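{- For every cut-free proof-structure $R$ of the fragment $(\neg ?\otimes)\mathit{LL}$ of $\mathit{MELL}$: $R\models\mathsf{ACC}_{\sharp\mathsf w}$ if and only if $R$ is sequentializable in $(\neg ?\otimes)\mathit{LL}$.
   Context: Formulae of $\mathit{MELL}$: $A::=X\mid\mathbf 1\mid\bot\mid A\otimes A\mid A\wp A\mid !A\mid ?A$, with $X$ ranging over a countably infinite set of atomic formulae equipped with a fixed-point-free involution $(\cdot)^\bot$ extended by De Morgan duality ($\mathbf 1/\bot$, $\otimes/\wp$, $!/?$). The fragment $(\neg ?\otimes)\mathit{LL}$ is the set of formulae of kind $A$ or $E$ given by $$A::=X\mid\mathbf 1\mid A\otimes A\mid A\wp A\mid A\wp E\mid E\wp A\mid !A\mid !E,\qquad E::=\bot\mid E\wp E\mid ?A\mid ?E.$$ Sequent calculus in a fragment $\mathcal F$ (all sequents are finite sequences of formulae of $\mathcal F$): axiom $\vdash A,A^\bot$; cut; exchange; $\otimes$ (from $\vdash\Gamma,A$ and $\vdash B,\Delta$ infer $\vdash\Gamma,A\otimes B,\Delta$); $\vdash\mathbf 1$; $\wp$ (from $\vdash\Gamma,A,B$ infer $\vdash\Gamma,A\wp B$); $\bot$ (from $\vdash\Gamma$ infer $\vdash\Gamma,\bot$); dereliction (from $\vdash\Gamma,A$ infer $\vdash\Gamma,?A$); weakening (from $\vdash\Gamma$ infer $\vdash\Gamma,?A$); contraction (from $\vdash\Gamma,?A,?A$ infer $\vdash\Gamma,?A$); promotion (from $\vdash ?\Gamma,A$ infer $\vdash ?\Gamma,!A$).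 Graphs are finite directed graphs (parallel arcs allowed, no loops); an arc is a conclusion of its tail and a premise of its head. A proof-structure (ps) of $\mathit{MELL}$ is defined inductively on depth: it is such a graph (the ground structure) without directed cycles, with nodes labelled $\mathtt{ax}$ (2 conclusions, no premise), $\mathtt{cut}$ (2 premises, no conclusion), $\mathtt 1$, $\bot$ or $?\mathtt w$ (1 conclusion, no premise), $\otimes$, $\wp$ or $?\mathtt c$ (2 premises, 1 conclusion; premises ordered for $\otimes,\wp$), $?\mathtt d$ (1 premise, 1 conclusion), $\bullet$ (1 premise, no conclusion), or box node (no premise, one principal conclusion and $k\ge0$ auxiliary conclusions), with a total order on its conclusions (the premises of $\bullet$ nodes); each box node comes with a ps (its content) of smaller depth whose conclusions are in bijection with the conclusions of the box node. Arcs are typed by formulae: dual types on the two conclusions of $\mathtt{ax}$ and the two premises of $\mathtt{cut}$; $\mathbf 1$, $\bot$, $B\otimes C$, $B\wp C$ for conclusions of $\mathtt 1,\bot,\otimes,\wp$ nodes; $?\mathtt d$ has premise of type $B$ and conclusion of type $?B$; $?\mathtt c$ has two premises and a conclusion of the same type $?B$; $?\mathtt w$ has conclusion of type $?B$; the principal conclusion of a box has type $!B$ where $B$ is the type of the corresponding conclusion of the content, and each auxiliary conclusion has a type $?C_i$ equal to the type of the corresponding conclusion of the content. It is a ps of a fragment $\mathcal F$ if all types (at every depth) are in $\mathcal F$; cut-free if it has no $\mathtt{cut}$ node at any depth. A switching $\varphi$ of the ground structure maps each $\wp$ and each $?\mathtt c$ node to one of its premises; the switching graph is obtained by redirecting the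 head of the other premise of each such node to a fresh $\bullet$ node (box nodes are treated as single nodes). $R\models\mathsf{ACC}_{\sharp\mathsf w}$ means: for every switching of the ground structure, the switching graph has no undirected cycle and its number of connected components equals (number of $\bot$ and $?\mathtt w$ nodes of the ground structure) $+1$, and, inductively, the content of every box satisfies $\mathsf{ACC}_{\sharp\mathsf w}$. Desequentialization $\pi\mapsto\pi^\circ$ maps a sequent calculus proof to a ps in the usual way, by induction on $\pi$: an axiom/$\mathbf 1$ rule gives a single $\mathtt{ax}$/$\mathtt 1$ node with conclusions pointing to $\bullet$ nodes; exchange permutes the conclusions; $\bot$ and weakening rules add disjointly a $\bot$ or $?\mathtt w$ node with conclusion pointing to a $\bullet$ node; $\wp$, contraction and dereliction rules add a $\wp$, $?\mathtt c$, $?\mathtt d$ node below the active conclusion(s); $\otimes$ and cut rules join the two disjoint ps by a $\otimes$ or $\mathtt{cut}$ node below the active conclusions; a promotion rule gives a single box node with conclusions pointing to $\bullet$ nodes, whose content is the ps of the premise. $R$ is sequentializable in $\mathcal F$ if $R=\pi^\circ$ (up to isomorphism) for some sequent calculus proof $\pi$ in $\mathcal F$. -}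

module Defs where

open import Data.Bool.Base using (Bool; true; false)
open import Data.Fin.Base using (Fin; zero; suc; _↑ˡ_; _↑ʳ_)
open import Data.Fin.Permutation using (Permutation; id; _⟨$⟩ʳ_)
open import Data.List.Base using (List; []; _∷_; length; filterᵇ)
import Data.List.Base as List
open import Data.List.Membership.Propositional using (_∈_)
open import Data.List.Relation.Unary.Unique.Propositional using (Unique)
open import Data.Nat.Base using (ℕ; suc; _+_)
open import Data.Product using (∃; ∃!; _×_)
open import Data.Sum.Base using (_⊎_)
open import Data.Unit.Base using (⊤)
open import Data.Vec.Base as Vec using (Vec; []; _∷_; _++_; lookup)
open import Data.Vec.Functional as F using ()
open import Data.Vec.Relation.Unary.All using (All)
open import Function.Base using (_∘_)
open import Function.Bundles using (_↔_; _⇔_)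
open import Function.Definitions using (Surjective)
open import Relation.Binary.Construct.Closure.Transitive using (TransClosure)
open import Relation.Binary.PropositionalEquality.Core using (_≡_; _≢_)
open import Relation.Nullary.Negation.Core using (¬_)

-- Finite directed multigraphs, described locally: each vertex lists the arcs
-- arriving at it (its premises) and the arcs leaving it (its conclusions).
record Graph : Set₁ where
  field
    Vertex Arc  : Set
    premises    : Vertex → List Arc
    conclusions : Vertex → List Arc

module _ (G : Graph) where
  open Graph G

  -- Every arc has exactly one tail and one head, and is listed once at each.
  record WellFormed : Set where
    field
      unique-premises    : ∀ v → Unique (premises v)
      unique-conclusions : ∀ v → Unique (conclusions v)
      tail               : ∀ a → ∃! _≡_ λ v → a ∈ conclusions v
      head               : ∀ a → ∃! _≡_ λ v → a ∈ premises v

  _─[_]→_ : Vertex → Arc → Vertex → Set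
  u ─[ a ]→ v = a ∈ conclusions u × a ∈ premises v

  NoDirectedCycle : Set
  NoDirectedCycle = ∀ v → ¬ TransClosure (λ u w → ∃ λ a → u ─[ a ]→ w) v v

  -- Walks ignoring the orientation of arcs.
  data Walk : Vertex → Vertex → Set where
    []       : ∀ {v} → Walk v v
    forward  : ∀ {u v w} a → u ─[ a ]→ v → Walk v w → Walk u w
    backward : ∀ {u v w} a → v ─[ a ]→ u → Walk v w → Walk u w

  walkArcs : ∀ {u v} → Walk u v → List Arc
  walkArcs []               = []
  walkArcs (forward  a _ w) = a ∷ walkArcs w
  walkArcs (backward a _ w) = a ∷ walkArcs w

  -- The vertices visited, without the last one.
  walkVertices : ∀ {u v} → Walk u v → List Vertex
  walkVertices []                       = []
  walkVertices (forward  {u = u} _ _ w) = u ∷ walkVertices w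
  walkVertices (backward {u = u} _ _ w) = u ∷ walkVertices w

  record IsCycle {v} (w : Walk v v) : Set where
    field
      nonempty        : walkArcs w ≢ []
      unique-arcs     : Unique (walkArcs w)
      unique-vertices : Unique (walkVertices w)

  NoUndirectedCycle : Set
  NoUndirectedCycle = ∀ {v} (w : Walk v v) → ¬ IsCycle w

  record HasComponents (k : ℕ) : Set where
    field
      component  : Vertex → Fin k
      surjective : Surjective _≡_ _≡_ component
      connected  : ∀ u v → component u ≡ component v ⇔ Walk u v

record Atoms : Set₁ where
  field
    Atom            : Set
    countable       : ℕ ↔ Atom
    dual            : Atom → Atom
    dual-involutive : ∀ X → dual (dual X) ≡ X
    dual-fixfree    : ∀ X → dual X ≢ X

module MELL (𝒜 : Atoms) where
  open Atoms 𝒜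

  infix  9 _^⊥
  infixr 8 !_ ⁇_
  infixr 7 _⊗_ _⅋_

  -- ⁇_ is the "why not" modality.
  data Formula : Set where
    atom    : Atom → Formula
    𝟏 ⊥     : Formula
    _⊗_ _⅋_ : Formula → Formula → Formula
    !_ ⁇_   : Formula → Formula

  _^⊥ : Formula → Formula
  (atom X) ^⊥ = atom (dual X)
  𝟏 ^⊥        = ⊥
  ⊥ ^⊥        = 𝟏
  (A ⊗ B) ^⊥  = A ^⊥ ⅋ B ^⊥
  (A ⅋ B) ^⊥  = A ^⊥ ⊗ B ^⊥
  (! A) ^⊥    = ⁇ (A ^⊥)
  (⁇ A) ^⊥    = ! (A ^⊥)

  Fragment : Set₁
  Fragment = Formula → Set

  data KindA : Formula → Set
  data KindE : Formula → Set

  data KindA where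
    atom : ∀ X → KindA (atom X)
    𝟏    : KindA 𝟏
    _⊗_  : ∀ {A B} → KindA A → KindA B → KindA (A ⊗ B)
    _⅋_  : ∀ {A B} → KindA A → KindA B → KindA (A ⅋ B)
    _⅋ʳ_ : ∀ {A E} → KindA A → KindE E → KindA (A ⅋ E)
    _⅋ˡ_ : ∀ {E A} → KindE E → KindA A → KindA (E ⅋ A)
    !ᴬ_  : ∀ {A} → KindA A → KindA (! A)
    !ᴱ_  : ∀ {E} → KindE E → KindA (! E)

  data KindE where
    ⊥    : KindE ⊥
    _⅋_  : ∀ {E F} → KindE E → KindE F → KindE (E ⅋ F)
    ⁇ᴬ_  : ∀ {A} → KindA A → KindE (⁇ A)
    ⁇ᴱ_  : ∀ {E} → KindE E → KindE (⁇ E)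

  ¬?⊗LL : Fragment
  ¬?⊗LL A = KindA A ⊎ KindE A

  -- In the exchange rule, σ sends positions of the conclusion to positions of
  -- the premise.
  data Proof (ℱ : Fragment) : ∀ {n} → Vec Formula n → Set where
    axiom : ∀ {A} →
      All ℱ (A ∷ A ^⊥ ∷ []) →
      Proof ℱ (A ∷ A ^⊥ ∷ [])
    cut : ∀ {k l} {Γ : Vec Formula k} {A} {Δ : Vec Formula l} →
      All ℱ (Γ ++ Δ) →
      Proof ℱ (Γ ++ A ∷ []) → Proof ℱ (A ^⊥ ∷ Δ) →
      Proof ℱ (Γ ++ Δ)
    exchange : ∀ {m n} {Γ : Vec Formula n} {Δ : Vec Formula m} →
      All ℱ Δ →
      (σ : Permutation m n) → (∀ i → lookup Δ i ≡ lookup Γ (σ ⟨$⟩ʳ i)) →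
      Proof ℱ Γ → Proof ℱ Δ
    tensor : ∀ {k l} {Γ : Vec Formula k} {A B} {Δ : Vec Formula l} →
      All ℱ (Γ ++ A ⊗ B ∷ Δ) →
      Proof ℱ (Γ ++ A ∷ []) → Proof ℱ (B ∷ Δ) →
      Proof ℱ (Γ ++ A ⊗ B ∷ Δ)
    one :
      All ℱ (𝟏 ∷ []) →
      Proof ℱ (𝟏 ∷ [])
    par : ∀ {k} {Γ : Vec Formula k} {A B} →
      All ℱ (Γ ++ A ⅋ B ∷ []) →
      Proof ℱ (Γ ++ A ∷ B ∷ []) → Proof ℱ (Γ ++ A ⅋ B ∷ [])
    bottom : ∀ {k} {Γ : Vec Formula k} →
      All ℱ (Γ ++ ⊥ ∷ []) →
      Proof ℱ Γ → Proof ℱ (Γ ++ ⊥ ∷ [])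
    dereliction : ∀ {k} {Γ : Vec Formula k} {A} →
      All ℱ (Γ ++ ⁇ A ∷ []) →
      Proof ℱ (Γ ++ A ∷ []) → Proof ℱ (Γ ++ ⁇ A ∷ [])
    weakening : ∀ {k} {Γ : Vec Formula k} {A} →
      All ℱ (Γ ++ ⁇ A ∷ []) →
      Proof ℱ Γ → Proof ℱ (Γ ++ ⁇ A ∷ [])
    contraction : ∀ {k} {Γ : Vec Formula k} {A} →
      All ℱ (Γ ++ ⁇ A ∷ []) →
      Proof ℱ (Γ ++ ⁇ A ∷ ⁇ A ∷ []) → Proof ℱ (Γ ++ ⁇ A ∷ [])
    promotion : ∀ {k} {Γ : Vec Formula k} {A} →
      All ℱ (Vec.map ⁇_ Γ ++ ! A ∷ []) →
      Proof ℱ (Vec.map ⁇_ Γ ++ A ∷ []) → Proof ℱ (Vec.map ⁇_ Γ ++ ! A ∷ [])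

  -- A node other than •, together with its incident arcs (premises first, then
  -- conclusions; the order is immaterial for ax, cut and for the premises of
  -- contr: see _≈_).  A box lists its conclusions in the order given by the
  -- bijection with those of its content; the Fin c points at the principal one.
  data Node (m : ℕ) : Set
  record PreStructure (c : ℕ) : Set

  data Node m where
    ax       : (a b : Fin m) → Node m
    cut      : (p q : Fin m) → Node m
    one bot  : (a : Fin m) → Node m
    tensor   : (p q a : Fin m) → Node m
    par      : (p q a : Fin m) → Node m
    weak     : (a : Fin m) → Node m
    contr    : (p q a : Fin m) → Node m
    der      : (p a : Fin m) → Node m
    box      : ∀ {c} → PreStructure c → Fin c → Vec (Fin m) c → Node m

  -- Structures with c ordered conclusions.  The • nodes are the elements of
  -- Fin c, and their premises are given by concl.
  record PreStructure c where
    inductive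
    field
      nodes arcs : ℕ
      type       : Fin arcs → Formula
      node       : Fin nodes → Node arcs
      concl      : Vec (Fin arcs) c

  open PreStructure public

  private variable
    c d m n : ℕ

  premises conclusions : Node m → List (Fin m)
  premises (ax a b)       = []
  premises (cut p q)      = p ∷ q ∷ []
  premises (one a)        = []
  premises (bot a)        = []
  premises (tensor p q a) = p ∷ q ∷ []
  premises (par p q a)    = p ∷ q ∷ []
  premises (weak a)       = []
  premises (contr p q a)  = p ∷ q ∷ []
  premises (der p a)      = p ∷ []
  premises (box S i as)   = []

  conclusions (ax a b)       = a ∷ b ∷ []
  conclusions (cut p q)      = []
  conclusions (one a)        = a ∷ []
  conclusions (bot a)        = a ∷ []
  conclusions (tensor p q a) = a ∷ []
  conclusions (par p q a)    = a ∷ []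
  conclusions (weak a)       = a ∷ []
  conclusions (contr p q a)  = a ∷ []
  conclusions (der p a)      = a ∷ []
  conclusions (box S i as)   = Vec.toList as

  data Vertex (R : PreStructure c) : Set where
    internal : Fin (nodes R) → Vertex R
    •        : Fin c → Vertex R

  ground : PreStructure c → Graph
  Graph.Vertex      (ground R)              = Vertex R
  Graph.Arc         (ground R)              = Fin (arcs R)
  Graph.premises    (ground R) (internal v) = premises (node R v)
  Graph.premises    (ground R) (• i)        = lookup (concl R) i ∷ []
  Graph.conclusions (ground R) (internal v) = conclusions (node R v)
  Graph.conclusions (ground R) (• i)        = []

  WellTyped : (Fin m → Formula) → Node m → Set
  WellTyped τ (ax a b)       = τ b ≡ τ a ^⊥
  WellTyped τ (cut p q)      = τ q ≡ τ p ^⊥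
  WellTyped τ (one a)        = τ a ≡ 𝟏
  WellTyped τ (bot a)        = τ a ≡ ⊥
  WellTyped τ (tensor p q a) = τ a ≡ τ p ⊗ τ q
  WellTyped τ (par p q a)    = τ a ≡ τ p ⅋ τ q
  WellTyped τ (weak a)       = ∃ λ B → τ a ≡ ⁇ B
  WellTyped τ (contr p q a)  = ∃ λ B → τ p ≡ ⁇ B × τ q ≡ ⁇ B × τ a ≡ ⁇ B
  WellTyped τ (der p a)      = τ a ≡ ⁇ τ p
  WellTyped τ (box S i as)   =
    τ (lookup as i) ≡ ! σ i ×
    (∀ j → j ≢ i → ∃ λ C → τ (lookup as j) ≡ ⁇ C × σ j ≡ ⁇ C)
    where
    σ : Fin _ → Formula
    σ j = type S (lookup (concl S) j)

  -- Vacuous on nodes that are not boxes.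
  Content : (∀ {c} → PreStructure c → Set) → Node m → Set
  Content P (box S _ _) = P S
  Content P _           = ⊤

  record IsProofStructure (R : PreStructure c) : Set where
    inductive
    field
      well-formed : WellFormed (ground R)
      acyclic     : NoDirectedCycle (ground R)
      well-typed  : ∀ v → WellTyped (type R) (node R v)
      contents    : ∀ v → Content IsProofStructure (node R v)

  record _OfFragment_ (R : PreStructure c) (ℱ : Fragment) : Set where
    inductive
    field
      types    : ∀ a → ℱ (type R a)
      contents : ∀ v → Content (_OfFragment ℱ) (node R v)

  record CutFree (R : PreStructure c) : Set where
    inductive
    field
      no-cut   : ∀ v p q → node R v ≢ cut p q
      contents : ∀ v → Content CutFree (node R v)

  data IsSwitch {m} : Node m → Set where
    par   : ∀ {p q a} → IsSwitch (par p q a)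
    contr : ∀ {p q a} → IsSwitch (contr p q a)

  data Side : Set where
    left right : Side

  kept detached : ∀ {x : Node m} → IsSwitch x → Side → Fin m
  kept (par {p} {q})   left  = p
  kept (par {p} {q})   right = q
  kept (contr {p} {q}) left  = p
  kept (contr {p} {q}) right = q

  detached s left  = kept s right
  detached s right = kept s left

  Switching : PreStructure c → Set
  Switching R = ∀ v → IsSwitch (node R v) → Side

  switchedPremises : (x : Node m) → (IsSwitch x → Side) → List (Fin m)
  switchedPremises (par p q a)   φ = kept {x = par p q a} par (φ par) ∷ []
  switchedPremises (contr p q a) φ = kept {x = contr p q a} contr (φ contr) ∷ []
  switchedPremises x             φ = premises x

  -- fresh v s is the • node receiving the premise of v that is not selected.
  data SwitchVertex (R : PreStructure c) : Set where
    internal : Fin (nodes R) → SwitchVertex R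
    •        : Fin c → SwitchVertex R
    fresh    : ∀ v → IsSwitch (node R v) → SwitchVertex R

  switchingGraph : (R : PreStructure c) → Switching R → Graph
  Graph.Vertex      (switchingGraph R φ)              = SwitchVertex R
  Graph.Arc         (switchingGraph R φ)              = Fin (arcs R)
  Graph.premises    (switchingGraph R φ) (internal v) = switchedPremises (node R v) (φ v)
  Graph.premises    (switchingGraph R φ) (• i)        = lookup (concl R) i ∷ []
  Graph.premises    (switchingGraph R φ) (fresh v s)  = detached s (φ v s) ∷ []
  Graph.conclusions (switchingGraph R φ) (internal v) = conclusions (node R v)
  Graph.conclusions (switchingGraph R φ) (• i)        = []
  Graph.conclusions (switchingGraph R φ) (fresh v s)  = []

  isWeakening : Node m → Bool
  isWeakening (bot _)  = true
  isWeakening (weak _) = true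
  isWeakening _        = false

  ♯w : PreStructure c → ℕ
  ♯w R = length (filterᵇ (isWeakening ∘ node R) (List.allFin (nodes R)))

  record ACC♯w (R : PreStructure c) : Set where
    inductive
    field
      acyclic    : (φ : Switching R) → NoUndirectedCycle (switchingGraph R φ)
      components : (φ : Switching R) → HasComponents (switchingGraph R φ) (♯w R + 1)
      contents   : ∀ v → Content ACC♯w (node R v)

  mapNode : (Fin m → Fin n) → Node m → Node n
  mapNode f (ax a b)       = ax (f a) (f b)
  mapNode f (cut p q)      = cut (f p) (f q)
  mapNode f (one a)        = one (f a)
  mapNode f (bot a)        = bot (f a)
  mapNode f (tensor p q a) = tensor (f p) (f q) (f a)
  mapNode f (par p q a)    = par (f p) (f q) (f a)
  mapNode f (weak a)       = weak (f a)
  mapNode f (contr p q a)  = contr (f p) (f q) (f a)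
  mapNode f (der p a)      = der (f p) (f a)
  mapNode f (box S i as)   = box S i (Vec.map f as)

  -- Isomorphisms, relative to a bijection ρ between the conclusions.  That an
  -- isomorphism preserves tails and heads is part of the field node-≈.  For box
  -- nodes, contents are related along the bijection imposed by the conclusions
  -- of the box; the order of the conclusions of the content plays no other role.
  data _≈_ {m} : Node m → Node m → Set
  record Iso (ρ : Permutation c d) (R : PreStructure c) (S : PreStructure d) : Set

  data _≈_ {m} where
    same       : ∀ {x} → x ≈ x
    swap-ax    : ∀ {a b} → ax a b ≈ ax b a
    swap-cut   : ∀ {p q} → cut p q ≈ cut q p
    swap-contr : ∀ {p q a} → contr p q a ≈ contr q p a
    box        : ∀ {c d} {R : PreStructure c} {S : PreStructure d} {i j as bs}
                 (ρ : Permutation c d) → Iso ρ R S → ρ ⟨$⟩ʳ i ≡ j →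
                 (∀ k → lookup bs (ρ ⟨$⟩ʳ k) ≡ lookup as k) →
                 box R i as ≈ box S j bs

  record Iso ρ R S where
    inductive
    field
      nodeBij : Permutation (nodes R) (nodes S)
      arcBij  : Permutation (arcs R) (arcs S)
      type-≡  : ∀ a → type S (arcBij ⟨$⟩ʳ a) ≡ type R a
      node-≈  : ∀ v → mapNode (arcBij ⟨$⟩ʳ_) (node R v) ≈ node S (nodeBij ⟨$⟩ʳ v)
      concl-≡ : ∀ i → lookup (concl S) (ρ ⟨$⟩ʳ i) ≡ arcBij ⟨$⟩ʳ lookup (concl R) i

  _≅_ : PreStructure c → PreStructure c → Set
  R ≅ S = Iso id R S

  -- Add a node; if it has a conclusion, that is the new arc zero, and the arc a
  -- of R becomes suc a.
  addNode : (R : PreStructure c) → Formula → Node (suc (arcs R)) →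
            Vec (Fin (suc (arcs R))) d → PreStructure d
  addNode R A x as = record
    { nodes = suc (nodes R)
    ; arcs  = suc (arcs R)
    ; type  = A F.∷ type R
    ; node  = x F.∷ (mapNode suc ∘ node R)
    ; concl = as
    }

  addLeaf : PreStructure c → Formula → (∀ {m} → Fin m → Node m) → PreStructure (c + 1)
  addLeaf R A x = addNode R A (x zero) (Vec.map suc (concl R) ++ zero ∷ [])

  addUnary : (k : ℕ) → PreStructure (k + 1) → Formula →
             (∀ {m} → Fin m → Fin m → Node m) → PreStructure (k + 1)
  addUnary k R A x =
    addNode R A (x (suc (lookup (concl R) (k ↑ʳ zero))) zero)
            (Vec.map suc (Vec.take k (concl R)) ++ zero ∷ [])

  addBinary : (k : ℕ) → PreStructure (k + 2) → Formula →
              (∀ {m} → Fin m → Fin m → Fin m → Node m) → PreStructure (k + 1)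
  addBinary k R A x =
    addNode R A (x (suc (lookup (concl R) (k ↑ʳ zero)))
                   (suc (lookup (concl R) (k ↑ʳ suc zero)))
                   zero)
            (Vec.map suc (Vec.take k (concl R)) ++ zero ∷ [])

  permute : Permutation d c → PreStructure c → PreStructure d
  permute σ R = record
    { nodes = nodes R
    ; arcs  = arcs R
    ; type  = type R
    ; node  = node R
    ; concl = Vec.tabulate λ i → lookup (concl R) (σ ⟨$⟩ʳ i)
    }

  -- The last conclusion of R and the first one of S become the premises of a
  -- new ⊗ node, respectively cut node.
  module Join {k l} (R : PreStructure (k + 1)) (S : PreStructure (suc l)) where

    inR : Fin (arcs R) → Fin (arcs R + arcs S)
    inR a = a ↑ˡ arcs S

    inS : Fin (arcs S) → Fin (arcs R + arcs S)
    inS a = arcs R ↑ʳ a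

    p q : Fin (arcs R + arcs S)
    p = inR (lookup (concl R) (k ↑ʳ zero))
    q = inS (Vec.head (concl S))

    Γ : Vec (Fin (arcs R + arcs S)) k
    Γ = Vec.map inR (Vec.take k (concl R))

    Δ : Vec (Fin (arcs R + arcs S)) l
    Δ = Vec.map inS (Vec.tail (concl S))

    union : PreStructure ((k + 1) + suc l)
    union = record
      { nodes = nodes R + nodes S
      ; arcs  = arcs R + arcs S
      ; type  = type R F.++ type S
      ; node  = (mapNode inR ∘ node R) F.++ (mapNode inS ∘ node S)
      ; concl = Vec.map inR (concl R) ++ Vec.map inS (concl S)
      }

    addTensor : Formula → PreStructure (k + suc l)
    addTensor A = addNode union A (tensor (suc p) (suc q) zero)
                          (Vec.map suc Γ ++ zero ∷ Vec.map suc Δ)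

    addCut : PreStructure (k + l)
    addCut = record
      { nodes = suc (nodes union)
      ; arcs  = arcs union
      ; type  = type union
      ; node  = cut p q F.∷ node union
      ; concl = Γ ++ Δ
      }

  singleNode : (Γ : Vec Formula c) → Node c → PreStructure c
  singleNode {c} Γ x = record
    { nodes = 1
    ; arcs  = c
    ; type  = lookup Γ
    ; node  = λ _ → x
    ; concl = Vec.allFin c
    }

  desequentialize : ∀ {ℱ} {Γ : Vec Formula c} → Proof ℱ Γ → PreStructure c
  desequentialize (axiom {A} _) = singleNode (A ∷ A ^⊥ ∷ []) (ax zero (suc zero))
  desequentialize (cut _ π₁ π₂) =
    Join.addCut (desequentialize π₁) (desequentialize π₂)
  desequentialize (exchange _ σ _ π) = permute σ (desequentialize π)
  desequentialize (tensor {A = A} {B} _ π₁ π₂) =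
    Join.addTensor (desequentialize π₁) (desequentialize π₂) (A ⊗ B)
  desequentialize (one _) = singleNode (𝟏 ∷ []) (one zero)
  desequentialize (par {k} {A = A} {B} _ π) =
    addBinary k (desequentialize π) (A ⅋ B) par
  desequentialize (bottom _ π) = addLeaf (desequentialize π) ⊥ bot
  desequentialize (dereliction {k} {A = A} _ π) =
    addUnary k (desequentialize π) (⁇ A) der
  desequentialize (weakening {A = A} _ π) = addLeaf (desequentialize π) (⁇ A) weak
  desequentialize (contraction {k} {A = A} _ π) =
    addBinary k (desequentialize π) (⁇ A) contr
  desequentialize (promotion {k} {Γ} {A} _ π) =
    singleNode (Vec.map ⁇_ Γ ++ ! A ∷ [])
               (box (desequentialize π) (k ↑ʳ zero) (Vec.allFin (k + 1)))

  Sequentializable : Fragment → PreStructure c → Set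
  Sequentializable {c} ℱ R =
    ∃ λ (Γ : Vec Formula c) → ∃ λ (π : Proof ℱ Γ) → R ≅ desequentialize π

{-# OPTIONS --safe #-}
module Submission where

{- A structure R is acyclic and connected in the required sense exactly when its
nodes can be collected into one sequentializable cluster.

Euler's formula for forests turns ACC♯w into the count
#(ax, 𝟏, box nodes) = #(⊗ nodes) + 1, and conversely lets this count and an upper
bound on the number of components replace a proof of acyclicity.

For the direct implication, parse R from the top.  First collect the trees whose
leaves are all ⊥ or ?w nodes; in the fragment their roots have kind E, hence are
never premises of ⊗.  Then start with one cluster for each initial node and let
clusters absorb der, ⅋, ?c nodes and trees, or merge at ⊗ nodes, keeping one more
cluster than there are ⊗ nodes waiting.  As long as there are several clusters and
none can absorb a node, each cluster has an output that is a premise of a waiting ⊗: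
otherwise, detaching its outputs at all ⅋ and ?c nodes, and the trees likewise,
gives a switching with ♯w + 2 components, which are told apart by a colouring.  By
the count, two clusters then share a ⊗ node, and merge there. -}

open import Defs
open import Algebra.Bundles using (CommutativeMonoid)
import Algebra.Solver.CommutativeMonoid
open import Data.Bool.Base using (Bool; true; false; if_then_else_) renaming (T to IsTrue)
open import Data.Bool.Properties using (T-≡; T?)
open import Data.Empty using (⊥-elim) renaming (⊥ to Empty)
open import Data.Fin.Base using (Fin; zero; suc; _↑ˡ_; _↑ʳ_; punchIn; punchOut; splitAt; toℕ)
open import Data.Fin.Induction using (spo-wellFounded)
open import Data.Fin.Permutation as Perm
  using (Permutation; _⟨$⟩ʳ_; _⟨$⟩ˡ_; _∘ₚ_; inverseʳ; inverseˡ)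
open import Data.Fin.Properties as Fin
  using (injective⇒≤; pigeonhole; punchIn-punchOut; punchInᵢ≢i; punchOut-cong; punchOut-injective)
open import Data.List.Base as List
  using (List; []; _∷_; [_]; length; concatMap; tabulate; allFin; filterᵇ)
  renaming (_++_ to _⊕_)
import Data.List.Properties as List
open import Data.List.Membership.Propositional using (_∈_; _∉_; find; lose)
open import Data.List.Membership.Propositional.Properties
  using (∈-++⁺ˡ; ∈-++⁺ʳ; ∈-++⁻; ∈-allFin; ∈-tabulate⁺; ∈-tabulate⁻; ∈-lookup; ∈-∃++; ∈-map⁺; ∈-map⁻; ∈-filter⁺; ∈-filter⁻; ∈-concatMap⁺; ∈-concatMap⁻)
open import Data.List.Membership.Propositional.Properties.WithK using (unique∧set⇒bag)
import Data.List.Membership.DecPropositional as DecMembership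
open import Data.List.Relation.Binary.BagAndSetEquality using (∼bag⇒↭)
open import Data.List.Relation.Binary.Permutation.Homogeneous using (onIndices)
open import Data.List.Relation.Binary.Permutation.Propositional
  as ↭ using (_↭_; ↭-refl; ↭-sym; ↭-trans; ↭-reflexive; ↭-prep; ↭⇒↭ₛ)
open import Data.List.Relation.Binary.Permutation.Propositional.Properties
  using (∈-resp-↭; map⁺; ++⁺; ++⁺ˡ; ++⁺ʳ; drop-∷; shift; ++-comm; ↭-length; ++-commutativeMonoid)
import Data.List.Relation.Binary.Permutation.Setoid.Properties as Permutationₛ
open import Data.List.Relation.Unary.All as All using (All; []; _∷_)
import Data.List.Relation.Unary.All.Properties as All
open import Data.List.Relation.Unary.AllPairs using ([]; _∷_)
open import Data.List.Relation.Unary.Any as Any using (Any; here; there; any?)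
open import Data.List.Relation.Unary.Any.Properties using (lookup-index)
open import Data.List.Relation.Unary.Unique.Propositional using (Unique)
open import Data.List.Relation.Unary.Unique.Propositional.Properties as Unique
  using (allFin⁺; Unique[x∷xs]⇒x∉xs)
open import Data.Nat.Base using (ℕ; zero; suc; _+_; _≤_; _<_; s≤s; z≤n)
open import Data.Nat.ListAction using (sum)
open import Data.Nat.ListAction.Properties using (sum-++; sum-↭)
open import Data.Nat.Properties as ℕ
  using (+-suc; +-comm; +-cancelˡ-≡; +-cancelʳ-≡; suc-injective)
open import Data.Nat.Solver using (module +-*-Solver)
open import Data.Product using (∃; ∃₂; Σ; _×_; _,_; proj₁; proj₂)
open import Data.Sum.Base using (_⊎_; inj₁; inj₂; [_,_]′)
open import Data.Unit.Base using (⊤; tt)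
open import Data.Vec.Base as Vec using (Vec; []; _∷_; _++_; lookup; toList; fromList)
import Data.Vec.Functional as F
import Data.Vec.Functional.Properties as F
import Data.Vec.Properties as Vec
open import Data.Vec.Relation.Unary.All using ([]; _∷_) renaming (All to AllV)
open import Function.Base using (_∘_; id; case_of_)
open import Function.Bundles using (_⇔_; mk⇔; Equivalence)
open import Function.Definitions using (Injective)
open import Induction.WellFounded using (Acc; acc; WellFounded)
open import Relation.Binary.Construct.Closure.Transitive as Plus using (TransClosure)
open import Relation.Binary.PropositionalEquality
  using (_≡_; _≢_; refl; sym; trans; cong; cong₂; subst; subst₂; setoid; isEquivalence; module ≡-Reasoning)
open import Relation.Nullary.Decidable using (Dec; yes; no; dec-true; dec-false; _×-dec_; _⊎-dec_; map′)
open import Relation.Nullary.Negation using (¬_; contradiction)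

-- `ACC♯w` counts components, but neither it nor R says to which part of R a ⊥ or ?w node should be
-- attached. The choice is harmless for a tree topped by such nodes only: it needs a cluster as a
-- host, but no particular one (`graft`). Under a ⊗ this freedom would be lost, since each premise
-- of a ⊗ rule comes from a proof of its own; this is the obstacle that the fragment removes.
--
-- Both implications pass through `Seq`, the trace of a cut-free proof that keeps only the nodes
-- used on one level and the arcs left open. The order of conclusions, the sequents and the box
-- contents are dealt with when translating between `Seq` and `Proof`, so the graph-theoretic
-- argument never sees a sequent and is applied afresh to each box content.

module ↭Solver {X : Set} =
  Algebra.Solver.CommutativeMonoid (++-commutativeMonoid {A = X})

private variable
  X Y : Set
  m n : ℕ

-- Lists up to permutation, and finite sums

unique-↭ : {xs ys : List X} → Unique xs → Unique ys →
           (∀ {x} → x ∈ xs → x ∈ ys) → (∀ {x} → x ∈ ys → x ∈ xs) → xs ↭ ys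
unique-↭ uxs uys to from = ∼bag⇒↭ (unique∧set⇒bag uxs uys (mk⇔ to from))

Unique-resp-↭ : {xs ys : List X} → xs ↭ ys → Unique xs → Unique ys
Unique-resp-↭ p = Permutationₛ.Unique-resp-↭ (setoid _) (↭⇒↭ₛ p)

Unique-++⁻ˡ : (xs : List X) {ys : List X} → Unique (xs ⊕ ys) → Unique xs
Unique-++⁻ˡ []       u       = []
Unique-++⁻ˡ (x ∷ xs) (n ∷ u) = All.++⁻ˡ xs n ∷ Unique-++⁻ˡ xs u

Unique-++⁻ʳ : (xs : List X) {ys : List X} → Unique (xs ⊕ ys) → Unique ys
Unique-++⁻ʳ []       u       = u
Unique-++⁻ʳ (x ∷ xs) (n ∷ u) = Unique-++⁻ʳ xs u

Unique-++-disjoint : (xs : List X) {ys : List X} → Unique (xs ⊕ ys) →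
                     ∀ {x} → x ∈ xs → x ∉ ys
Unique-++-disjoint (x ∷ xs) (n ∷ u) (here refl) x∈ys = All.lookup (All.++⁻ʳ xs n) x∈ys refl
Unique-++-disjoint (x ∷ xs) (n ∷ u) (there i)   x∈ys = Unique-++-disjoint xs u i x∈ys

∈⇒↭∷ : {x : X} {xs : List X} → x ∈ xs → ∃ λ ys → xs ↭ x ∷ ys
∈⇒↭∷ x∈xs with ys , zs , refl ← ∈-∃++ x∈xs = ys ⊕ zs , shift _ ys zs

∈∈⇒↭∷∷ : {x y : X} {xs : List X} → x ∈ xs → y ∈ xs → x ≢ y →
          ∃ λ zs → xs ↭ x ∷ y ∷ zs
∈∈⇒↭∷∷ x∈ y∈ x≢y with ys , p ← ∈⇒↭∷ x∈ with ∈-resp-↭ p y∈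
... | here refl  = contradiction refl x≢y
... | there y∈ys with zs , q ← ∈⇒↭∷ y∈ys = zs , ↭-trans p (↭-prep _ q)

++-cancelˡ-↭ : (zs : List X) {xs ys : List X} → zs ⊕ xs ↭ zs ⊕ ys → xs ↭ ys
++-cancelˡ-↭ []       p = p
++-cancelˡ-↭ (z ∷ zs) p = ++-cancelˡ-↭ zs (drop-∷ p)

concatMap-↭ : (f : X → List Y) {xs ys : List X} → xs ↭ ys → concatMap f xs ↭ concatMap f ys
concatMap-↭ f ↭.refl = ↭-refl
concatMap-↭ f (↭.prep x p) = ++⁺ˡ (f x) (concatMap-↭ f p)
concatMap-↭ f {ys = _ ∷ _ ∷ ys} (↭.swap x y p) = ↭-trans
  (++⁺ˡ (f x) (++⁺ˡ (f y) (concatMap-↭ f p)))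
  (solve 3 (λ a b c → a ⊙ b ⊙ c ⊜ b ⊙ a ⊙ c) ↭-refl (f x) (f y) (concatMap f ys))
  where
  open ↭Solver using (solve; _⊜_) renaming (_⊕_ to _⊙_)
concatMap-↭ f (↭.trans p q) = ↭-trans (concatMap-↭ f p) (concatMap-↭ f q)

∈-concatMap : {f : X → List Y} {x : X} {y : Y} {xs : List X} →
              x ∈ xs → y ∈ f x → y ∈ concatMap f xs
∈-concatMap {f = f} x∈xs y∈fx = ∈-concatMap⁺ f (lose x∈xs y∈fx)

concatMap-∈ : (f : X → List Y) {y : Y} (xs : List X) →
              y ∈ concatMap f xs → ∃ λ x → x ∈ xs × y ∈ f x
concatMap-∈ f xs y∈ = find (∈-concatMap⁻ f y∈)

Unique-concatMap : {f : X → List Y} {xs : List X} → Unique xs → (∀ x → Unique (f x)) →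
                   (∀ {x x′ y} → y ∈ f x → y ∈ f x′ → x ≡ x′) → Unique (concatMap f xs)
Unique-concatMap [] u inj = []
Unique-concatMap {f = f} {_ ∷ xs} (n ∷ us) u inj =
  Unique.++⁺ (u _) (Unique-concatMap us u inj) λ where
    (i , j) → case concatMap-∈ f xs j of λ where
      (x′ , x′∈ , j′) → All.lookup n x′∈ (inj i j′)

∑ : List X → (X → ℕ) → ℕ
∑ xs f = sum (List.map f xs)

∑-↭ : (f : X → ℕ) {xs ys : List X} → xs ↭ ys → ∑ xs f ≡ ∑ ys f
∑-↭ f p = sum-↭ (map⁺ f p)

∑-++ : (f : X → ℕ) (xs ys : List X) → ∑ (xs ⊕ ys) f ≡ ∑ xs f + ∑ ys f
∑-++ f xs ys = trans (cong sum (List.map-++ f xs ys)) (sum-++ (List.map f xs) _)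

∑-+ : (f g : X → ℕ) (xs : List X) → ∑ xs (λ x → f x + g x) ≡ ∑ xs f + ∑ xs g
∑-+ f g []       = refl
∑-+ f g (x ∷ xs) rewrite ∑-+ f g xs =
  solve 4 (λ a b c d → (a :+ b) :+ (c :+ d) := (a :+ c) :+ (b :+ d)) refl (f x) (g x) (∑ xs f) (∑ xs g)
  where open +-*-Solver

∑-cong : {f g : X → ℕ} (xs : List X) → (∀ x → f x ≡ g x) → ∑ xs f ≡ ∑ xs g
∑-cong xs f≗g = cong sum (List.map-cong f≗g xs)

∑-zero : {f : X → ℕ} (xs : List X) → (∀ {x} → x ∈ xs → f x ≡ 0) → ∑ xs f ≡ 0
∑-zero []       z = refl
∑-zero (x ∷ xs) z = cong₂ _+_ (z (here refl)) (∑-zero xs (z ∘ there))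

∑-member : (f : X → ℕ) {x : X} {xs : List X} → x ∈ xs → f x ≤ ∑ xs f
∑-member f {x} (here refl)  = ℕ.m≤m+n (f x) _
∑-member f     (there x∈xs) = ℕ.≤-trans (∑-member f x∈xs) (ℕ.m≤n+m _ _)

length-concatMap : (f : X → List Y) (xs : List X) → length (concatMap f xs) ≡ ∑ xs (length ∘ f)
length-concatMap f []       = refl
length-concatMap f (x ∷ xs) =
  trans (List.length-++ (f x)) (cong (length (f x) +_) (length-concatMap f xs))

toList-tabulate : (xs : Vec X n) → toList xs ≡ tabulate (lookup xs)
toList-tabulate []       = refl
toList-tabulate (x ∷ xs) = cong (x ∷_) (toList-tabulate xs)

tabulate-++ : ∀ m {n} (f : Fin (m + n) → X) →
              tabulate f ≡ tabulate (f ∘ (_↑ˡ n)) ⊕ tabulate (f ∘ (m ↑ʳ_))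
tabulate-++ zero    f = refl
tabulate-++ (suc m) f = cong (f zero ∷_) (tabulate-++ m (f ∘ suc))

-- Lists up to `_↭_` carry the combinatorics, while `exchange` and `Iso` ask for bijections of
-- indices; this lemma and `↭-permute` translate between the two.
permute-↭ : {f : Fin m → X} {g : Fin n → X} (σ : Permutation m n) →
            (∀ i → f i ≡ g (σ ⟨$⟩ʳ i)) → tabulate f ↭ tabulate g
permute-↭ {f = f} {g} σ eq = subst₂ _↭_
  (trans (List.map-tabulate _ g) (List.tabulate-cong (sym ∘ eq)))
  (List.map-tabulate id g)
  (map⁺ g (unique-↭ (Unique.tabulate⁺ inj) (allFin⁺ _) (λ {x} _ → ∈-allFin x) onto))
  where
  inj : ∀ {i j} → σ ⟨$⟩ʳ i ≡ σ ⟨$⟩ʳ j → i ≡ j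
  inj e = trans (sym (inverseˡ σ)) (trans (cong (σ ⟨$⟩ˡ_) e) (inverseˡ σ))
  onto : ∀ {x} → x ∈ allFin _ → x ∈ tabulate (σ ⟨$⟩ʳ_)
  onto {x} _ = subst (_∈ _) (inverseʳ σ) (∈-tabulate⁺ (σ ⟨$⟩ˡ x))

↭-permute : {f : Fin m → X} {g : Fin n → X} → tabulate f ↭ tabulate g →
            ∃ λ (σ : Permutation m n) → ∀ i → f i ≡ g (σ ⟨$⟩ʳ i)
↭-permute {f = f} {g} p = σ , eq
  where
  q = ↭⇒↭ₛ p
  σ : Permutation _ _
  σ = Perm.cast-id (sym (List.length-tabulate f)) ∘ₚ onIndices q ∘ₚ Perm.cast-id (List.length-tabulate g)
  lookup-g : ∀ j → List.lookup (tabulate g) j ≡ g (Perm.cast-id (List.length-tabulate g) ⟨$⟩ʳ j)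
  lookup-g j = trans
    (cong (List.lookup (tabulate g)) (sym (inverseˡ (Perm.cast-id (List.length-tabulate g)))))
    (List.lookup-tabulate g _)
  eq : ∀ i → f i ≡ g (σ ⟨$⟩ʳ i)
  eq i = trans (sym (List.lookup-tabulate f i))
         (trans (Permutationₛ.onIndices-lookup (setoid _) q _) (lookup-g _))

-- Finite graphs: walks, components and Euler's formula

record FiniteGraph (G : Graph) : Set where
  open Graph G public
  field
    src tgt          : Arc → Vertex
    edge             : ∀ a → _─[_]→_ G (src a) a (tgt a)
    src-unique       : ∀ {a v} → a ∈ conclusions v → v ≡ src a
    tgt-unique       : ∀ {a v} → a ∈ premises v → v ≡ tgt a
    size             : ℕ
    index            : Vertex → Fin size
    index-injective  : Injective _≡_ _≡_ index
    index-surjective : ∀ i → ∃ λ v → index v ≡ i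

module _ {G : Graph} (𝔾 : FiniteGraph G) where
  open FiniteGraph 𝔾
  private
    _≟ᵛ_ : (u v : Vertex) → Dec (u ≡ v)
    u ≟ᵛ v = map′ index-injective (cong index) (index u Fin.≟ index v)

    open DecMembership _≟ᵛ_ using (_∈?_)

    Walkᴳ : Vertex → Vertex → Set
    Walkᴳ = Walk G

    arcsOf : ∀ {u v} → Walkᴳ u v → List Arc
    arcsOf = walkArcs G

  -- Connectivity is relative to a list of allowed arcs because `components` adds the arcs one at a
  -- time; the whole graph is the case where `as` lists every arc.
  Conn : List Arc → Vertex → Vertex → Set
  Conn as u v = Σ (Walk G u v) λ w → All (_∈ as) (walkArcs G w)

  conn-refl : ∀ {as u} → Conn as u u
  conn-refl = [] , []

  conn-trans : ∀ {as u v w} → Conn as u v → Conn as v w → Conn as u w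
  conn-trans ([]             , [])      q = q
  conn-trans (forward  a e w , i ∷ is) q with w′ , js ← conn-trans (w , is) q =
    forward a e w′ , i ∷ js
  conn-trans (backward a e w , i ∷ is) q with w′ , js ← conn-trans (w , is) q =
    backward a e w′ , i ∷ js

  conn-sym : ∀ {as u v} → Conn as u v → Conn as v u
  conn-sym ([]             , [])     = conn-refl
  conn-sym (forward  a e w , i ∷ is) = conn-trans (conn-sym (w , is)) (backward a e [] , i ∷ [])
  conn-sym (backward a e w , i ∷ is) = conn-trans (conn-sym (w , is)) (forward a e [] , i ∷ [])

  conn-arc : ∀ {as a} → a ∈ as → Conn as (src a) (tgt a)
  conn-arc {a = a} a∈as = forward a (edge a) [] , a∈as ∷ []

  conn-map : ∀ {as bs u v} → (∀ {a} → a ∈ as → Conn bs (src a) (tgt a)) →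
             Conn as u v → Conn bs u v
  conn-map {as} {bs} f (w , ks) = go w ks
    where
    go : ∀ {u v} (w : Walk G u v) → All (_∈ as) (walkArcs G w) → Conn bs u v
    go []                     []       = conn-refl
    go (forward a (i , j) w)  (k ∷ ks) = conn-trans
      (subst₂ (Conn bs) (sym (src-unique i)) (sym (tgt-unique j)) (f k)) (go w ks)
    go (backward a (i , j) w) (k ∷ ks) = conn-trans
      (conn-sym (subst₂ (Conn bs) (sym (src-unique i)) (sym (tgt-unique j)) (f k))) (go w ks)

  conn-invariant : ∀ {X : Set} {as u v} (f : Vertex → X) →
                   (∀ {a} → a ∈ as → f (src a) ≡ f (tgt a)) → Conn as u v → f u ≡ f v
  conn-invariant {as = as} f inv (w , ks) = go w ks
    where
    go : ∀ {u v} (w : Walk G u v) → All (_∈ as) (walkArcs G w) → f u ≡ f v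
    go []                     []       = refl
    go (forward a (i , j) w)  (k ∷ ks) = trans
      (trans (cong f (src-unique i)) (trans (inv k) (cong f (sym (tgt-unique j))))) (go w ks)
    go (backward a (i , j) w) (k ∷ ks) = trans
      (trans (cong f (tgt-unique j)) (trans (sym (inv k)) (cong f (sym (src-unique i))))) (go w ks)

  walk⇒conn : ∀ {as u v} → (∀ a → a ∈ as) → Walk G u v → Conn as u v
  walk⇒conn all w = w , All.tabulate λ {a} _ → all a

  private
    vertices : ∀ {u v} → Walkᴳ u v → List Vertex
    vertices {v = v} w = walkVertices G w ⊕ [ v ]

    Simple : ∀ {u v} → Walkᴳ u v → Set
    Simple w = Unique (arcsOf w) × Unique (vertices w)

    start∈ : ∀ {u v} (w : Walkᴳ u v) → u ∈ vertices w
    start∈ []               = here refl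
    start∈ (forward  _ _ _) = here refl
    start∈ (backward _ _ _) = here refl

    ends∈ : ∀ {u v a} (w : Walkᴳ u v) → a ∈ arcsOf w → src a ∈ vertices w × tgt a ∈ vertices w
    ends∈ (forward a (i , j) w) (here refl) =
      here (sym (src-unique i)) , there (subst (_∈ vertices w) (tgt-unique j) (start∈ w))
    ends∈ (backward a (i , j) w) (here refl) =
      there (subst (_∈ vertices w) (src-unique i) (start∈ w)) , here (sym (tgt-unique j))
    ends∈ (forward  _ _ w) (there k) with s , t ← ends∈ w k = there s , there t
    ends∈ (backward _ _ w) (there k) with s , t ← ends∈ w k = there s , there t

    suffix : ∀ {P : Arc → Set} {u v x} (w : Walkᴳ u v) → Simple w → All P (arcsOf w) →
             x ∈ vertices w → Σ (Walkᴳ x v) λ w′ → Simple w′ × All P (arcsOf w′)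
    suffix []               s ps (here refl) = [] , s , ps
    suffix (forward  a e w) s ps (here refl) = forward a e w , s , ps
    suffix (backward a e w) s ps (here refl) = backward a e w , s , ps
    suffix (forward  a e w) (_ ∷ us , _ ∷ vs) (_ ∷ ps) (there x∈) = suffix w (us , vs) ps x∈
    suffix (backward a e w) (_ ∷ us , _ ∷ vs) (_ ∷ ps) (there x∈) = suffix w (us , vs) ps x∈

    fresh-cons : ∀ {X : Set} {x : X} {xs} → x ∉ xs → Unique xs → Unique (x ∷ xs)
    fresh-cons x∉ u = All.tabulate (λ y∈ x≡y → x∉ (subst (_∈ _) (sym x≡y) y∈)) ∷ u

    -- Loop erasure: if the first vertex occurs again later, only the suffix from that occurrence is
    -- kept. `P` is inherited because arcs are only dropped.
    simplify : ∀ {P : Arc → Set} {u v} (w : Walkᴳ u v) → All P (arcsOf w) →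
               Σ (Walkᴳ u v) λ w′ → Simple w′ × All P (arcsOf w′)
    simplify [] [] = [] , ([] , [] ∷ []) , []
    simplify {u = u} (forward a (i , j) w) (p ∷ ps) with simplify w ps
    ... | w′ , s@(ua , uv) , ps′ with u ∈? vertices w′
    ...   | yes u∈ = suffix w′ s ps′ u∈
    ...   | no  u∉ = forward a (i , j) w′ ,
      (fresh-cons (λ a∈ → u∉ (subst (_∈ _) (sym (src-unique i)) (proj₁ (ends∈ w′ a∈)))) ua ,
       fresh-cons u∉ uv) ,
      p ∷ ps′
    simplify {u = u} (backward a (i , j) w) (p ∷ ps) with simplify w ps
    ... | w′ , s@(ua , uv) , ps′ with u ∈? vertices w′
    ...   | yes u∈ = suffix w′ s ps′ u∈
    ...   | no  u∉ = backward a (i , j) w′ ,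
      (fresh-cons (λ a∈ → u∉ (subst (_∈ _) (sym (tgt-unique j)) (proj₂ (ends∈ w′ a∈)))) ua ,
       fresh-cons u∉ uv) ,
      p ∷ ps′

  conn⇒cycle : ∀ {as a} → a ∉ as → Conn as (tgt a) (src a) → ¬ NoUndirectedCycle G
  conn⇒cycle {as} {a} a∉as (w , ws) acyclic with simplify w ws
  ... | w′ , (ua , uv) , ps = acyclic (forward a (edge a) w′) record
    { nonempty        = λ ()
    ; unique-arcs     = fresh-cons (a∉as ∘ All.lookup ps) ua
    -- `vertices w′` ends with `src a`, whereas the cycle lists `src a` first, hence the rotation.
    ; unique-vertices = Unique-resp-↭ (++-comm (walkVertices G w′) _) uv
    }

  record Components (as : List Arc) (k : ℕ) : Set where
    field
      component  : Vertex → Fin k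
      surjective : ∀ i → ∃ λ v → component v ≡ i
      sound      : ∀ {u v} → component u ≡ component v → Conn as u v
      complete   : ∀ {u v} → Conn as u v → component u ≡ component v

  open Components

  private
    module Merge {as k} (C : Components as (suc k)) (a : Arc)
                 (x≢y : component C (src a) ≢ component C (tgt a)) where
      x y : Fin (suc k)
      x = component C (src a)
      y = component C (tgt a)

      -- Class `y` gives up its index: its vertices take that of `x`, and `punchOut` renumbers the
      -- other classes without a gap.
      merge : Fin (suc k) → Fin k
      merge z with y Fin.≟ z
      ... | yes _   = punchOut (x≢y ∘ sym)
      ... | no  y≢z = punchOut y≢z

      merge-punchIn : ∀ i → merge (punchIn y i) ≡ i
      merge-punchIn i with y Fin.≟ punchIn y i
      ... | yes e = contradiction (sym e) (punchInᵢ≢i y i)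
      ... | no  n = trans (punchOut-cong y refl) (Fin.punchOut-punchIn y)

      merge-xy : merge x ≡ merge y
      merge-xy with y Fin.≟ x | y Fin.≟ y
      ... | yes e | _     = contradiction (sym e) x≢y
      ... | no _  | no n  = contradiction refl n
      ... | no _  | yes _ = punchOut-cong y refl

      Joined : Fin (suc k) → Set
      Joined z = z ≡ x ⊎ z ≡ y

      merge-injective : ∀ {z z′} → merge z ≡ merge z′ → z ≡ z′ ⊎ Joined z × Joined z′
      merge-injective {z} {z′} e with y Fin.≟ z | y Fin.≟ z′
      ... | yes p | yes q = inj₁ (trans (sym p) q)
      ... | no  p | no  q = inj₁ (punchOut-injective p q e)
      ... | yes p | no  q = inj₂ (inj₂ (sym p) , inj₁ (sym (punchOut-injective _ q e)))
      ... | no  p | yes q = inj₂ (inj₁ (punchOut-injective p _ e) , inj₂ (sym q))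

      lift : ∀ {u v} → Conn as u v → Conn (a ∷ as) u v
      lift = conn-map (conn-arc ∘ there)

      toSrc : ∀ {u} → Joined (component C u) → Conn (a ∷ as) u (src a)
      toSrc (inj₁ e) = lift (sound C e)
      toSrc (inj₂ e) = conn-trans (lift (sound C e)) (conn-sym (conn-arc (here refl)))

      merged : Components (a ∷ as) k
      component  merged   = merge ∘ component C
      surjective merged i with v , e ← surjective C (punchIn y i) =
        v , trans (cong merge e) (merge-punchIn i)
      sound      merged e with merge-injective e
      ... | inj₁ e′      = lift (sound C e′)
      ... | inj₂ (p , q) = conn-trans (toSrc p) (conn-sym (toSrc q))
      complete   merged   = conn-invariant (merge ∘ component C) λ where
        (here refl) → merge-xy
        (there i)   → cong merge (complete C (conn-arc i))

  -- Each arc lowers the number of components by at most one, and by exactly one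
  -- unless it closes a cycle.
  components : ∀ as → ∃ λ k → Components as k × size ≤ length as + k ×
               (NoUndirectedCycle G → Unique as → size ≡ length as + k)
  components [] = size , record
    { component  = index
    ; surjective = index-surjective
    ; sound      = λ e → subst (Conn [] _) (index-injective e) conn-refl
    ; complete   = conn-invariant index λ ()
    } , ℕ.≤-refl , λ _ _ → refl
  components (a ∷ as) with components as
  ... | zero , C , _ = case component C (src a) of λ ()
  ... | suc k , C , le , eq with component C (src a) Fin.≟ component C (tgt a)
  ...   | no x≢y = k , Merge.merged C a x≢y ,
    ℕ.≤-trans le (ℕ.≤-reflexive (+-suc _ k)) ,
    λ { acyclic (_ ∷ u) → trans (eq acyclic u) (+-suc _ k) }
  -- The ends of `a` are already connected, so `a` closes a cycle and the exact count is claimed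
  -- only under a contradictory hypothesis.
  ...   | yes x≡y = suc k , record
    { component  = component C
    ; surjective = surjective C
    ; sound      = conn-map (conn-arc ∘ there) ∘ sound C
    ; complete   = conn-invariant (component C) λ where
        (here refl) → x≡y
        (there i)   → complete C (conn-arc i)
    } , ℕ.m≤n⇒m≤1+n le ,
    λ { acyclic u@(_ ∷ _) → ⊥-elim (conn⇒cycle (Unique[x∷xs]⇒x∉xs u) (sound C (sym x≡y)) acyclic) }

  -- One vertex is chosen in each class of `D`. Two of them in the same class of `C` would be
  -- connected along `as`, hence along `bs`.
  section-≤ : ∀ {as bs k l} → Components as k → Components bs l →
              (∀ {u v} → Conn as u v → Conn bs u v) → l ≤ k
  section-≤ {k = k} {l} C D f = injective⇒≤ {f = g} inj
    where
    g : Fin l → Fin k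
    g i = component C (proj₁ (surjective D i))
    inj : Injective _≡_ _≡_ g
    inj {i} {j} e = trans (sym (proj₂ (surjective D i)))
      (trans (complete D (f (sound C e))) (proj₂ (surjective D j)))

  module _ (arcs : List Arc) (arcs-all : ∀ a → a ∈ arcs) where

    hasComponents : ∀ {k} → Components arcs k → HasComponents G k
    hasComponents C = record
      { component  = component C
      ; surjective = λ i → proj₁ (surjective C i) , λ { refl → proj₂ (surjective C i) }
      ; connected  = λ u v → mk⇔ (proj₁ ∘ sound C) (complete C ∘ walk⇒conn arcs-all)
      }

    fromHasComponents : ∀ {k} → HasComponents G k → Components arcs k
    fromHasComponents H = record
      { component  = HasComponents.component H
      ; surjective = λ i → proj₁ (HasComponents.surjective H i) , proj₂ (HasComponents.surjective H i) refl
      ; sound      = walk⇒conn arcs-all ∘ Equivalence.to (HasComponents.connected H _ _)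
      ; complete   = Equivalence.from (HasComponents.connected H _ _) ∘ proj₁
      }

    -- The exact count is known for the `k′` found by `components`. Connectivity alone fixes the
    -- number of classes, so `k′` equals `k` by `section-≤` in both directions.
    euler : Unique arcs → NoUndirectedCycle G → ∀ {k} → HasComponents G k → size ≡ length arcs + k
    euler u acyclic H with k′ , C , _ , eq ← components arcs =
      trans (eq acyclic u) (cong (length arcs +_) (ℕ.≤-antisym
        (section-≤ (fromHasComponents H) C id) (section-≤ C (fromHasComponents H) id)))

    -- Each class is sent to the position in `L` of a vertex belonging to it, and different classes
    -- get different positions.
    spanned-≤ : ∀ {k} → Components arcs k → (L : List Vertex) →
                (∀ v → ∃ λ x → x ∈ L × Conn arcs v x) → k ≤ length L
    spanned-≤ {k} C L near = injective⇒≤ {f = f} inj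
      where
      rep : Fin k → Vertex
      rep i = proj₁ (near (proj₁ (surjective C i)))
      rep∈ : ∀ i → rep i ∈ L
      rep∈ i = proj₁ (proj₂ (near (proj₁ (surjective C i))))
      rep-component : ∀ i → component C (rep i) ≡ i
      rep-component i = trans (sym (complete C (proj₂ (proj₂ (near (proj₁ (surjective C i)))))))
                              (proj₂ (surjective C i))
      f : Fin k → Fin (length L)
      f i = Any.index (rep∈ i)
      inj : Injective _≡_ _≡_ f
      inj {i} {j} e = trans (sym (rep-component i)) (trans (cong (component C)
        (trans (lookup-index (rep∈ i)) (trans (cong (List.lookup L) e) (sym (lookup-index (rep∈ j))))))
        (rep-component j))

    -- Dropping an arc of a cycle does not disconnect anything, since the rest of the cycle bypasses
    -- it. So `length arcs` minus one arcs would still leave at most `k` components, against the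
    -- inequality `size ≤ length as + k` of `components`.
    tree-acyclic : ∀ {k} → Components arcs k → size ≡ length arcs + k → NoUndirectedCycle G
    tree-acyclic {k} C eq w cyc = go w (IsCycle.nonempty cyc) (IsCycle.unique-arcs cyc)
      where
      module Bypass a {bs} (p : arcs ↭ a ∷ bs) where
        bypass : ¬ Conn bs (src a) (tgt a)
        bypass c with k′ , D , le , _ ← components bs = ℕ.1+n≰n (begin
          suc (length bs + k)  ≡⟨ cong (_+ k) (↭-length p) ⟨
          length arcs + k      ≡⟨ eq ⟨
          size                 ≤⟨ le ⟩
          length bs + k′       ≤⟨ ℕ.+-monoʳ-≤ (length bs) (section-≤ C D (conn-map reroute)) ⟩
          length bs + k        ∎)
          where
          open ℕ.≤-Reasoning
          reroute : ∀ {b} → b ∈ arcs → Conn bs (src b) (tgt b)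
          reroute b∈ with ∈-resp-↭ p b∈
          ... | here refl = c
          ... | there b∈bs = conn-arc b∈bs

        avoid : ∀ {u v} (w : Walkᴳ u v) → All (a ≢_) (arcsOf w) → Conn bs u v
        avoid w ns = w , All.map other ns
          where
          other : ∀ {b} → a ≢ b → b ∈ bs
          other {b} a≢b with ∈-resp-↭ p (arcs-all b)
          ... | here refl  = contradiction refl a≢b
          ... | there b∈bs = b∈bs

      go : ∀ {v} (w : Walkᴳ v v) → arcsOf w ≢ [] → Unique (arcsOf w) → Empty
      go []                      ne _       = ne refl
      go (forward  a (i , j) w) _ (n ∷ _) with bs , p ← ∈⇒↭∷ (arcs-all a) =
        bypass (conn-sym (subst₂ (Conn bs) (tgt-unique j) (src-unique i) (avoid w n)))
        where open Bypass a p
      go (backward a (i , j) w) _ (n ∷ _) with bs , p ← ∈⇒↭∷ (arcs-all a) =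
        bypass (subst₂ (Conn bs) (src-unique i) (tgt-unique j) (avoid w n))
        where open Bypass a p

-- Nodes, switching graphs and their size

index-unique : {X : Set} {xs : List X} → Unique xs → ∀ {i} (p : List.lookup xs i ∈ xs) → Any.index p ≡ i
index-unique (n ∷ u) {zero}  (here _)  = refl
index-unique (n ∷ u) {zero}  (there p) = contradiction p (Unique[x∷xs]⇒x∉xs (n ∷ u))
index-unique (n ∷ u) {suc i} (here e)  = ⊥-elim (Unique[x∷xs]⇒x∉xs (n ∷ u) (subst (_∈ _) e (∈-lookup i)))
index-unique (n ∷ u) {suc i} (there p) = cong suc (index-unique u p)

length-filterᵇ : {X : Set} (p : X → Bool) (xs : List X) →
                 length (filterᵇ p xs) ≡ ∑ xs (λ x → if p x then 1 else 0)
length-filterᵇ p [] = refl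
length-filterᵇ p (x ∷ xs) with p x
... | true  = cong suc (length-filterᵇ p xs)
... | false = length-filterᵇ p xs

module Nodes (𝒜 : Atoms) where
  open MELL 𝒜

  isSwitch? : ∀ {m} (x : Node m) → Dec (IsSwitch x)
  isSwitch? (ax a b)       = no λ ()
  isSwitch? (cut p q)      = no λ ()
  isSwitch? (one a)        = no λ ()
  isSwitch? (bot a)        = no λ ()
  isSwitch? (tensor p q a) = no λ ()
  isSwitch? (par p q a)    = yes par
  isSwitch? (weak a)       = no λ ()
  isSwitch? (contr p q a)  = yes contr
  isSwitch? (der p a)      = no λ ()
  isSwitch? (box S i as)   = no λ ()

  IsSwitch-irrelevant : ∀ {m} {x : Node m} (s s′ : IsSwitch x) → s ≡ s′
  IsSwitch-irrelevant par   par   = refl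
  IsSwitch-irrelevant contr contr = refl

  freshes : ∀ {c} (R : PreStructure c) → Fin (nodes R) → List (SwitchVertex R)
  freshes R v with isSwitch? (node R v)
  ... | yes s = [ fresh v s ]
  ... | no  _ = []

  isJoin : ∀ {m} → Node m → Bool
  isJoin (cut _ _)      = true
  isJoin (tensor _ _ _) = true
  isJoin _              = false

  initials joins switches weakenings : ∀ {m} → Node m → ℕ
  initials (ax _ _)    = 1
  initials (one _)     = 1
  initials (box _ _ _) = 1
  initials _           = 0

  joins x = if isJoin x then 1 else 0

  switches x with isSwitch? x
  ... | yes _ = 1
  ... | no  _ = 0

  weakenings x = if isWeakening x then 1 else 0

  -- A node contributes `suc (switches x)` vertices to a switching graph, namely itself and its
  -- fresh • if any, and receives `length (premises x)` arcs. The difference is 1 for initial, ⊥ and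
  -- ?w nodes, -1 for ⊗ and cut nodes, and 0 for all others.
  balance : ∀ {m} (x : Node m) →
            suc (switches x) + joins x ≡ (length (premises x) + weakenings x) + initials x
  balance (ax a b)       = refl
  balance (cut p q)      = refl
  balance (one a)        = refl
  balance (bot a)        = refl
  balance (tensor p q a) = refl
  balance (par p q a)    = refl
  balance (weak a)       = refl
  balance (contr p q a)  = refl
  balance (der p a)      = refl
  balance (box S i as)   = refl

  module _ {m} {a : Fin m} where

    kept-or-detached : ∀ x (φ : IsSwitch x → Side) → a ∈ premises x →
                       a ∈ switchedPremises x φ ⊎ Σ (IsSwitch x) λ s → a ≡ detached s (φ s)
    kept-or-detached (cut p q)      φ i = inj₁ i
    kept-or-detached (tensor p q b) φ i = inj₁ i
    kept-or-detached (der p b)      φ i = inj₁ i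
    kept-or-detached (par p q b)    φ i with φ par in eq | i
    ... | left  | here e         = inj₁ (here e)
    ... | left  | there (here e) = inj₂ (par , trans e (cong (detached par) (sym eq)))
    ... | right | here e         = inj₂ (par , trans e (cong (detached par) (sym eq)))
    ... | right | there (here e) = inj₁ (here e)
    kept-or-detached (contr p q b)  φ i with φ contr in eq | i
    ... | left  | here e         = inj₁ (here e)
    ... | left  | there (here e) = inj₂ (contr , trans e (cong (detached contr) (sym eq)))
    ... | right | here e         = inj₂ (contr , trans e (cong (detached contr) (sym eq)))
    ... | right | there (here e) = inj₁ (here e)

    kept⇒premise : ∀ x (φ : IsSwitch x → Side) → a ∈ switchedPremises x φ → a ∈ premises x
    kept⇒premise (cut p q)      φ i = i
    kept⇒premise (tensor p q b) φ i = i
    kept⇒premise (der p b)      φ i = i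
    kept⇒premise (par p q b)    φ (here e) with φ par
    ... | left  = here e
    ... | right = there (here e)
    kept⇒premise (contr p q b)  φ (here e) with φ contr
    ... | left  = here e
    ... | right = there (here e)

    detached⇒premise : ∀ {x : Node m} (s : IsSwitch x) d → a ≡ detached s d → a ∈ premises x
    detached⇒premise par   left  e = there (here e)
    detached⇒premise par   right e = here e
    detached⇒premise contr left  e = there (here e)
    detached⇒premise contr right e = here e

    kept≢detached : ∀ x (φ : IsSwitch x → Side) → Unique (premises x) →
                    a ∈ switchedPremises x φ → (s : IsSwitch x) → a ≢ detached s (φ s)
    kept≢detached _ φ ((n ∷ []) ∷ _) (here refl) par e with φ par
    ... | left  = n e
    ... | right = n (sym e)
    kept≢detached _ φ ((n ∷ []) ∷ _) (here refl) contr e with φ contr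
    ... | left  = n e
    ... | right = n (sym e)

  module Ground {c : ℕ} (R : PreStructure c) (wf : WellFormed (ground R)) where

    conc prem : Fin (nodes R) → List (Fin (arcs R))
    conc v = conclusions (node R v)
    prem v = premises (node R v)

    V : List (Fin (nodes R))
    V = allFin (nodes R)

    private
      tail′ : ∀ a → ∃ λ v → a ∈ conc v × (∀ {u} → a ∈ conc u → u ≡ v)
      tail′ a with WellFormed.tail wf a
      ... | internal v , a∈ , unique = v , a∈ , λ i → case unique {internal _} i of λ { refl → refl }

    tail : Fin (arcs R) → Fin (nodes R)
    tail a = proj₁ (tail′ a)

    tail∈ : ∀ a → a ∈ conc (tail a)
    tail∈ a = proj₁ (proj₂ (tail′ a))

    tail-unique : ∀ {a v} → a ∈ conc v → v ≡ tail a
    tail-unique i = proj₂ (proj₂ (tail′ _)) i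

    head : Fin (arcs R) → Vertex R
    head a = proj₁ (WellFormed.head wf a)

    head∈ : ∀ a → a ∈ Graph.premises (ground R) (head a)
    head∈ a = proj₁ (proj₂ (WellFormed.head wf a))

    head-unique : ∀ {a v} → a ∈ Graph.premises (ground R) v → v ≡ head a
    head-unique i = sym (proj₂ (proj₂ (WellFormed.head wf _)) i)

    prem-unique : ∀ v → Unique (prem v)
    prem-unique v = WellFormed.unique-premises wf (internal v)

    conc-disjoint : ∀ {u v a} → a ∈ conc u → a ∈ conc v → u ≡ v
    conc-disjoint i j = trans (tail-unique i) (sym (tail-unique j))

    prem-disjoint : ∀ {u v a} → a ∈ prem u → a ∈ prem v → u ≡ v
    prem-disjoint {u} {v} i j =
      case trans (head-unique {v = internal u} i) (sym (head-unique {v = internal v} j)) of λ { refl → refl }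

    concl-prem-disjoint : ∀ {i v} → lookup (concl R) i ∉ prem v
    concl-prem-disjoint {i} {v} j =
      case trans (head-unique {v = internal v} j) (sym (head-unique {v = • i} (here refl))) of λ ()

    concl-injective : ∀ {i j} → lookup (concl R) i ≡ lookup (concl R) j → i ≡ j
    concl-injective {i} {j} e =
      case trans (head-unique {v = • i} (here refl)) (sym (head-unique {v = • j} (here e))) of λ { refl → refl }

    concl∈ : ∀ i → lookup (concl R) i ∈ toList (concl R)
    concl∈ i = subst (lookup (concl R) i ∈_) (sym (toList-tabulate (concl R))) (∈-tabulate⁺ i)

    ∈concl : ∀ {a} → a ∈ toList (concl R) → ∃ λ i → a ≡ lookup (concl R) i
    ∈concl a∈ = ∈-tabulate⁻ (subst (_ ∈_) (toList-tabulate (concl R)) a∈)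

    conclusions-unique : ∀ {ns} → Unique ns → Unique (concatMap conc ns)
    conclusions-unique u =
      Unique-concatMap u (λ v → WellFormed.unique-conclusions wf (internal v)) conc-disjoint

    arcs-by-tail : concatMap conc V ↭ allFin (arcs R)
    arcs-by-tail = unique-↭ (conclusions-unique (allFin⁺ _)) (allFin⁺ _)
      (λ _ → ∈-allFin _) (λ {a} _ → ∈-concatMap {f = conc} (∈-allFin (tail a)) (tail∈ a))

    arcs-by-head : toList (concl R) ⊕ concatMap prem V ↭ allFin (arcs R)
    arcs-by-head = unique-↭
      (Unique.++⁺
        (subst Unique (sym (toList-tabulate (concl R))) (Unique.tabulate⁺ concl-injective))
        (Unique-concatMap (allFin⁺ _) prem-unique prem-disjoint)
        λ { (i , j) → case ∈concl i , concatMap-∈ prem V j of λ { ((_ , refl) , v , _ , k) → concl-prem-disjoint k } })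
      (allFin⁺ _) (λ _ → ∈-allFin _) (λ {a} _ → onto a)
      where
      onto : ∀ a → a ∈ toList (concl R) ⊕ concatMap prem V
      onto a with head a | head∈ a
      ... | internal v | i        = ∈-++⁺ʳ (toList (concl R)) (∈-concatMap {f = prem} (∈-allFin v) i)
      ... | • j        | here eq  = ∈-++⁺ˡ (subst (_∈ _) (sym eq) (concl∈ j))

    ∑ᴿ : (Node (arcs R) → ℕ) → ℕ
    ∑ᴿ f = ∑ V (f ∘ node R)

    module _ (φ : Switching R) where
      private
        G = switchingGraph R φ

        -- Folding each fresh • back into the node it was detached from reduces the uniqueness of
        -- heads in the switching graph to that in `ground R`; `kept≢detached` separates the two
        -- vertices folded together.
        ground-vertex : SwitchVertex R → Vertex R
        ground-vertex (internal v) = internal v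
        ground-vertex (• i)        = • i
        ground-vertex (fresh v s)  = internal v

        vertices : List (SwitchVertex R)
        vertices = List.map internal V ⊕ List.map • (allFin c) ⊕ concatMap (freshes R) V

        ∈-freshes : ∀ {v} s → fresh v s ∈ freshes R v
        ∈-freshes {v} s with isSwitch? (node R v)
        ... | yes s′ = here (cong (fresh v) (IsSwitch-irrelevant s s′))
        ... | no  ¬s = contradiction s ¬s

        freshes-∈ : ∀ {v x} → x ∈ freshes R v → ∃ λ s → x ≡ fresh v s
        freshes-∈ {v} i with isSwitch? (node R v)
        freshes-∈ (here e) | yes s = s , e

        freshes-unique : ∀ v → Unique (freshes R v)
        freshes-unique v with isSwitch? (node R v)
        ... | yes s = [] ∷ []
        ... | no  _ = []

        ∈-vertices : ∀ x → x ∈ vertices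
        ∈-vertices (internal v) = ∈-++⁺ˡ (∈-map⁺ internal (∈-allFin v))
        ∈-vertices (• i)        = ∈-++⁺ʳ (List.map internal V) (∈-++⁺ˡ (∈-map⁺ • (∈-allFin i)))
        ∈-vertices (fresh v s)  = ∈-++⁺ʳ (List.map internal V) (∈-++⁺ʳ (List.map • (allFin c))
          (∈-concatMap {f = freshes R} (∈-allFin v) (∈-freshes s)))

        internal-disjoint : ∀ {x} → ¬ (x ∈ List.map internal V × x ∈ List.map • (allFin c) ⊕ concatMap (freshes R) V)
        internal-disjoint (i , j) with ∈-map⁻ internal i | ∈-++⁻ (List.map • (allFin c)) j
        ... | v , _ , refl | inj₁ k = case ∈-map⁻ • k of λ { (_ , _ , ()) }
        ... | v , _ , refl | inj₂ k with u , _ , k′ ← concatMap-∈ (freshes R) V k with () ← proj₂ (freshes-∈ {u} k′)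

        •-disjoint : ∀ {x} → ¬ (x ∈ List.map • (allFin c) × x ∈ concatMap (freshes R) V)
        •-disjoint (i , k) with ∈-map⁻ • i
        ... | v , _ , refl with u , _ , k′ ← concatMap-∈ (freshes R) V k with () ← proj₂ (freshes-∈ {u} k′)

        vertices-unique : Unique vertices
        vertices-unique = Unique.++⁺ (Unique.map⁺ (λ { refl → refl }) (allFin⁺ _))
          (Unique.++⁺ (Unique.map⁺ (λ { refl → refl }) (allFin⁺ _))
            (Unique-concatMap (allFin⁺ _) freshes-unique
              (λ {u} {v} i j → case freshes-∈ {u} i , freshes-∈ {v} j of λ { ((_ , refl) , (_ , refl)) → refl }))
            •-disjoint) internal-disjoint

        target : ∀ a v → a ∈ Graph.premises (ground R) v →
                 ∃ λ x → a ∈ Graph.premises G x × ground-vertex x ≡ v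
        target a (• i)        a∈ = • i , a∈ , refl
        target a (internal v) a∈ with kept-or-detached (node R v) (φ v) a∈
        ... | inj₁ k       = internal v , k , refl
        ... | inj₂ (s , e) = fresh v s , here e , refl

        ground-premise : ∀ {a} x → a ∈ Graph.premises G x → a ∈ Graph.premises (ground R) (ground-vertex x)
        ground-premise (internal v) i        = kept⇒premise (node R v) (φ v) i
        ground-premise (• i)        j        = j
        ground-premise (fresh v s)  (here e) = detached⇒premise s (φ v s) e

        same-ground : ∀ {a} x y → a ∈ Graph.premises G x → a ∈ Graph.premises G y →
                      ground-vertex x ≡ ground-vertex y → x ≡ y
        same-ground (internal v) (internal v) i j refl = refl
        same-ground (internal v) (fresh v s) i (here e) refl =
          contradiction e (kept≢detached (node R v) (φ v) (prem-unique v) i s)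
        same-ground (• i) (• i) _ _ refl = refl
        same-ground (fresh v s) (internal v) (here e) j refl =
          contradiction e (kept≢detached (node R v) (φ v) (prem-unique v) j s)
        same-ground (fresh v s) (fresh v s′) _ _ refl = cong (fresh v) (IsSwitch-irrelevant s s′)

        source-unique : ∀ {a} x → a ∈ Graph.conclusions G x → x ≡ internal (tail a)
        source-unique (internal v) i = cong internal (tail-unique i)

      switching : FiniteGraph G
      switching = record
        { src          = λ a → internal (tail a)
        ; tgt          = λ a → proj₁ (target a (head a) (head∈ a))
        ; edge         = λ a → tail∈ a , proj₁ (proj₂ (target a (head a) (head∈ a)))
        ; src-unique   = λ {a} {x} → source-unique x
        ; tgt-unique   = λ {a} {x} i →
            same-ground x _ i (proj₁ (proj₂ (target a (head a) (head∈ a))))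
              (trans (head-unique (ground-premise x i)) (sym (proj₂ (proj₂ (target a (head a) (head∈ a))))))
        ; size         = length vertices
        ; index        = λ x → Any.index (∈-vertices x)
        ; index-injective = λ {x} {y} e →
            trans (lookup-index (∈-vertices x)) (trans (cong (List.lookup vertices) e) (sym (lookup-index (∈-vertices y))))
        ; index-surjective = λ i → List.lookup vertices i , index-unique vertices-unique _
        }

      private
        length-freshes : ∀ v → length (freshes R v) ≡ switches (node R v)
        length-freshes v with isSwitch? (node R v)
        ... | yes _ = refl
        ... | no  _ = refl

      -- This is `balance` summed over all nodes. The `c` vertices • i, added to both sides,
      -- complete the count of arcs, since every arc arrives at a node or is a conclusion of R. The
      -- right-hand side does not mention φ, so all switching graphs have the same size.
      size-count : FiniteGraph.size switching + ∑ᴿ joins ≡ (arcs R + ♯w R) + ∑ᴿ initials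
      size-count = begin
        length vertices + ∑ᴿ joins
          ≡⟨ cong (_+ ∑ᴿ joins) (trans (List.length-++ (List.map internal V))
               (cong₂ _+_ (trans (List.length-map internal V) (count V))
                 (trans (List.length-++ (List.map • (allFin c)))
                   (cong₂ _+_ (trans (List.length-map • (allFin c)) (List.length-tabulate id))
                     (trans (length-concatMap (freshes R) V) (∑-cong V length-freshes)))))) ⟩
        (∑ V (λ _ → 1) + (c + ∑ᴿ switches)) + ∑ᴿ joins
          ≡⟨ solve 4 (λ a b c d → (a :+ (b :+ c)) :+ d := b :+ ((a :+ c) :+ d)) refl
               (∑ V (λ _ → 1)) c (∑ᴿ switches) (∑ᴿ joins) ⟩
        c + ((∑ V (λ _ → 1) + ∑ᴿ switches) + ∑ᴿ joins)
          ≡⟨ cong (c +_) (trans (cong (_+ ∑ᴿ joins) (sym (∑-+ (λ _ → 1) (switches ∘ node R) V)))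
               (sym (∑-+ (suc ∘ switches ∘ node R) (joins ∘ node R) V))) ⟩
        c + ∑ V (λ v → suc (switches (node R v)) + joins (node R v))
          ≡⟨ cong (c +_) (∑-cong V (balance ∘ node R)) ⟩
        c + ∑ V (λ v → (length (prem v) + weakenings (node R v)) + initials (node R v))
          ≡⟨ cong (c +_) (trans (∑-+ (λ v → length (prem v) + weakenings (node R v)) (initials ∘ node R) V)
               (cong (_+ ∑ᴿ initials) (∑-+ (length ∘ prem) (weakenings ∘ node R) V))) ⟩
        c + ((∑ V (length ∘ prem) + ∑ᴿ weakenings) + ∑ᴿ initials)
          ≡⟨ solve 4 (λ a b c d → a :+ ((b :+ c) :+ d) := ((a :+ b) :+ c) :+ d) refl
               c (∑ V (length ∘ prem)) (∑ᴿ weakenings) (∑ᴿ initials) ⟩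
        ((c + ∑ V (length ∘ prem)) + ∑ᴿ weakenings) + ∑ᴿ initials
          ≡⟨ cong (_+ ∑ᴿ initials) (cong₂ _+_ arcs-count (sym (length-filterᵇ (isWeakening ∘ node R) V))) ⟩
        (arcs R + ♯w R) + ∑ᴿ initials ∎
        where
        open ≡-Reasoning
        open +-*-Solver
        count : ∀ {X : Set} (xs : List X) → length xs ≡ ∑ xs (λ _ → 1)
        count []       = refl
        count (x ∷ xs) = cong suc (count xs)
        arcs-count : c + ∑ V (length ∘ prem) ≡ arcs R
        arcs-count = begin
          c + ∑ V (length ∘ prem)
            ≡⟨ cong₂ _+_ (Vec.length-toList (concl R)) (length-concatMap prem V) ⟨
          length (toList (concl R)) + length (concatMap prem V)
            ≡⟨ List.length-++ (toList (concl R)) ⟨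
          length (toList (concl R) ⊕ concatMap prem V)
            ≡⟨ ↭-length arcs-by-head ⟩
          length (allFin (arcs R))
            ≡⟨ List.length-tabulate id ⟩
          arcs R ∎

-- Sequentializable clusters, trees and their outputs

module Sequents (𝒜 : Atoms) where
  open MELL 𝒜
  open Nodes 𝒜

  data IsInitial {m} : Node m → Set where
    ax  : ∀ {a b} → IsInitial (ax a b)
    one : ∀ {a} → IsInitial (one a)
    box : ∀ {c} {S : PreStructure c} {i as} → IsInitial (box S i as)

  data IsLeaf {m} : Node m → Fin m → Set where
    bot  : ∀ {a} → IsLeaf (bot a) a
    weak : ∀ {a} → IsLeaf (weak a) a

  data IsBinary {m} : Node m → Fin m → Fin m → Fin m → Set where
    par   : ∀ {p q a} → IsBinary (par p q a) p q a
    contr : ∀ {p q a} → IsBinary (contr p q a) p q a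

  leaf-prem : ∀ {m} {x : Node m} {a} → IsLeaf x a → premises x ≡ []
  leaf-prem bot  = refl
  leaf-prem weak = refl

  leaf-conc : ∀ {m} {x : Node m} {a} → IsLeaf x a → conclusions x ≡ [ a ]
  leaf-conc bot  = refl
  leaf-conc weak = refl

  binary-prem : ∀ {m} {x : Node m} {p q a} → IsBinary x p q a → premises x ≡ p ∷ q ∷ []
  binary-prem par   = refl
  binary-prem contr = refl

  binary-conc : ∀ {m} {x : Node m} {p q a} → IsBinary x p q a → conclusions x ≡ [ a ]
  binary-conc par   = refl
  binary-conc contr = refl

  initial-prem : ∀ {m} {x : Node m} → IsInitial x → premises x ≡ []
  initial-prem ax  = refl
  initial-prem one = refl
  initial-prem box = refl

  module _ {m} {x : Node m} (φ : IsSwitch x → Side) where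

    der-kept : ∀ {p a} → x ≡ der p a → p ∈ switchedPremises x φ
    der-kept refl = here refl

    tensor-kept : ∀ {p q a} → x ≡ tensor p q a → p ∈ switchedPremises x φ × q ∈ switchedPremises x φ
    tensor-kept refl = here refl , there (here refl)

    binary-kept : ∀ {p q a} → IsBinary x p q a → p ∈ switchedPremises x φ ⊎ q ∈ switchedPremises x φ
    binary-kept par with φ par
    ... | left  = inj₁ (here refl)
    ... | right = inj₂ (here refl)
    binary-kept contr with φ contr
    ... | left  = inj₁ (here refl)
    ... | right = inj₂ (here refl)

  module _ {c : ℕ} (R : PreStructure c) where

    -- A cut-free proof stripped of its formulae: the nodes that its rules introduce and the arcs
    -- that it leaves open, in an order that `resp` makes immaterial. A box is opaque and counts as
    -- an axiom, so a `Seq` concerns a single level.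
    data Seq : List (Fin (nodes R)) → List (Fin (arcs R)) → Set where
      init   : ∀ {v} → IsInitial (node R v) → Seq [ v ] (conclusions (node R v))
      leaf   : ∀ {v a ns cs} → IsLeaf (node R v) a → Seq ns cs → Seq (v ∷ ns) (a ∷ cs)
      der    : ∀ {v p a ns cs} → node R v ≡ der p a → Seq ns (p ∷ cs) → Seq (v ∷ ns) (a ∷ cs)
      binary : ∀ {v p q a ns cs} → IsBinary (node R v) p q a →
               Seq ns (p ∷ q ∷ cs) → Seq (v ∷ ns) (a ∷ cs)
      tensor : ∀ {v p q a ns cs ms ds} → node R v ≡ tensor p q a →
               Seq ns (p ∷ cs) → Seq ms (q ∷ ds) → Seq (v ∷ ns ⊕ ms) (a ∷ cs ⊕ ds)
      resp   : ∀ {ns ms cs ds} → ns ↭ ms → cs ↭ ds → Seq ns cs → Seq ms ds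

    -- The part of R above an arc all of whose topmost nodes are ⊥ and ?w nodes.
    data Tree : List (Fin (nodes R)) → Fin (arcs R) → Set where
      leaf   : ∀ {v a} → IsLeaf (node R v) a → Tree [ v ] a
      der    : ∀ {v p a ns} → node R v ≡ der p a → Tree ns p → Tree (v ∷ ns) a
      binary : ∀ {v p q a ns ms} → IsBinary (node R v) p q a →
               Tree ns p → Tree ms q → Tree (v ∷ ns ⊕ ms) a

    -- The ⊥ and weakening rules apply to any sequent, so the nodes of a tree can be added to an
    -- existing `Seq` from the leaves down, with no link between the tree and its host.
    graft : ∀ {ns a ms cs} → Tree ns a → Seq ms cs → Seq (ns ⊕ ms) (a ∷ cs)
    graft (leaf l) s = leaf l s
    graft (der e t) s = der e (graft t s)
    graft {ms = ks} (binary {v} {ns = ns} {ms} b t u) s =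
      resp (↭-reflexive (cong (v ∷_) (sym (List.++-assoc ns ms ks)))) ↭-refl
           (binary b (graft t (graft u s)))

  module Borders {c : ℕ} (R : PreStructure c) (wf : WellFormed (ground R)) where
    open Ground R wf

    -- An identity of multisets: the arcs leaving nodes of `ns` are the outputs and the premises of
    -- nodes of `ns`. It says at once that `ns` is closed under going up along premises and that the
    -- arcs of `cs` are those leading out of it.
    record Bordered (ns : List (Fin (nodes R))) (cs : List (Fin (arcs R))) : Set where
      constructor bordered
      field border-↭ : concatMap conc ns ↭ cs ⊕ concatMap prem ns

    border-cons : ∀ {v a ps ns cs} → conc v ≡ [ a ] → prem v ≡ ps →
                  Bordered ns (ps ⊕ cs) → Bordered (v ∷ ns) (a ∷ cs)
    border-cons {v} {a} {ps} {ns} {cs} ec ep (bordered b) = bordered (↭-trans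
      (++⁺ (↭-reflexive ec) b) (↭-trans
      (↭-prep a (solve 3 (λ p c x → (p ⊙ c) ⊙ x ⊜ c ⊙ p ⊙ x) ↭-refl ps cs (concatMap prem ns)))
      (↭-prep a (++⁺ˡ cs (++⁺ʳ (concatMap prem ns) (↭-reflexive (sym ep)))))))
      where open ↭Solver using (solve; _⊜_) renaming (_⊕_ to _⊙_)

    border-++ : ∀ {ns cs ms ds} → Bordered ns cs → Bordered ms ds → Bordered (ns ⊕ ms) (cs ⊕ ds)
    border-++ {ns} {cs} {ms} {ds} (bordered b) (bordered d) = bordered (↭-trans
      (↭-reflexive (List.concatMap-++ conc ns ms)) (↭-trans (++⁺ b d) (↭-trans
      (solve 4 (λ c x d y → (c ⊙ x) ⊙ (d ⊙ y) ⊜ (c ⊙ d) ⊙ (x ⊙ y)) ↭-refl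
        cs (concatMap prem ns) ds (concatMap prem ms))
      (++⁺ˡ (cs ⊕ ds) (↭-reflexive (sym (List.concatMap-++ prem ns ms)))))))
      where open ↭Solver using (solve; _⊜_) renaming (_⊕_ to _⊙_)

    border-resp : ∀ {ns cs ms ds} → ns ↭ ms → cs ↭ ds → Bordered ns cs → Bordered ms ds
    border-resp p q (bordered b) = bordered (↭-trans (↭-sym (concatMap-↭ conc p))
      (↭-trans b (++⁺ q (concatMap-↭ prem p))))

    border-init : ∀ {v} → IsInitial (node R v) → Bordered [ v ] (conc v)
    border-init {v} i = bordered (++⁺ˡ (conc v) (++⁺ʳ [] (↭-reflexive (sym (initial-prem i)))))

    seq-border : ∀ {ns cs} → Seq R ns cs → Bordered ns cs
    seq-border (init i)     = border-init i
    seq-border (leaf l s)   = border-cons (leaf-conc l) (leaf-prem l) (seq-border s)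
    seq-border (der e s)    = border-cons (cong conclusions e) (cong premises e) (seq-border s)
    seq-border (binary b s) = border-cons (binary-conc b) (binary-prem b) (seq-border s)
    seq-border (tensor {p = p} {q} {ns = ns} {cs} {ms} {ds} e s t) =
      border-cons (cong conclusions e) (cong premises e) (border-resp ↭-refl
        (↭-prep p (shift q cs ds))
        (border-++ (seq-border s) (seq-border t)))
    seq-border (resp p q s) = border-resp p q (seq-border s)

    tree-border : ∀ {ns a} → Tree R ns a → Bordered ns [ a ]
    tree-border (leaf l)   = border-cons (leaf-conc l) (leaf-prem l) (bordered ↭-refl)
    tree-border (der e t)  = border-cons (cong conclusions e) (cong premises e) (tree-border t)
    tree-border (binary {ns = ns} {ms} b t u) = border-cons (binary-conc b) (binary-prem b)
      (border-++ (tree-border t) (tree-border u))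

    module _ {ns cs} (B : Bordered ns cs) where
      private b = Bordered.border-↭ B

      prem-tail : ∀ {v p} → v ∈ ns → p ∈ prem v → tail p ∈ ns
      prem-tail v∈ p∈
        with u , u∈ , i ← concatMap-∈ conc ns (∈-resp-↭ (↭-sym b) (∈-++⁺ʳ cs (∈-concatMap {f = prem} v∈ p∈)))
        = subst (_∈ ns) (tail-unique i) u∈

      border-tail : ∀ {a} → a ∈ cs → tail a ∈ ns
      border-tail a∈
        with u , u∈ , i ← concatMap-∈ conc ns (∈-resp-↭ (↭-sym b) (∈-++⁺ˡ a∈))
        = subst (_∈ ns) (tail-unique i) u∈

      tail-border : ∀ {a} → tail a ∈ ns → a ∈ cs ⊎ ∃ λ v → v ∈ ns × a ∈ prem v
      tail-border {a} t∈ with ∈-++⁻ cs (∈-resp-↭ b (∈-concatMap {f = conc} t∈ (tail∈ a)))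
      ... | inj₁ i = inj₁ i
      ... | inj₂ i = inj₂ (concatMap-∈ prem ns i)

    ∑ₙ : List (Fin (nodes R)) → (Node (arcs R) → ℕ) → ℕ
    ∑ₙ ns f = ∑ ns (f ∘ node R)

    -- Seen as a tree, a `Seq` has its leaves at `init` and branches only at `tensor`, in two.
    initial-joins : ∀ {ns cs} → Seq R ns cs → ∑ₙ ns initials ≡ suc (∑ₙ ns joins)
    initial-joins (init {v} i) with node R v | i
    ... | _ | ax  = refl
    ... | _ | one = refl
    ... | _ | box = refl
    initial-joins (leaf {v} l s) with node R v | l
    ... | _ | bot  = initial-joins s
    ... | _ | weak = initial-joins s
    initial-joins (der e s) rewrite e = initial-joins s
    initial-joins (binary {v} b s) with node R v | b
    ... | _ | par   = initial-joins s
    ... | _ | contr = initial-joins s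
    initial-joins (tensor {ns = ns} {ms = ms} e s t)
      rewrite e | ∑-++ (initials ∘ node R) ns ms | ∑-++ (joins ∘ node R) ns ms
            | initial-joins s | initial-joins t = cong suc (+-suc _ _)
    initial-joins (resp p q s) =
      trans (sym (∑-↭ (initials ∘ node R) p)) (trans (initial-joins s) (cong suc (∑-↭ (joins ∘ node R) p)))

    module _ (φ : Switching R) where
      private
        G = switchingGraph R φ
        𝔾 = switching φ

        _~_ : SwitchVertex R → SwitchVertex R → Set
        _~_ = Conn 𝔾 (allFin (arcs R))

        along : ∀ {a} x → a ∈ Graph.premises G x → internal (tail a) ~ x
        along {a} x i = subst (internal (tail a) ~_) (sym (FiniteGraph.tgt-unique 𝔾 {v = x} i))
                              (conn-arc 𝔾 (∈-allFin a))

        Near : SwitchVertex R → List (SwitchVertex R) → Set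
        Near u L = ∃ λ x → x ∈ L × u ~ x

        near-~ : ∀ {u v L} → u ~ v → Near v L → Near u L
        near-~ p (x , i , q) = x , i , conn-trans 𝔾 p q

        ~-sym : ∀ {u v} → u ~ v → v ~ u
        ~-sym = conn-sym 𝔾

        Representatives : List (Fin (nodes R)) → Set
        Representatives ns = ∃ λ L → length L ≡ suc (∑ₙ ns weakenings) ×
                                     (∀ {v} → v ∈ ns → Near (internal v) L)

        attach : ∀ {v a ns} → weakenings (node R v) ≡ 0 → a ∈ switchedPremises (node R v) (φ v) →
                 tail a ∈ ns → Representatives ns → Representatives (v ∷ ns)
        attach {v} {a} {ns} w i t (L , len , near) =
          L , trans len (cong (λ k → suc (k + ∑ₙ ns weakenings)) (sym w)) , λ where
            (here refl) → near-~ (~-sym (along (internal v) i)) (near t)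
            (there j)   → near j

        binary-weakenings : ∀ {x : Node (arcs R)} {p q a} → IsBinary x p q a → weakenings x ≡ 0
        binary-weakenings par   = refl
        binary-weakenings contr = refl

      -- A ⊥ or ?w node may start a component and brings its own representative. A der, ⅋ or ?c node
      -- is linked to the older part by a kept premise, whichever one the switching keeps.
      representatives : ∀ {ns cs} → Seq R ns cs → Representatives ns
      representatives (init {v} i) = [ internal v ] , cong suc (sym (weak0 i)) ,
        λ { (here refl) → _ , here refl , conn-refl 𝔾 }
        where
        weak0 : ∀ {x : Node (arcs R)} → IsInitial x → weakenings x + 0 ≡ 0
        weak0 ax  = refl
        weak0 one = refl
        weak0 box = refl
      representatives (leaf {v} {ns = ns} l s) with L , len , near ← representatives s =
        internal v ∷ L , cong suc (trans len (cong (_+ ∑ₙ ns weakenings) (sym (weak1 l)))) , λ where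
          (here refl) → _ , here refl , conn-refl 𝔾
          (there j)   → case near j of λ (x , i , p) → x , there i , p
        where
        weak1 : ∀ {x : Node (arcs R)} {a} → IsLeaf x a → weakenings x ≡ 1
        weak1 bot  = refl
        weak1 weak = refl
      representatives (der {v} e s) =
        attach (cong weakenings e) (der-kept (φ v) e) (border-tail (seq-border s) (here refl)) (representatives s)
      representatives (binary {v} b s) with binary-kept (φ v) b
      ... | inj₁ i = attach (binary-weakenings b) i (border-tail (seq-border s) (here refl)) (representatives s)
      ... | inj₂ i = attach (binary-weakenings b) i (border-tail (seq-border s) (there (here refl))) (representatives s)
      representatives (tensor {v} {p} {q} {ns = ns} {ms = ms} e s t)
        with L₁ , len₁ , near₁ ← representatives s | L₂ , len₂ , near₂ ← representatives t
        with x , x∈ , p~x ← near₁ (border-tail (seq-border s) (here refl))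
        with L , L₁↭ ← ∈⇒↭∷ x∈ = L ⊕ L₂ , len , near
        where
        v-near : Near (internal v) L₂
        v-near = near-~ (~-sym (along (internal v) (proj₂ (tensor-kept (φ v) e))))
                        (near₂ (border-tail (seq-border t) (here refl)))
        x-near : Near x L₂
        x-near = near-~ (~-sym p~x) (near-~ (along (internal v) (proj₁ (tensor-kept (φ v) e))) v-near)
        wider : ∀ {u} → Near u L₂ → Near u (L ⊕ L₂)
        wider (y , i , r) = y , ∈-++⁺ʳ L i , r
        near : ∀ {u} → u ∈ v ∷ ns ⊕ ms → Near (internal u) (L ⊕ L₂)
        near (here refl) = wider v-near
        near (there u∈) with ∈-++⁻ ns u∈
        ... | inj₂ j = wider (near₂ j)
        ... | inj₁ j with near₁ j
        ...   | y , y∈ , r with ∈-resp-↭ L₁↭ y∈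
        ...     | here refl = wider (near-~ r x-near)
        ...     | there y∈L = y , ∈-++⁺ˡ y∈L , r
        len : length (L ⊕ L₂) ≡ suc (∑ₙ (v ∷ ns ⊕ ms) weakenings)
        len = begin
          length (L ⊕ L₂)                                   ≡⟨ List.length-++ L ⟩
          length L + length L₂                              ≡⟨ cong₂ _+_ (suc-injective (trans (sym (↭-length L₁↭)) len₁)) len₂ ⟩
          ∑ₙ ns weakenings + suc (∑ₙ ms weakenings)         ≡⟨ +-suc _ _ ⟩
          suc (∑ₙ ns weakenings + ∑ₙ ms weakenings)         ≡⟨ cong suc (∑-++ (weakenings ∘ node R) ns ms) ⟨
          suc (∑ₙ (ns ⊕ ms) weakenings)                     ≡⟨ cong (λ x → suc (weakenings x + ∑ₙ (ns ⊕ ms) weakenings)) e ⟨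
          suc (∑ₙ (v ∷ ns ⊕ ms) weakenings)                 ∎
          where open ≡-Reasoning
      representatives (resp p q s) with L , len , near ← representatives s =
        L , trans len (cong suc (∑-↭ (weakenings ∘ node R) p)) , near ∘ ∈-resp-↭ (↭-sym p)

      -- By `size-count` and `initial-joins` there are exactly `♯w R + 1` more vertices than arcs.
      -- With `k` components there can be at most `k` more, so `♯w R + 1 ≤ k`; `representatives`
      -- gives the converse, and equality forces a forest.
      correct : ∀ {ns cs} → ns ↭ V → Seq R ns cs →
                NoUndirectedCycle G × HasComponents G (♯w R + 1)
      correct {ns} p s′ with k , C , le , _ ← components 𝔾 (allFin (arcs R)) =
        tree-acyclic 𝔾 (allFin (arcs R)) ∈-allFin C (trans size≡ (cong (length (allFin (arcs R)) +_) (sym k≡))) ,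
        hasComponents 𝔾 (allFin (arcs R)) ∈-allFin (subst (Components 𝔾 (allFin (arcs R))) k≡ C)
        where
        s = resp p ↭-refl s′
        |A|≡ : length (allFin (arcs R)) ≡ arcs R
        |A|≡ = List.length-tabulate id
        size≡ : FiniteGraph.size 𝔾 ≡ length (allFin (arcs R)) + (♯w R + 1)
        size≡ = +-cancelʳ-≡ (∑ᴿ joins) _ _ (begin
          FiniteGraph.size 𝔾 + ∑ᴿ joins                           ≡⟨ size-count φ ⟩
          (arcs R + ♯w R) + ∑ᴿ initials                            ≡⟨ cong ((arcs R + ♯w R) +_) (initial-joins s) ⟩
          (arcs R + ♯w R) + suc (∑ᴿ joins)
            ≡⟨ solve 3 (λ a w j → (a :+ w) :+ (con 1 :+ j) := (a :+ (w :+ con 1)) :+ j) refl (arcs R) (♯w R) (∑ᴿ joins) ⟩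
          (arcs R + (♯w R + 1)) + ∑ᴿ joins                        ≡⟨ cong (λ n → (n + (♯w R + 1)) + ∑ᴿ joins) |A|≡ ⟨
          (length (allFin (arcs R)) + (♯w R + 1)) + ∑ᴿ joins      ∎)
          where
          open ≡-Reasoning
          open +-*-Solver
        near-all : ∀ x → Near x (proj₁ (representatives s))
        near-all (internal v) = proj₂ (proj₂ (representatives s)) (∈-allFin v)
        near-all (• i)        = near-~ (~-sym (along (• i) (here refl))) (near-all (internal _))
        near-all (fresh v d)  = near-~ (~-sym (along (fresh v d) (here refl))) (near-all (internal _))
        k≤ : k ≤ ♯w R + 1
        k≤ = subst (k ≤_)
          (trans (proj₁ (proj₂ (representatives s)))
            (trans (cong suc (sym (length-filterᵇ (isWeakening ∘ node R) V))) (+-comm 1 (♯w R))))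
          (spanned-≤ 𝔾 (allFin (arcs R)) ∈-allFin C _ near-all)
        k≡ : k ≡ ♯w R + 1
        k≡ = ℕ.≤-antisym k≤ (ℕ.+-cancelˡ-≤ (length (allFin (arcs R))) _ _ (subst (_≤ length (allFin (arcs R)) + k) size≡ le))

-- Embedded structures, and the `Seq` of a proof

module Matching (𝒜 : Atoms) where
  open MELL 𝒜
  open Nodes 𝒜
  open Sequents 𝒜

  -- y is the image of x along f, up to the symmetries allowed by _≈_.
  data Match {m n : ℕ} (f : Fin m → Fin n) : Node m → Node n → Set where
    ax         : ∀ {a b a′ b′} → f a ≡ a′ → f b ≡ b′ → Match f (ax a b) (ax a′ b′)
    swap-ax    : ∀ {a b a′ b′} → f a ≡ b′ → f b ≡ a′ → Match f (ax a b) (ax a′ b′)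
    cut        : ∀ {p q p′ q′} → Match f (cut p q) (cut p′ q′)
    one        : ∀ {a a′} → f a ≡ a′ → Match f (one a) (one a′)
    bot        : ∀ {a a′} → f a ≡ a′ → Match f (bot a) (bot a′)
    tensor     : ∀ {p q a p′ q′ a′} → f p ≡ p′ → f q ≡ q′ → f a ≡ a′ →
                 Match f (tensor p q a) (tensor p′ q′ a′)
    par        : ∀ {p q a p′ q′ a′} → f p ≡ p′ → f q ≡ q′ → f a ≡ a′ →
                 Match f (par p q a) (par p′ q′ a′)
    weak       : ∀ {a a′} → f a ≡ a′ → Match f (weak a) (weak a′)
    contr      : ∀ {p q a p′ q′ a′} → f p ≡ p′ → f q ≡ q′ → f a ≡ a′ →
                 Match f (contr p q a) (contr p′ q′ a′)
    swap-contr : ∀ {p q a p′ q′ a′} → f p ≡ q′ → f q ≡ p′ → f a ≡ a′ →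
                 Match f (contr p q a) (contr p′ q′ a′)
    der        : ∀ {p a p′ a′} → f p ≡ p′ → f a ≡ a′ → Match f (der p a) (der p′ a′)
    box        : ∀ {c d} {S : PreStructure c} {S′ : PreStructure d} {i j as bs}
                 (ρ : Permutation d c) → Iso ρ S′ S → ρ ⟨$⟩ʳ j ≡ i →
                 (∀ k → lookup bs k ≡ f (lookup as (ρ ⟨$⟩ʳ k))) →
                 Match f (box S i as) (box S′ j bs)

  module _ {l m n} {f : Fin m → Fin n} {g : Fin l → Fin m} {h : Fin l → Fin n}
           (f∘g : ∀ a → f (g a) ≡ h a) where

    match-mapNode⁺ : ∀ {x y} → Match h x y → Match f (mapNode g x) y
    match-mapNode⁺ (ax e e₁)            = ax (trans (f∘g _) e) (trans (f∘g _) e₁)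
    match-mapNode⁺ (swap-ax e e₁)       = swap-ax (trans (f∘g _) e) (trans (f∘g _) e₁)
    match-mapNode⁺ cut                  = cut
    match-mapNode⁺ (one e)              = one (trans (f∘g _) e)
    match-mapNode⁺ (bot e)              = bot (trans (f∘g _) e)
    match-mapNode⁺ (tensor e e₁ e₂)     = tensor (trans (f∘g _) e) (trans (f∘g _) e₁) (trans (f∘g _) e₂)
    match-mapNode⁺ (par e e₁ e₂)        = par (trans (f∘g _) e) (trans (f∘g _) e₁) (trans (f∘g _) e₂)
    match-mapNode⁺ (weak e)             = weak (trans (f∘g _) e)
    match-mapNode⁺ (contr e e₁ e₂)      = contr (trans (f∘g _) e) (trans (f∘g _) e₁) (trans (f∘g _) e₂)
    match-mapNode⁺ (swap-contr e e₁ e₂) = swap-contr (trans (f∘g _) e) (trans (f∘g _) e₁) (trans (f∘g _) e₂)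
    match-mapNode⁺ (der e e₁)           = der (trans (f∘g _) e) (trans (f∘g _) e₁)
    match-mapNode⁺ (box {as = as} ρ iso e es) = box ρ iso e λ k →
      trans (es k) (sym (trans (cong f (Vec.lookup-map _ g as)) (f∘g _)))

    match-mapNode⁻ : ∀ {x y} → Match f (mapNode g x) y → Match h x y
    match-mapNode⁻ {ax _ _}       (ax e e₁)            = ax (trans (sym (f∘g _)) e) (trans (sym (f∘g _)) e₁)
    match-mapNode⁻ {ax _ _}       (swap-ax e e₁)       = swap-ax (trans (sym (f∘g _)) e) (trans (sym (f∘g _)) e₁)
    match-mapNode⁻ {cut _ _}      cut                  = cut
    match-mapNode⁻ {one _}        (one e)              = one (trans (sym (f∘g _)) e)
    match-mapNode⁻ {bot _}        (bot e)              = bot (trans (sym (f∘g _)) e)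
    match-mapNode⁻ {tensor _ _ _} (tensor e e₁ e₂)     = tensor (trans (sym (f∘g _)) e) (trans (sym (f∘g _)) e₁) (trans (sym (f∘g _)) e₂)
    match-mapNode⁻ {par _ _ _}    (par e e₁ e₂)        = par (trans (sym (f∘g _)) e) (trans (sym (f∘g _)) e₁) (trans (sym (f∘g _)) e₂)
    match-mapNode⁻ {weak _}       (weak e)             = weak (trans (sym (f∘g _)) e)
    match-mapNode⁻ {contr _ _ _}  (contr e e₁ e₂)      = contr (trans (sym (f∘g _)) e) (trans (sym (f∘g _)) e₁) (trans (sym (f∘g _)) e₂)
    match-mapNode⁻ {contr _ _ _}  (swap-contr e e₁ e₂) = swap-contr (trans (sym (f∘g _)) e) (trans (sym (f∘g _)) e₁) (trans (sym (f∘g _)) e₂)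
    match-mapNode⁻ {der _ _}      (der e e₁)           = der (trans (sym (f∘g _)) e) (trans (sym (f∘g _)) e₁)
    match-mapNode⁻ {box _ _ as}   (box ρ iso e es)     = box ρ iso e λ k →
      trans (es k) (trans (cong f (Vec.lookup-map _ g as)) (f∘g _))

  mapNode-id : ∀ {m} (x : Node m) → mapNode id x ≡ x
  mapNode-id (ax a b)       = refl
  mapNode-id (cut p q)      = refl
  mapNode-id (one a)        = refl
  mapNode-id (bot a)        = refl
  mapNode-id (tensor p q a) = refl
  mapNode-id (par p q a)    = refl
  mapNode-id (weak a)       = refl
  mapNode-id (contr p q a)  = refl
  mapNode-id (der p a)      = refl
  mapNode-id (box S i as)   = cong (box S i) (Vec.map-id as)

  Iso-refl : ∀ {c} (S : PreStructure c) → Iso Perm.id S S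
  Iso-refl S = record
    { nodeBij = Perm.id
    ; arcBij  = Perm.id
    ; type-≡  = λ _ → refl
    ; node-≈  = λ v → subst (_≈ node S v) (sym (mapNode-id (node S v))) same
    ; concl-≡ = λ _ → refl
    }

  match-refl : ∀ {m} (x : Node m) → Match id x x
  match-refl (ax a b)       = ax refl refl
  match-refl (cut p q)      = cut
  match-refl (one a)        = one refl
  match-refl (bot a)        = bot refl
  match-refl (tensor p q a) = tensor refl refl refl
  match-refl (par p q a)    = par refl refl refl
  match-refl (weak a)       = weak refl
  match-refl (contr p q a)  = contr refl refl refl
  match-refl (der p a)      = der refl refl
  match-refl (box S i as)   = box Perm.id (Iso-refl S) refl λ _ → refl

  module _ {m n} (f : Fin m → Fin n) (g : Fin n → Fin m) (f∘g : ∀ a → f (g a) ≡ a) where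

    -- The comparison is turned round: in an isomorphism, `_≈_` follows the map of arcs from R to
    -- the structure of the proof, while `Match` follows a map back into R.
    ≈⇒match : ∀ {x y} → mapNode g x ≈ y → Match f y x
    -- Splitting `x` lets `mapNode g x` reduce; otherwise the constructors of `_≈_` could not be
    -- matched against it.
    ≈⇒match {x@(ax _ _)} same = match-mapNode⁺ f∘g (match-refl x)
    ≈⇒match {x@(cut _ _)} same = match-mapNode⁺ f∘g (match-refl x)
    ≈⇒match {x@(one _)} same = match-mapNode⁺ f∘g (match-refl x)
    ≈⇒match {x@(bot _)} same = match-mapNode⁺ f∘g (match-refl x)
    ≈⇒match {x@(tensor _ _ _)} same = match-mapNode⁺ f∘g (match-refl x)
    ≈⇒match {x@(par _ _ _)} same = match-mapNode⁺ f∘g (match-refl x)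
    ≈⇒match {x@(weak _)} same = match-mapNode⁺ f∘g (match-refl x)
    ≈⇒match {x@(contr _ _ _)} same = match-mapNode⁺ f∘g (match-refl x)
    ≈⇒match {x@(der _ _)} same = match-mapNode⁺ f∘g (match-refl x)
    ≈⇒match {x@(box _ _ _)} same = match-mapNode⁺ f∘g (match-refl x)
    ≈⇒match {ax _ _}      swap-ax    = swap-ax (f∘g _) (f∘g _)
    ≈⇒match {cut _ _}     swap-cut   = cut
    ≈⇒match {contr _ _ _} swap-contr = swap-contr (f∘g _) (f∘g _) (f∘g _)
    ≈⇒match {box _ _ as} (box ρ iso e es) = box ρ iso e λ k →
      trans (sym (f∘g _)) (cong f (sym (trans (es k) (Vec.lookup-map k g as))))

    match⇒≈ : ∀ {x y} → (∀ p q → x ≢ cut p q) → Match g y x → mapNode f x ≈ y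
    match⇒≈ nc cut = contradiction refl (nc _ _)
    match⇒≈ nc (ax {a} {b} refl refl) rewrite f∘g a | f∘g b = same
    match⇒≈ nc (swap-ax {a} {b} refl refl) rewrite f∘g a | f∘g b = swap-ax
    match⇒≈ nc (one {a} refl) rewrite f∘g a = same
    match⇒≈ nc (bot {a} refl) rewrite f∘g a = same
    match⇒≈ nc (tensor {p} {q} {a} refl refl refl) rewrite f∘g p | f∘g q | f∘g a = same
    match⇒≈ nc (par {p} {q} {a} refl refl refl) rewrite f∘g p | f∘g q | f∘g a = same
    match⇒≈ nc (weak {a} refl) rewrite f∘g a = same
    match⇒≈ nc (contr {p} {q} {a} refl refl refl) rewrite f∘g p | f∘g q | f∘g a = same
    match⇒≈ nc (swap-contr {p} {q} {a} refl refl refl) rewrite f∘g p | f∘g q | f∘g a = swap-contr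
    match⇒≈ nc (der {p} {a} refl refl) rewrite f∘g p | f∘g a = same
    match⇒≈ nc (box {bs = bs} ρ iso e es) = box ρ iso e λ k →
      sym (trans (Vec.lookup-map k f bs) (trans (cong f (es k)) (f∘g _)))

  -- nm and am need not be onto: in inductions, T covers only a part of R.
  record Embeds {c d} (T : PreStructure c) (R : PreStructure d)
                (nm : Fin (nodes T) → Fin (nodes R)) (am : Fin (arcs T) → Fin (arcs R)) : Set where
    constructor embeds
    field matches : ∀ w → Match am (node T w) (node R (nm w))

  open Embeds public

  border : ∀ {c n} (T : PreStructure c) → (Fin (arcs T) → Fin n) → List (Fin n)
  border T am = toList (Vec.map am (concl T))

  last-split : ∀ {X : Set} k (xs : Vec X (k + 1)) →
               toList xs ≡ toList (Vec.take k xs) ⊕ [ lookup xs (k ↑ʳ zero) ]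
  last-split zero    (x ∷ []) = refl
  last-split (suc k) (x ∷ xs) = cong (x ∷_) (last-split k xs)

  last-two-split : ∀ {X : Set} k (xs : Vec X (k + 2)) →
    toList xs ≡ toList (Vec.take k xs) ⊕ (lookup xs (k ↑ʳ zero) ∷ lookup xs (k ↑ʳ suc zero) ∷ [])
  last-two-split zero    (x ∷ y ∷ []) = refl
  last-two-split (suc k) (x ∷ xs)     = cong (x ∷_) (last-two-split k xs)

  toList-map² : ∀ {X Y Z : Set} {n} (f : Y → Z) (g : X → Y) (xs : Vec X n) →
                toList (Vec.map f (Vec.map g xs)) ≡ toList (Vec.map (f ∘ g) xs)
  toList-map² f g xs = cong toList (sym (Vec.map-∘ f g xs))

  toList-map-++ : ∀ {X Y : Set} {m n} (f : X → Y) (xs : Vec X m) (ys : Vec X n) →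
                  toList (Vec.map f (xs ++ ys)) ≡ toList (Vec.map f xs) ⊕ toList (Vec.map f ys)
  toList-map-++ f xs ys = trans (cong toList (Vec.map-++ f xs ys)) (Vec.toList-++ (Vec.map f xs) _)

  module _ {n : ℕ} {X : Set} where

    -- The sequent rules act at the end of a sequent, `Seq` at the front of its outputs; this lemma
    -- and the next two convert between the conventions.
    border-last : ∀ k (am : Fin n → X) (xs : Vec (Fin n) (k + 1)) →
                  toList (Vec.map am xs) ↭
                  am (lookup xs (k ↑ʳ zero)) ∷ toList (Vec.map am (Vec.take k xs))
    border-last k am xs = ↭-trans
      (↭-reflexive (trans (Vec.toList-map am xs) (trans (cong (List.map am) (last-split k xs))
        (trans (List.map-++ am (toList (Vec.take k xs)) _)
          (cong (_⊕ [ am (lookup xs (k ↑ʳ zero)) ]) (sym (Vec.toList-map am (Vec.take k xs))))))))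
      (++-comm (toList (Vec.map am (Vec.take k xs))) _)

    border-last-two : ∀ k (am : Fin n → X) (xs : Vec (Fin n) (k + 2)) →
                      toList (Vec.map am xs) ↭
                      am (lookup xs (k ↑ʳ zero)) ∷ am (lookup xs (k ↑ʳ suc zero)) ∷
                      toList (Vec.map am (Vec.take k xs))
    border-last-two k am xs = ↭-trans
      (↭-reflexive (trans (Vec.toList-map am xs) (trans (cong (List.map am) (last-two-split k xs))
        (trans (List.map-++ am (toList (Vec.take k xs)) _)
          (cong (_⊕ (am (lookup xs (k ↑ʳ zero)) ∷ am (lookup xs (k ↑ʳ suc zero)) ∷ []))
            (sym (Vec.toList-map am (Vec.take k xs))))))))
      (++-comm (toList (Vec.map am (Vec.take k xs))) _)

    border-snoc : ∀ {k} (am : Fin (suc n) → X) (xs : Vec (Fin n) k) →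
                  am zero ∷ toList (Vec.map (am ∘ suc) xs) ↭
                  toList (Vec.map am (Vec.map suc xs ++ zero ∷ []))
    border-snoc am xs = ↭-trans (++-comm [ am zero ] _)
      (↭-reflexive (sym (trans (toList-map-++ am (Vec.map suc xs) _)
        (cong (_⊕ _) (toList-map² am suc xs)))))

  module _ {d} {R : PreStructure d} (cut-free : CutFree R) {ℱ : Fragment} where

    -- Induction on π for arbitrary embeddings, because the structure of a premise of π embeds only
    -- into a part of R. The node of the last rule matches a node of R of the same sort, which
    -- yields the constructor of `Seq`. Exchange becomes `resp`, and a cut rule would match a cut
    -- node of R.
    deseq⇒seq : ∀ {c} {Γ : Vec Formula c} (π : Proof ℱ Γ) {nm am} →
                Embeds (desequentialize π) R nm am →
                Seq R (tabulate nm) (border (desequentialize π) am)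
    deseq⇒seq (axiom _) {nm} {am} (embeds em) = axiom-seq (em zero)
      where
      axiom-seq : Match am (ax zero (suc zero)) (node R (nm zero)) → Seq R [ nm zero ] (am zero ∷ am (suc zero) ∷ [])
      axiom-seq mt with node R (nm zero) in eq | mt
      ... | ax a b | ax e e₁ = resp ↭-refl
              (↭-reflexive (trans (cong conclusions eq) (sym (cong₂ (λ x y → x ∷ y ∷ []) e e₁))))
              (init (subst IsInitial (sym eq) ax))
      ... | ax a b | swap-ax e e₁ = resp ↭-refl
              (↭-trans (↭-reflexive (trans (cong conclusions eq) (sym (cong₂ (λ x y → x ∷ y ∷ []) e₁ e))))
                (↭.swap _ _ ↭-refl))
              (init (subst IsInitial (sym eq) ax))
    deseq⇒seq (cut _ π₁ π₂) {nm} (embeds em) with node R (nm zero) in eq | em zero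
    ... | cut p q | cut = ⊥-elim (CutFree.no-cut cut-free _ p q eq)
    deseq⇒seq (exchange _ σ _ π) {nm} {am} (embeds em) = resp ↭-refl
      (↭-sym (subst₂ _↭_ (sym (toList-tabulate _)) (sym (toList-tabulate _)) (permute-↭ σ λ i →
        trans (Vec.lookup-map i am (Vec.tabulate _)) (trans (cong am (Vec.lookup∘tabulate _ i))
          (sym (Vec.lookup-map (σ ⟨$⟩ʳ i) am (concl (desequentialize π))))))))
      (deseq⇒seq π {nm} {am} (embeds em))
    deseq⇒seq (tensor {k} _ π₁ π₂) {nm} {am} (embeds em) = tensor-seq (em zero)
      where
      T₁ = desequentialize π₁
      T₂ = desequentialize π₂
      am₁ = am ∘ suc ∘ (_↑ˡ arcs T₂)
      am₂ = am ∘ suc ∘ (arcs T₁ ↑ʳ_)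
      open Join {k} T₁ T₂
      s₁ : Seq R _ _
      s₁ = deseq⇒seq π₁ {nm ∘ suc ∘ (_↑ˡ nodes T₂)} {am₁} (embeds λ w →
        match-mapNode⁻ (λ _ → refl) (match-mapNode⁻ (λ _ → refl) (subst (λ x → Match am (mapNode suc x) (node R (nm (suc (w ↑ˡ nodes T₂)))))
          (F.lookup-++ˡ (mapNode inR ∘ node T₁) (mapNode inS ∘ node T₂) w) (em (suc (w ↑ˡ nodes T₂))))))
      s₂ : Seq R _ _
      s₂ = deseq⇒seq π₂ {nm ∘ suc ∘ (nodes T₁ ↑ʳ_)} {am₂} (embeds λ w →
        match-mapNode⁻ (λ _ → refl) (match-mapNode⁻ (λ _ → refl) (subst (λ x → Match am (mapNode suc x) (node R (nm (suc (nodes T₁ ↑ʳ w)))))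
          (F.lookup-++ʳ (mapNode inR ∘ node T₁) (mapNode inS ∘ node T₂) w) (em (suc (nodes T₁ ↑ʳ w))))))
      head-tail : ∀ {X Y : Set} {n} (f : X → Y) (xs : Vec X (suc n)) →
                  toList (Vec.map f xs) ≡ f (Vec.head xs) ∷ toList (Vec.map f (Vec.tail xs))
      head-tail f (x ∷ xs) = refl
      ds₁ = toList (Vec.map am₁ (Vec.take k (concl T₁)))
      ds₂ = toList (Vec.map am₂ (Vec.tail (concl T₂)))
      tensor-seq : Match am (tensor (suc p) (suc q) zero) (node R (nm zero)) →
                   Seq R (tabulate nm) (toList (Vec.map am (Vec.map suc Γ ++ zero ∷ Vec.map suc Δ)))
      tensor-seq mt with node R (nm zero) in eq | mt
      ... | tensor _ _ _ | tensor refl refl refl = resp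
        (↭-prep (nm zero) (↭-reflexive (sym (tabulate-++ (nodes T₁) (nm ∘ suc)))))
        (↭-trans (↭-sym (shift (am zero) ds₁ ds₂))
          (↭-reflexive (sym (trans (toList-map-++ am (Vec.map suc Γ) _) (cong₂ _⊕_
            (trans (toList-map² am suc Γ) (toList-map² (am ∘ suc) inR (Vec.take k (concl T₁))))
            (cong (am zero ∷_) (trans (toList-map² am suc Δ) (toList-map² (am ∘ suc) inS (Vec.tail (concl T₂))))))))))
        (tensor {ns = tabulate (nm ∘ suc ∘ (_↑ˡ nodes T₂))} {ds₁} {tabulate (nm ∘ suc ∘ (nodes T₁ ↑ʳ_))} {ds₂} eq
          (resp ↭-refl (border-last k am₁ (concl T₁)) s₁)
          (resp ↭-refl (↭-reflexive (head-tail am₂ (concl T₂))) s₂))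
    deseq⇒seq (one _) {nm} {am} (embeds em) with node R (nm zero) in eq | em zero
    ... | one _ | one refl = resp ↭-refl (↭-reflexive (cong conclusions eq)) (init (subst IsInitial (sym eq) one))
    deseq⇒seq (par {k} _ π) {nm} {am} (embeds em) with node R (nm zero) in eq | em zero
    ... | par _ _ _ | par refl refl refl = resp ↭-refl (border-snoc am (Vec.take k (concl (desequentialize π))))
      (binary (subst (λ x → IsBinary x _ _ _) (sym eq) par)
        (resp ↭-refl (border-last-two k (am ∘ suc) (concl (desequentialize π)))
          (deseq⇒seq π (embeds λ w → match-mapNode⁻ (λ _ → refl) (em (suc w))))))
    deseq⇒seq (bottom _ π) {nm} {am} (embeds em) with node R (nm zero) in eq | em zero
    ... | bot _ | bot refl = resp ↭-refl (border-snoc am (concl (desequentialize π)))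
      (leaf (subst (λ x → IsLeaf x _) (sym eq) bot)
        (deseq⇒seq π (embeds λ w → match-mapNode⁻ (λ _ → refl) (em (suc w)))))
    deseq⇒seq (dereliction {k} _ π) {nm} {am} (embeds em) with node R (nm zero) in eq | em zero
    ... | der _ _ | der refl refl = resp ↭-refl (border-snoc am (Vec.take k (concl (desequentialize π))))
      (der eq (resp ↭-refl (border-last k (am ∘ suc) (concl (desequentialize π)))
        (deseq⇒seq π (embeds λ w → match-mapNode⁻ (λ _ → refl) (em (suc w))))))
    deseq⇒seq (weakening _ π) {nm} {am} (embeds em) with node R (nm zero) in eq | em zero
    ... | weak _ | weak refl = resp ↭-refl (border-snoc am (concl (desequentialize π)))
      (leaf (subst (λ x → IsLeaf x _) (sym eq) weak)
        (deseq⇒seq π (embeds λ w → match-mapNode⁻ (λ _ → refl) (em (suc w)))))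
    deseq⇒seq (contraction {k} _ π) {nm} {am} (embeds em) with node R (nm zero) in eq | em zero
    ... | contr _ _ _ | contr refl refl refl = resp ↭-refl (border-snoc am (Vec.take k (concl (desequentialize π))))
      (binary (subst (λ x → IsBinary x _ _ _) (sym eq) contr)
        (resp ↭-refl (border-last-two k (am ∘ suc) (concl (desequentialize π)))
          (deseq⇒seq π (embeds λ w → match-mapNode⁻ (λ _ → refl) (em (suc w))))))
    -- The match may exchange the premises of ?c; `binary` takes them in the order given by R.
    ... | contr _ _ _ | swap-contr refl refl refl = resp ↭-refl (border-snoc am (Vec.take k (concl (desequentialize π))))
      (binary (subst (λ x → IsBinary x _ _ _) (sym eq) contr)
        (resp ↭-refl (↭-trans (border-last-two k (am ∘ suc) (concl (desequentialize π))) (↭.swap _ _ ↭-refl))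
          (deseq⇒seq π (embeds λ w → match-mapNode⁻ (λ _ → refl) (em (suc w))))))
    deseq⇒seq (promotion {k} _ π) {nm} {am} (embeds em) = box-seq (em zero)
      where
      box-seq : Match am (box (desequentialize π) (k ↑ʳ zero) (Vec.allFin (k + 1))) (node R (nm zero)) →
                Seq R [ nm zero ] (toList (Vec.map am (Vec.allFin (k + 1))))
      box-seq mt with node R (nm zero) in eq | mt
      ... | box S j bs | box ρ _ _ es = resp ↭-refl
        (↭-trans (↭-reflexive (cong conclusions eq))
          (subst₂ _↭_ (sym (toList-tabulate bs)) (sym (toList-tabulate _)) (permute-↭ ρ λ k →
            trans (es k) (sym (Vec.lookup-map _ am (Vec.allFin _))))))
        (init (subst IsInitial (sym eq) box))

-- Sequentializable structures are correct

module Soundness (𝒜 : Atoms) where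
  open MELL 𝒜
  open Nodes 𝒜
  open Sequents 𝒜
  open Matching 𝒜

  content-mapNode : ∀ {P : ∀ {c} → PreStructure c → Set} {m n} (f : Fin m → Fin n) (x : Node m) →
                    Content P x → Content P (mapNode f x)
  content-mapNode f (ax a b)       _ = tt
  content-mapNode f (cut p q)      _ = tt
  content-mapNode f (one a)        _ = tt
  content-mapNode f (bot a)        _ = tt
  content-mapNode f (tensor p q a) _ = tt
  content-mapNode f (par p q a)    _ = tt
  content-mapNode f (weak a)       _ = tt
  content-mapNode f (contr p q a)  _ = tt
  content-mapNode f (der p a)      _ = tt
  content-mapNode f (box S i as)   q = q

  content-++ : ∀ {P : ∀ {c} → PreStructure c → Set} {k k′ l l′ m} {g : Fin l → Fin m} {h : Fin l′ → Fin m}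
               (x : Fin k → Node l) (y : Fin k′ → Node l′) →
               (∀ w → Content P (x w)) → (∀ w → Content P (y w)) →
               ∀ w → Content P (((mapNode g ∘ x) F.++ (mapNode h ∘ y)) w)
  content-++ {P} {k} x y px py w with splitAt k w
  ... | inj₁ u = content-mapNode {P} _ (x u) (px u)
  ... | inj₂ u = content-mapNode {P} _ (y u) (py u)

  iso⇒embeds : ∀ {c d} {ρ : Permutation d c} {R : PreStructure d} {T : PreStructure c} (iso : Iso ρ R T) →
               Embeds T R (Iso.nodeBij iso ⟨$⟩ˡ_) (Iso.arcBij iso ⟨$⟩ˡ_)
  iso⇒embeds {R = R} {T} iso = embeds λ w →
    ≈⇒match (arcBij ⟨$⟩ˡ_) (arcBij ⟨$⟩ʳ_) (λ _ → inverseˡ arcBij)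
      (subst (λ u → mapNode (arcBij ⟨$⟩ʳ_) (node R (nodeBij ⟨$⟩ˡ w)) ≈ node T u) (inverseʳ nodeBij)
        (node-≈ (nodeBij ⟨$⟩ˡ w)))
    where open Iso iso

  module _ {ℱ : Fragment} where

    -- Stated for every R isomorphic to `T`, along any bijection ρ of conclusions: that is how the
    -- content of a box of R is related to the content built by a promotion rule.
    Correct : ∀ {c} → PreStructure c → Set
    Correct T = ∀ {d} {ρ : Permutation d _} (R : PreStructure d) →
                IsProofStructure R → CutFree R → Iso ρ R T → ACC♯w R

    private
      content-correct : ∀ {m n} {g : Fin m → Fin n} (x : Node m) {y : Node n} → mapNode g x ≈ y →
                        Content Correct y → Content IsProofStructure x → Content CutFree x →
                        Content ACC♯w x
      content-correct (ax a b)       _ _ _ _ = tt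
      content-correct (cut p q)      _ _ _ _ = tt
      content-correct (one a)        _ _ _ _ = tt
      content-correct (bot a)        _ _ _ _ = tt
      content-correct (tensor p q a) _ _ _ _ = tt
      content-correct (par p q a)    _ _ _ _ = tt
      content-correct (weak a)       _ _ _ _ = tt
      content-correct (contr p q a)  _ _ _ _ = tt
      content-correct (der p a)      _ _ _ _ = tt
      content-correct (box S i as) same            q ps cf = q S ps cf (Iso-refl S)
      content-correct (box S i as) (box ρ iso _ _) q ps cf = q S ps cf iso

    -- `correct` settles the ground level. The contents stem from the proofs above promotion rules,
    -- which `contents-correct` reaches by structural recursion through the other rules.
    sequentializable⇒correct : ∀ {c} {Γ : Vec Formula c} (π : Proof ℱ Γ) → Correct (desequentialize π)
    contents-correct : ∀ {c} {Γ : Vec Formula c} (π : Proof ℱ Γ) →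
                       ∀ w → Content Correct (node (desequentialize π) w)

    sequentializable⇒correct π R ps cf iso = record
      { acyclic    = λ φ → proj₁ (correct φ nodes-↭ seq)
      ; components = λ φ → proj₂ (correct φ nodes-↭ seq)
      ; contents   = λ v → content-correct (node R v) (Iso.node-≈ iso v) (contents-correct π _)
                             (IsProofStructure.contents ps v) (CutFree.contents cf v)
      }
      where
      open Borders R (IsProofStructure.well-formed ps)
      seq : Seq R (tabulate (Iso.nodeBij iso ⟨$⟩ˡ_)) _
      seq = deseq⇒seq cf π (iso⇒embeds iso)
      nodes-↭ : tabulate (Iso.nodeBij iso ⟨$⟩ˡ_) ↭ allFin (nodes R)
      nodes-↭ = permute-↭ {g = id} (Perm.flip (Iso.nodeBij iso)) λ _ → refl

    contents-correct (axiom _)           w = tt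
    contents-correct (cut _ π₁ π₂)       zero = tt
    contents-correct (cut _ π₁ π₂)       (suc w) =
      content-++ {Correct} (node (desequentialize π₁)) (node (desequentialize π₂))
        (contents-correct π₁) (contents-correct π₂) w
    contents-correct (exchange _ σ _ π)  w = contents-correct π w
    contents-correct (tensor _ π₁ π₂)    zero = tt
    contents-correct (tensor {k} _ π₁ π₂) (suc w) =
      content-mapNode {Correct} suc (node (Join.union {k} (desequentialize π₁) (desequentialize π₂)) w)
        (content-++ {Correct} (node (desequentialize π₁)) (node (desequentialize π₂))
          (contents-correct π₁) (contents-correct π₂) w)
    contents-correct (one _)             w = tt
    contents-correct (par _ π)           zero = tt
    contents-correct (par _ π)           (suc w) =
      content-mapNode {Correct} suc (node (desequentialize π) w) (contents-correct π w)
    contents-correct (bottom _ π)        zero = tt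
    contents-correct (bottom _ π)        (suc w) =
      content-mapNode {Correct} suc (node (desequentialize π) w) (contents-correct π w)
    contents-correct (dereliction _ π)   zero = tt
    contents-correct (dereliction _ π)   (suc w) =
      content-mapNode {Correct} suc (node (desequentialize π) w) (contents-correct π w)
    contents-correct (weakening _ π)     zero = tt
    contents-correct (weakening _ π)     (suc w) =
      content-mapNode {Correct} suc (node (desequentialize π) w) (contents-correct π w)
    contents-correct (contraction _ π)   zero = tt
    contents-correct (contraction _ π)   (suc w) =
      content-mapNode {Correct} suc (node (desequentialize π) w) (contents-correct π w)
    contents-correct (promotion _ π)     w = sequentializable⇒correct π

-- From a `Seq` to a sequent calculus proof

Vec-ext : {X : Set} {n : ℕ} {xs ys : Vec X n} → (∀ i → lookup xs i ≡ lookup ys i) → xs ≡ ys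
Vec-ext {xs = xs} {ys} e =
  trans (sym (Vec.tabulate∘lookup xs)) (trans (Vec.tabulate-cong e) (Vec.tabulate∘lookup ys))

take-++ : {X : Set} {m n : ℕ} (xs : Vec X m) (ys : Vec X n) → Vec.take m (xs ++ ys) ≡ xs
take-++ []       ys = refl
take-++ (x ∷ xs) ys = cong (x ∷_) (take-++ xs ys)

module Completeness (𝒜 : Atoms) where
  open MELL 𝒜
  open Nodes 𝒜
  open Sequents 𝒜
  open Matching 𝒜

  module _ {ℱ : Fragment} where

    -- Unlike in `Sequentializable`, the sequent is fixed by the types of the conclusions, so that a
    -- promotion rule put below agrees with the types at the box.
    Sequentialized : ∀ {c} → PreStructure c → Set
    Sequentialized S = Σ (Proof ℱ (Vec.map (type S) (concl S))) λ π → S ≅ desequentialize π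

    module Build {c : ℕ} (R : PreStructure c) (ps : IsProofStructure R) (frag : R OfFragment ℱ)
                 (boxes : ∀ v → Content Sequentialized (node R v)) where
      open Ground R (IsProofStructure.well-formed ps)
      open Borders R (IsProofStructure.well-formed ps)

      private
        τ : Fin (arcs R) → Formula
        τ = type R

        variable
          k : ℕ
          ns : List (Fin (nodes R))
          cs : List (Fin (arcs R))

      -- The two permutations make `nm` and `am` enumerate a part of R without indexing that part by
      -- a `Fin`. For the list `V` of all nodes they turn into the two bijections of an isomorphism.
      record Covers (T : PreStructure k) (ns : List (Fin (nodes R))) : Set where
        field
          nm      : Fin (nodes T) → Fin (nodes R)
          am      : Fin (arcs T) → Fin (arcs R)
          embed   : Embeds T R nm am
          types-≡ : ∀ a → τ (am a) ≡ type T a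
          nodes-↭ : tabulate nm ↭ ns
          arcs-↭  : tabulate am ↭ concatMap conc ns

      open Covers

      -- `Δ` is kept apart from `Vec.map τ D` because the rules yield sequents such as
      -- `Vec.map τ xs ++ A ⅋ B ∷ []`, which equal it only propositionally.
      record Sequenced (ns : List (Fin (nodes R))) (D : Vec (Fin (arcs R)) k) (Δ : Vec Formula k) : Set where
        field
          proof   : Proof ℱ Δ
          covers  : Covers (desequentialize proof) ns
          concl-≡ : Vec.map (am covers) (concl (desequentialize proof)) ≡ D

      open Sequenced

      all-types : {D : Vec (Fin (arcs R)) k} {Δ : Vec Formula k} → Δ ≡ Vec.map τ D → AllV ℱ Δ
      all-types {D = []}    refl = []
      all-types {D = a ∷ D} refl = _OfFragment_.types frag a ∷ all-types refl

      Vec-↭-permute : ∀ {X : Set} {k l} {xs : Vec X k} {ys : Vec X l} → toList xs ↭ toList ys →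
                      ∃ λ (σ : Permutation k l) → ∀ i → lookup xs i ≡ lookup ys (σ ⟨$⟩ʳ i)
      Vec-↭-permute p = ↭-permute (subst₂ _↭_ (toList-tabulate _) (toList-tabulate _) p)

      reorder : ∀ {k l} {D : Vec _ k} {D′ : Vec _ l} {Δ Δ′} → Sequenced ns D Δ →
                Δ ≡ Vec.map τ D → toList D′ ↭ toList D → Δ′ ≡ Vec.map τ D′ → Sequenced ns D′ Δ′
      reorder {D = D} {D′} {Δ} {Δ′} s eΔ p eΔ′ with σ , eσ ← Vec-↭-permute p = record
        { proof   = exchange (all-types eΔ′) σ eqΔ (proof s)
        -- `permute` changes only `concl`, so the old matches serve for the new structure.
        ; covers  = record { Covers (covers s) hiding (embed) ; embed = embeds (matches (embed (covers s))) }
        ; concl-≡ = Vec-ext λ i → trans (Vec.lookup-map i (am (covers s)) (Vec.tabulate _))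
            (trans (cong (am (covers s)) (Vec.lookup∘tabulate _ i))
              (trans (sym (Vec.lookup-map (σ ⟨$⟩ʳ i) (am (covers s)) (concl (desequentialize (proof s)))))
                (trans (cong (λ D → lookup D (σ ⟨$⟩ʳ i)) (concl-≡ s)) (sym (eσ i)))))
        }
        where
        eqΔ : ∀ i → lookup Δ′ i ≡ lookup Δ (σ ⟨$⟩ʳ i)
        eqΔ i = trans (cong (λ Δ → lookup Δ i) eΔ′) (trans (Vec.lookup-map i τ D′) (trans (cong τ (eσ i))
          (trans (sym (Vec.lookup-map (σ ⟨$⟩ʳ i) τ D)) (cong (λ Δ → lookup Δ (σ ⟨$⟩ʳ i)) (sym eΔ)))))

      addNode-covers : ∀ {l} {T : PreStructure k} {A} {x : Node (suc (arcs T))} {as : Vec (Fin (suc (arcs T))) l} →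
                       (C : Covers T ns) (v : Fin (nodes R)) {a : Fin (arcs R)} → τ a ≡ A → conc v ≡ [ a ] →
                       Match (a F.∷ am C) x (node R v) → Covers (addNode T A x as) (v ∷ ns)
      addNode-covers C v {a} ea ev mt = record
        { nm      = v F.∷ nm C
        ; am      = a F.∷ am C
        ; embed   = embeds λ { zero → mt ; (suc w) → match-mapNode⁺ (λ _ → refl) (matches (embed C) w) }
        ; types-≡ = λ { zero → ea ; (suc b) → types-≡ C b }
        ; nodes-↭ = ↭-prep v (nodes-↭ C)
        ; arcs-↭  = ++⁺ (↭-reflexive (sym ev)) (arcs-↭ C)
        }

      union-covers : ∀ {k l ns ms} {T : PreStructure (k + 1)} {U : PreStructure (suc l)} →
                     Covers T ns → Covers U ms → Covers (Join.union {k} T U) (ns ⊕ ms)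
      union-covers {k} {l} {ns} {ms} {T} {U} C D = record
        { nm      = nm C F.++ nm D
        ; am      = am′
        ; embed   = embeds matches′
        ; types-≡ = types′
        ; nodes-↭ = ↭-trans (↭-reflexive (trans (tabulate-++ (nodes T) (nm C F.++ nm D)) (cong₂ _⊕_
            (List.tabulate-cong (F.lookup-++ˡ (nm C) (nm D))) (List.tabulate-cong (F.lookup-++ʳ (nm C) (nm D))))))
            (++⁺ (nodes-↭ C) (nodes-↭ D))
        ; arcs-↭  = ↭-trans (↭-reflexive (trans (tabulate-++ (arcs T) am′) (cong₂ _⊕_
            (List.tabulate-cong (F.lookup-++ˡ (am C) (am D))) (List.tabulate-cong (F.lookup-++ʳ (am C) (am D))))))
            (↭-trans (++⁺ (arcs-↭ C) (arcs-↭ D)) (↭-reflexive (sym (List.concatMap-++ conc ns ms))))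
        }
        where
        am′ = am C F.++ am D
        matches′ : ∀ w → Match am′ (node (Join.union {k} T U) w) (node R ((nm C F.++ nm D) w))
        matches′ w with splitAt (nodes T) w
        ... | inj₁ u = match-mapNode⁺ (F.lookup-++ˡ (am C) (am D)) (matches (embed C) u)
        ... | inj₂ u = match-mapNode⁺ (F.lookup-++ʳ (am C) (am D)) (matches (embed D) u)
        types′ : ∀ a → τ (am′ a) ≡ type (Join.union {k} T U) a
        types′ a with splitAt (arcs T) a
        ... | inj₁ b = types-≡ C b
        ... | inj₂ b = types-≡ D b

      singleNode-covers : ∀ {D : Vec _ k} {Δ x} v → Δ ≡ Vec.map τ D → toList D ↭ conc v →
                          Match (lookup D) x (node R v) → Covers (singleNode Δ x) [ v ]
      singleNode-covers {D = D} v eΔ p mt = record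
        { nm      = λ _ → v
        ; am      = lookup D
        ; embed   = embeds λ _ → mt
        ; types-≡ = λ a → trans (sym (Vec.lookup-map a τ D)) (cong (λ Δ → lookup Δ a) (sym eΔ))
        ; nodes-↭ = ↭-refl
        ; arcs-↭  = ↭-trans (↭-reflexive (sym (toList-tabulate D)))
                      (↭-trans p (↭-reflexive (sym (List.++-identityʳ (conc v)))))
        }

      take-concl : ∀ {k l m} (f : Fin m → Fin (arcs R)) {a} (C : Vec (Fin m) (k + l))
                   (xs : Vec (Fin (arcs R)) k) {ys : Vec (Fin (arcs R)) l} → Vec.map f C ≡ xs ++ ys →
                   Vec.map (a F.∷ f) (Vec.map suc (Vec.take k C)) ≡ xs
      take-concl {k} f C xs e = trans (sym (Vec.map-∘ _ suc (Vec.take k C))) (trans (sym (Vec.take-map f k C))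
        (trans (cong (Vec.take k) e) (take-++ xs _)))

      snoc-concl : ∀ {k m} (f : Fin m → Fin (arcs R)) {a} (C : Vec (Fin m) k) (xs : Vec (Fin (arcs R)) k) →
                   Vec.map (a F.∷ f) (Vec.map suc C) ≡ xs →
                   Vec.map (a F.∷ f) (Vec.map suc C ++ zero ∷ []) ≡ xs ++ a ∷ []
      snoc-concl f {a} C xs e = trans (Vec.map-++ (a F.∷ f) (Vec.map suc C) _) (cong (_++ a ∷ []) e)

      premise-at : ∀ {k l m} {f : Fin m → Fin (arcs R)} {C : Vec (Fin m) (k + l)}
                   (xs : Vec (Fin (arcs R)) k) {ys : Vec (Fin (arcs R)) l} →
                   Vec.map f C ≡ xs ++ ys → ∀ i → f (lookup C (k ↑ʳ i)) ≡ lookup ys i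
      premise-at {f = f} {C} xs {ys} e i = trans (sym (Vec.lookup-map _ f C))
        (trans (cong (λ D → lookup D _) e) (Vec.lookup-++ʳ xs ys i))

      -- Quantifying over all orders D of the conclusions keeps the exchange rule implicit.
      SeqProof : List (Fin (nodes R)) → List (Fin (arcs R)) → Set
      SeqProof ns cs = ∀ {k} (D : Vec (Fin (arcs R)) k) → toList D ↭ cs → ∀ {Δ} → Δ ≡ Vec.map τ D → Sequenced ns D Δ

      -- A proof for one order of the conclusions gives all the others by exchange.
      unordered : {D : Vec (Fin (arcs R)) k} {Δ : Vec Formula k} →
                  Sequenced ns D Δ → Δ ≡ Vec.map τ D → toList D ↭ cs → SeqProof ns cs
      unordered s e p D′ p′ e′ = reorder s e (↭-trans p′ (↭-sym p)) e′

      snoc-types : (xs : Vec (Fin (arcs R)) k) {l : ℕ} (ys : Vec (Fin (arcs R)) l) →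
                   Vec.map τ xs ++ Vec.map τ ys ≡ Vec.map τ (xs ++ ys)
      snoc-types xs ys = sym (Vec.map-++ τ xs ys)

      snoc-↭ : (as : List (Fin (arcs R))) {k : ℕ} (ys : Vec (Fin (arcs R)) k) →
               toList (fromList as ++ ys) ↭ toList ys ⊕ as
      snoc-↭ as ys = ↭-trans (↭-reflexive (trans (Vec.toList-++ (fromList as) ys)
        (cong (_⊕ toList ys) (Vec.toList∘fromList as)))) (++-comm as (toList ys))

      snoc-type : ∀ {A a} (xs : Vec (Fin (arcs R)) k) → τ a ≡ A →
                  Vec.map τ xs ++ A ∷ [] ≡ Vec.map τ (xs ++ a ∷ [])
      snoc-type xs refl = snoc-types xs _

      -- The node is generalized to `x` so that `IsLeaf x a` can be analysed by pattern matching,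
      -- which the stuck term `node R v` would block; `binary-proof` follows the same pattern.
      leaf-proof : ∀ {v a x} → node R v ≡ x → IsLeaf x a → WellTyped τ x →
                   SeqProof ns cs → SeqProof (v ∷ ns) (a ∷ cs)
      leaf-proof {cs = cs} {v} {a} ev bot et s = unordered (record
        { proof   = bottom (all-types (snoc-type xs et)) (proof s₀)
        ; covers  = addNode-covers (covers s₀) v et (cong conclusions ev) (subst (Match _ _) (sym ev) (bot refl))
        ; concl-≡ = snoc-concl (am (covers s₀)) (concl (desequentialize (proof s₀))) xs
            (trans (sym (Vec.map-∘ _ suc (concl (desequentialize (proof s₀))))) (concl-≡ s₀))
        }) (snoc-type xs et) (snoc-↭ cs _)
        where
        xs = fromList cs
        s₀ = s xs (↭-reflexive (Vec.toList∘fromList cs)) refl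
      leaf-proof {cs = cs} {v} {a} ev weak (B , et) s = unordered (record
        { proof   = weakening (all-types (snoc-type xs et)) (proof s₀)
        ; covers  = addNode-covers (covers s₀) v et (cong conclusions ev) (subst (Match _ _) (sym ev) (weak refl))
        ; concl-≡ = snoc-concl (am (covers s₀)) (concl (desequentialize (proof s₀))) xs
            (trans (sym (Vec.map-∘ _ suc (concl (desequentialize (proof s₀))))) (concl-≡ s₀))
        }) (snoc-type xs et) (snoc-↭ cs _)
        where
        xs = fromList cs
        s₀ = s xs (↭-reflexive (Vec.toList∘fromList cs)) refl

      der-proof : ∀ {v p a} → node R v ≡ der p a → τ a ≡ ⁇ τ p →
                  SeqProof ns (p ∷ cs) → SeqProof (v ∷ ns) (a ∷ cs)
      der-proof {cs = cs} {v} {p} {a} ev et s = unordered (record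
        { proof   = dereliction (all-types (snoc-type xs et)) (proof s₀)
        ; covers  = addNode-covers (covers s₀) v et (cong conclusions ev)
            (subst (Match _ _) (sym ev) (der (premise-at {C = C} xs (concl-≡ s₀) zero) refl))
        ; concl-≡ = snoc-concl (am (covers s₀)) (Vec.take κ C) xs (take-concl (am (covers s₀)) C xs (concl-≡ s₀))
        }) (snoc-type xs et) (snoc-↭ cs _)
        where
        κ  = length cs
        xs = fromList cs
        s₀ = s (xs ++ p ∷ []) (snoc-↭ cs _) (snoc-types xs _)
        C  = concl (desequentialize (proof s₀))

      binary-proof : ∀ {v p q a x} → node R v ≡ x → IsBinary x p q a → WellTyped τ x →
                     SeqProof ns (p ∷ q ∷ cs) → SeqProof (v ∷ ns) (a ∷ cs)
      binary-proof {cs = cs} {v} {p} {q} ev par et s = unordered (record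
        { proof   = par (all-types (snoc-type xs et)) (proof s₀)
        ; covers  = addNode-covers (covers s₀) v et (cong conclusions ev)
            (subst (Match _ _) (sym ev) (par (premise-at {C = C} xs (concl-≡ s₀) zero)
              (premise-at {C = C} xs (concl-≡ s₀) (suc zero)) refl))
        ; concl-≡ = snoc-concl (am (covers s₀)) (Vec.take κ C) xs (take-concl (am (covers s₀)) C xs (concl-≡ s₀))
        }) (snoc-type xs et) (snoc-↭ cs _)
        where
        κ  = length cs
        xs = fromList cs
        s₀ = s (xs ++ p ∷ q ∷ []) (snoc-↭ cs _) (snoc-types xs _)
        C  = concl (desequentialize (proof s₀))
      binary-proof {cs = cs} {v} {p} {q} ev contr (B , ep , eq , et) s = unordered (record
        { proof   = contraction (all-types (snoc-type xs et)) (proof s₀)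
        ; covers  = addNode-covers (covers s₀) v et (cong conclusions ev)
            (subst (Match _ _) (sym ev) (contr (premise-at {C = C} xs (concl-≡ s₀) zero)
              (premise-at {C = C} xs (concl-≡ s₀) (suc zero)) refl))
        ; concl-≡ = snoc-concl (am (covers s₀)) (Vec.take κ C) xs (take-concl (am (covers s₀)) C xs (concl-≡ s₀))
        }) (snoc-type xs et) (snoc-↭ cs _)
        where
        κ  = length cs
        xs = fromList cs
        s₀ = s (xs ++ p ∷ q ∷ []) (snoc-↭ cs _)
               (trans (cong₂ (λ A B → Vec.map τ xs ++ A ∷ B ∷ []) (sym ep) (sym eq)) (snoc-types xs _))
        C  = concl (desequentialize (proof s₀))

      tensor-proof : ∀ {v p q a ms ds} → node R v ≡ tensor p q a → τ a ≡ τ p ⊗ τ q →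
                     SeqProof ns (p ∷ cs) → SeqProof ms (q ∷ ds) → SeqProof (v ∷ ns ⊕ ms) (a ∷ cs ⊕ ds)
      tensor-proof {cs = cs} {v} {p} {q} {a} {ms} {ds} ev et s t = unordered (record
        { proof   = tensor (all-types types) (proof s₀) (proof t₀)
        ; covers  = addNode-covers U v et (cong conclusions ev)
            (subst (Match _ _) (sym ev) (tensor
              (trans (F.lookup-++ˡ (am (covers s₀)) (am (covers t₀)) _) (premise-at {C = C} xs (concl-≡ s₀) zero))
              (trans (F.lookup-++ʳ (am (covers s₀)) (am (covers t₀)) _) (head-≡ (concl-≡ t₀)))
              refl))
        ; concl-≡ = trans (Vec.map-++ (a F.∷ am U) (Vec.map suc Γ) _) (cong₂ (λ x y → x ++ a ∷ y) Γ≡ Δ≡)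
        }) types
        (↭-trans (↭-reflexive (trans (Vec.toList-++ xs (a ∷ ys))
          (cong₂ _⊕_ (Vec.toList∘fromList cs) (cong (a ∷_) (Vec.toList∘fromList ds))))) (shift a cs ds))
        where
        κ  = length cs
        xs = fromList cs
        ys = fromList ds
        types : Vec.map τ xs ++ (τ p ⊗ τ q) ∷ Vec.map τ ys ≡ Vec.map τ (xs ++ a ∷ ys)
        types = trans (cong (λ A → Vec.map τ xs ++ A ∷ Vec.map τ ys) (sym et)) (snoc-types xs _)
        s₀ = s (xs ++ p ∷ []) (snoc-↭ cs _) (snoc-types xs _)
        t₀ = t (q ∷ ys) (↭-prep q (↭-reflexive (Vec.toList∘fromList ds))) refl
        C  = concl (desequentialize (proof s₀))
        C′ = concl (desequentialize (proof t₀))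
        open Join {κ} (desequentialize (proof s₀)) (desequentialize (proof t₀)) using (Γ; Δ; inR; inS)
        U  = union-covers {κ} (covers s₀) (covers t₀)
        head-≡ : ∀ {X Y : Set} {n} {f : X → Y} {xs : Vec X (suc n)} {y ys} → Vec.map f xs ≡ y ∷ ys → f (Vec.head xs) ≡ y
        head-≡ {xs = _ ∷ _} refl = refl
        tail-≡ : ∀ {X Y : Set} {n} {f : X → Y} {xs : Vec X (suc n)} {y ys} → Vec.map f xs ≡ y ∷ ys → Vec.map f (Vec.tail xs) ≡ ys
        tail-≡ {xs = _ ∷ _} refl = refl
        Γ≡ : Vec.map (a F.∷ am U) (Vec.map suc Γ) ≡ xs
        Γ≡ = trans (sym (Vec.map-∘ _ suc Γ)) (trans (sym (Vec.map-∘ (am U) inR (Vec.take κ C)))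
          (trans (Vec.map-cong (F.lookup-++ˡ (am (covers s₀)) (am (covers t₀))) (Vec.take κ C))
            (trans (sym (Vec.take-map (am (covers s₀)) κ C)) (trans (cong (Vec.take κ) (concl-≡ s₀)) (take-++ xs _)))))
        Δ≡ : Vec.map (a F.∷ am U) (Vec.map suc Δ) ≡ ys
        Δ≡ = trans (sym (Vec.map-∘ _ suc Δ)) (trans (sym (Vec.map-∘ (am U) inS (Vec.tail C′)))
          (trans (Vec.map-cong (F.lookup-++ʳ (am (covers s₀)) (am (covers t₀))) (Vec.tail C′))
            (tail-≡ (concl-≡ t₀))))

      ax-proof : ∀ {v a b} → node R v ≡ ax a b → τ b ≡ τ a ^⊥ → SeqProof [ v ] (a ∷ b ∷ [])
      ax-proof {v} {a} {b} ev et = unordered {D = D} (record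
        { proof   = axiom (all-types {D = D} types)
        ; covers  = singleNode-covers {D = D} v types (↭-reflexive (cong conclusions (sym ev)))
                      (subst (Match _ _) (sym ev) (ax refl refl))
        ; concl-≡ = refl
        }) types ↭-refl
        where
        D = a ∷ b ∷ []
        types : τ a ∷ τ a ^⊥ ∷ [] ≡ τ a ∷ τ b ∷ []
        types = cong (λ B → τ a ∷ B ∷ []) (sym et)

      one-proof : ∀ {v a} → node R v ≡ one a → τ a ≡ 𝟏 → SeqProof [ v ] [ a ]
      one-proof {v} {a} ev et = unordered {D = a ∷ []} (record
        { proof   = one (all-types {D = a ∷ []} types)
        ; covers  = singleNode-covers {D = a ∷ []} v types (↭-reflexive (cong conclusions (sym ev)))
                      (subst (Match _ _) (sym ev) (one refl))
        ; concl-≡ = refl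
        }) types ↭-refl
        where
        types : 𝟏 ∷ [] ≡ τ a ∷ []
        types = cong (_∷ []) (sym et)

      -- Promotion wants the principal formula last and auxiliary formulae of the literal form
      -- `⁇ C`, whereas a box lists its conclusions in the order of its content. So the proof of the
      -- content is first exchanged along `J`, which moves `i` to the end, and the new content is
      -- related to `S` by the inverse of σ.
      box-proof : ∀ {v c} {S : PreStructure c} {i as} → node R v ≡ box S i as → WellTyped τ (box S i as) →
                  S OfFragment ℱ → Sequentialized S → SeqProof [ v ] (toList as)
      box-proof {v} {suc k} {S} {i} {as} ev (e! , e?) fragS (πS , iso) = unordered {D = D} (record
        { proof   = promotion (all-types types) premise
        ; covers  = singleNode-covers v types (↭-trans D↭ (↭-reflexive (cong conclusions (sym ev))))
            (subst (Match _ _) (sym ev) (box (Perm.flip σ) iso′ principal conclusions-≡))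
        ; concl-≡ = Vec.map-lookup-allFin D
        }) types D↭
        where
        σS : Fin (suc k) → Formula
        σS j = type S (lookup (concl S) j)
        J : Vec (Fin (suc k)) (k + 1)
        J = Vec.map (punchIn i) (Vec.allFin k) ++ i ∷ []
        σ,eσ : ∃ λ (σ : Permutation (k + 1) (suc k)) → ∀ x → lookup J x ≡ σ ⟨$⟩ʳ x
        σ,eσ = ↭-permute {g = id} (subst (_↭ allFin (suc k)) (trans (sym listJ) (toList-tabulate J)) J↭)
          where
          listJ : toList J ≡ List.map (punchIn i) (allFin k) ⊕ [ i ]
          listJ = trans (Vec.toList-++ (Vec.map (punchIn i) (Vec.allFin k)) _) (cong (_⊕ [ i ])
            (trans (Vec.toList-map (punchIn i) (Vec.allFin k)) (cong (List.map (punchIn i))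
              (trans (toList-tabulate (Vec.allFin k)) (List.tabulate-cong Vec.lookup-allFin)))))
          J↭ : List.map (punchIn i) (allFin k) ⊕ [ i ] ↭ allFin (suc k)
          J↭ = unique-↭
            (Unique.++⁺ (Unique.map⁺ (Fin.punchIn-injective i _ _) (allFin⁺ k)) ([] ∷ []) λ where
              (x∈ , here refl) → case ∈-map⁻ (punchIn i) x∈ of λ (j , _ , e) → punchInᵢ≢i i j (sym e))
            (allFin⁺ _) (λ _ → ∈-allFin _) λ {x} _ → all x
            where
            all : ∀ x → x ∈ List.map (punchIn i) (allFin k) ⊕ [ i ]
            all x with i Fin.≟ x
            ... | yes e = ∈-++⁺ʳ (List.map (punchIn i) (allFin k)) (here (sym e))
            ... | no i≢x = ∈-++⁺ˡ (subst (_∈ List.map (punchIn i) (allFin k)) (punchIn-punchOut i≢x)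
                             (∈-map⁺ (punchIn i) (∈-allFin (punchOut i≢x))))
        σ : Permutation (k + 1) (suc k)
        σ = proj₁ σ,eσ
        eσ : ∀ x → lookup J x ≡ σ ⟨$⟩ʳ x
        eσ = proj₂ σ,eσ
        Γ? : Vec Formula k
        Γ? = Vec.map (λ j → proj₁ (e? (punchIn i j) (punchInᵢ≢i i j))) (Vec.allFin k)
        D : Vec (Fin (arcs R)) (k + 1)
        D = Vec.map (lookup as) J
        D↭ : toList D ↭ toList as
        D↭ = subst₂ _↭_ (sym (toList-tabulate D)) (sym (toList-tabulate as))
          (permute-↭ {g = lookup as} σ λ x → trans (Vec.lookup-map x (lookup as) J) (cong (lookup as) (eσ x)))
        -- Serves both for the conclusions of the box and for those of its content, which agree at
        -- the auxiliary positions and differ at `i` by a `!`.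
        along-J : ∀ {A} (f : Fin (suc k) → Formula) → f i ≡ A →
                  (∀ j → f (punchIn i j) ≡ ⁇ proj₁ (e? (punchIn i j) (punchInᵢ≢i i j))) →
                  Vec.map ⁇_ Γ? ++ A ∷ [] ≡ Vec.map f J
        along-J f refl eqs = sym (trans (Vec.map-++ f (Vec.map (punchIn i) (Vec.allFin k)) _) (cong (_++ f i ∷ [])
          (trans (sym (Vec.map-∘ f (punchIn i) (Vec.allFin k)))
            (trans (Vec.map-cong eqs (Vec.allFin k)) (Vec.map-∘ ⁇_ _ (Vec.allFin k))))))
        types : Vec.map ⁇_ Γ? ++ (! σS i) ∷ [] ≡ Vec.map τ D
        types = trans (along-J (τ ∘ lookup as) e! λ j → proj₁ (proj₂ (e? _ (punchInᵢ≢i i j))))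
                  (Vec.map-∘ τ (lookup as) J)
        typesS : Vec.map ⁇_ Γ? ++ σS i ∷ [] ≡ Vec.map σS J
        typesS = along-J σS refl λ j → proj₂ (proj₂ (e? _ (punchInᵢ≢i i j)))
        all-σS : ∀ {l} (xs : Vec (Fin (suc k)) l) → AllV ℱ (Vec.map σS xs)
        all-σS []       = []
        all-σS (x ∷ xs) = _OfFragment_.types fragS _ ∷ all-σS xs
        premise : Proof ℱ (Vec.map ⁇_ Γ? ++ σS i ∷ [])
        premise = exchange (subst (AllV ℱ) (sym typesS) (all-σS J)) σ
          (λ x → trans (cong (λ Δ → lookup Δ x) typesS) (trans (Vec.lookup-map x σS J)
            (trans (cong σS (eσ x)) (sym (Vec.lookup-map (σ ⟨$⟩ʳ x) (type S) (concl S)))))) πS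
        iso′ : Iso (Perm.flip σ) S (desequentialize premise)
        iso′ = record
          { nodeBij = Iso.nodeBij iso
          ; arcBij  = Iso.arcBij iso
          ; type-≡  = Iso.type-≡ iso
          ; node-≈  = Iso.node-≈ iso
          ; concl-≡ = λ j → trans (Vec.lookup∘tabulate _ (σ ⟨$⟩ˡ j))
              (trans (cong (lookup (concl (desequentialize πS))) (inverseʳ σ)) (Iso.concl-≡ iso j))
          }
        principal : σ ⟨$⟩ˡ i ≡ k ↑ʳ zero
        principal = trans (cong (σ ⟨$⟩ˡ_) (trans (sym (Vec.lookup-++ʳ (Vec.map (punchIn i) (Vec.allFin k)) (i ∷ []) zero)) (eσ _)))
                          (inverseˡ σ)
        conclusions-≡ : ∀ j → lookup as j ≡ lookup D (lookup (Vec.allFin (k + 1)) (σ ⟨$⟩ˡ j))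
        conclusions-≡ j = sym (trans (cong (lookup D) (Vec.lookup-allFin _))
          (trans (Vec.lookup-map _ (lookup as) J) (cong (lookup as) (trans (eσ _) (inverseʳ σ)))))

      init-proof : ∀ v → IsInitial (node R v) → SeqProof [ v ] (conc v)
      init-proof v i with node R v in eq | i | IsProofStructure.well-typed ps v | boxes v
                        | _OfFragment_.contents frag v
      ... | ax a b     | ax  | et | _ | _ = ax-proof eq et
      ... | one a      | one | et | _ | _ = one-proof eq et
      ... | box S j as | box | et | s | f = box-proof eq et f s

      seq⇒proof : Seq R ns cs → SeqProof ns cs
      seq⇒proof (init {v} i) = init-proof v i
      seq⇒proof (leaf {v} l s) = leaf-proof refl l (IsProofStructure.well-typed ps v) (seq⇒proof s)
      seq⇒proof (der {v} e s) =
        der-proof e (subst (WellTyped τ) e (IsProofStructure.well-typed ps v)) (seq⇒proof s)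
      seq⇒proof (binary {v} b s) = binary-proof refl b (IsProofStructure.well-typed ps v) (seq⇒proof s)
      seq⇒proof (tensor {v} e s t) =
        tensor-proof e (subst (WellTyped τ) e (IsProofStructure.well-typed ps v)) (seq⇒proof s) (seq⇒proof t)
      seq⇒proof (resp p q s) D D↭ eΔ with s₀ ← seq⇒proof s D (↭-trans D↭ (↭-sym q)) eΔ = record
        { proof   = proof s₀
        ; covers  = record
          { nm      = nm (covers s₀)
          ; am      = am (covers s₀)
          ; embed   = embed (covers s₀)
          ; types-≡ = types-≡ (covers s₀)
          ; nodes-↭ = ↭-trans (nodes-↭ (covers s₀)) p
          ; arcs-↭  = ↭-trans (arcs-↭ (covers s₀)) (concatMap-↭ conc p)
          }
        ; concl-≡ = concl-≡ s₀
        }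

      sequentialized : CutFree R → Seq R V cs → Sequentialized R
      sequentialized {cs} cf s = proof s₀ , iso
        where
        -- Together with the premises of all nodes, either list enumerates every arc once; the
        -- premises cancel.
        cs↭ : toList (concl R) ↭ cs
        cs↭ = ++-cancelˡ-↭ (concatMap prem V) (↭-trans (++-comm (concatMap prem V) _) (↭-trans
          (↭-trans arcs-by-head (↭-trans (↭-sym arcs-by-tail) (Bordered.border-↭ (seq-border s))))
          (++-comm cs _)))
        s₀ : Sequenced V (concl R) (Vec.map τ (concl R))
        s₀ = seq⇒proof s (concl R) cs↭ refl
        T = desequentialize (proof s₀)
        σN,eN = ↭-permute {f = nm (covers s₀)} {g = id} (nodes-↭ (covers s₀))
        σA,eA = ↭-permute {f = am (covers s₀)} {g = id} (↭-trans (arcs-↭ (covers s₀)) arcs-by-tail)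
        σN = proj₁ σN,eN
        σA = proj₁ σA,eA
        iso : R ≅ T
        iso = record
          { nodeBij = Perm.flip σN
          ; arcBij  = Perm.flip σA
          ; type-≡  = λ a → trans (sym (types-≡ (covers s₀) _)) (cong τ (trans (proj₂ σA,eA _) (inverseʳ σA)))
          ; node-≈  = λ v → match⇒≈ (σA ⟨$⟩ˡ_) (am (covers s₀))
              (λ a → trans (cong (σA ⟨$⟩ˡ_) (proj₂ σA,eA a)) (inverseˡ σA))
              (CutFree.no-cut cf v)
              (subst (λ u → Match (am (covers s₀)) (node T (σN ⟨$⟩ˡ v)) (node R u))
                (trans (proj₂ σN,eN _) (inverseʳ σN)) (matches (embed (covers s₀)) (σN ⟨$⟩ˡ v)))
          ; concl-≡ = λ i → trans (sym (inverseˡ σA)) (cong (σA ⟨$⟩ˡ_) (trans (sym (proj₂ σA,eA _))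
              (trans (sym (Vec.lookup-map i (am (covers s₀)) (concl T))) (cong (λ D → lookup D i) (concl-≡ s₀)))))
          }

-- What the fragment says about types

module Kinds (𝒜 : Atoms) where
  open MELL 𝒜

  -- `⅋` is the only connective common to the two grammars, and each of its productions of kind A
  -- has an immediate subformula of kind A, where kind E demands kind E.
  kinds-disjoint : ∀ {A} → KindA A → ¬ KindE A
  kinds-disjoint (a ⅋ b)  (e ⅋ f) = kinds-disjoint a e
  kinds-disjoint (a ⅋ʳ b) (e ⅋ f) = kinds-disjoint a e
  kinds-disjoint (a ⅋ˡ b) (e ⅋ f) = kinds-disjoint b f

  ⊗-kinds : ∀ {A B} → ¬?⊗LL (A ⊗ B) → KindA A × KindA B
  ⊗-kinds (inj₁ (a ⊗ b)) = a , b

  ⁇-kind : ∀ {A} → ¬?⊗LL (⁇ A) → KindE (⁇ A)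
  ⁇-kind (inj₂ e) = e

-- Trees topped by ⊥ and ?w nodes only

module Parsing (𝒜 : Atoms) where
  open MELL 𝒜
  open Nodes 𝒜
  open Sequents 𝒜
  open Kinds 𝒜

  data View {m} (x : Node m) : Set where
    initial : IsInitial x → View x
    leaf    : ∀ {a} → IsLeaf x a → View x
    der     : ∀ {p a} → x ≡ der p a → View x
    binary  : ∀ {p q a} → IsBinary x p q a → View x
    tensor  : ∀ {p q a} → x ≡ tensor p q a → View x

  view : ∀ {m} (x : Node m) → (∀ p q → x ≢ cut p q) → View x
  view (ax a b)       nc = initial ax
  view (cut p q)      nc = contradiction refl (nc p q)
  view (one a)        nc = initial one
  view (bot a)        nc = leaf bot
  view (tensor p q a) nc = tensor refl
  view (par p q a)    nc = binary par
  view (weak a)       nc = leaf weak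
  view (contr p q a)  nc = binary contr
  view (der p a)      nc = der refl
  view (box S i as)   nc = initial box

  isInitial? : ∀ {m} (x : Node m) → Dec (IsInitial x)
  isInitial? (ax a b)       = yes ax
  isInitial? (cut p q)      = no λ ()
  isInitial? (one a)        = yes one
  isInitial? (bot a)        = no λ ()
  isInitial? (tensor p q a) = no λ ()
  isInitial? (par p q a)    = no λ ()
  isInitial? (weak a)       = no λ ()
  isInitial? (contr p q a)  = no λ ()
  isInitial? (der p a)      = no λ ()
  isInitial? (box S i as)   = yes box

  -- If P p means that only ⊥ and ?w nodes lie at the top above p, then Below P x
  -- says the same of the conclusion of x.
  Below : ∀ {m} → (Fin m → Set) → Node m → Set
  Below P (bot a)       = ⊤
  Below P (weak a)      = ⊤
  Below P (par p q a)   = P p × P q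
  Below P (contr p q a) = P p × P q
  Below P (der p a)     = P p
  Below P _             = Empty

  below? : ∀ {m} {P : Fin m → Set} → (∀ a → Dec (P a)) → (x : Node m) → Dec (Below P x)
  below? P? (ax a b)       = no id
  below? P? (cut p q)      = no id
  below? P? (one a)        = no id
  below? P? (bot a)        = yes tt
  below? P? (tensor p q a) = no id
  below? P? (par p q a)    = P? p ×-dec P? q
  below? P? (weak a)       = yes tt
  below? P? (contr p q a)  = P? p ×-dec P? q
  below? P? (der p a)      = P? p
  below? P? (box S i as)   = no id

  below-leaf : ∀ {m} {P : Fin m → Set} {x a} → IsLeaf x a → Below P x
  below-leaf bot  = tt
  below-leaf weak = tt

  below-binary : ∀ {m} {P : Fin m → Set} {x p q a} → IsBinary x p q a → P p → P q → Below P x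
  below-binary par   i j = i , j
  below-binary contr i j = i , j

  data BelowView {m} (P : Fin m → Set) (x : Node m) : Set where
    leaf   : ∀ {a} → IsLeaf x a → BelowView P x
    der    : ∀ {p a} → x ≡ der p a → P p → BelowView P x
    binary : ∀ {p q a} → IsBinary x p q a → P p → P q → BelowView P x

  below-view : ∀ {m} {P : Fin m → Set} (x : Node m) → Below P x → BelowView P x
  below-view (bot a)       _       = leaf bot
  below-view (weak a)      _       = leaf weak
  below-view (par p q a)   (i , j) = binary par i j
  below-view (contr p q a) (i , j) = binary contr i j
  below-view (der p a)     i       = der refl i

  module Trees {c : ℕ} (R : PreStructure c) (ps : IsProofStructure R)
               (frag : R OfFragment ¬?⊗LL) where
    open Ground R (IsProofStructure.well-formed ps)
    open Borders R (IsProofStructure.well-formed ps)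
    open DecMembership (Fin._≟_ {nodes R}) using (_∈?_)

    private
      wt : ∀ v → WellTyped (type R) (node R v)
      wt = IsProofStructure.well-typed ps

    record TreeItem : Set where
      constructor tree-item
      field
        {items} : List (Fin (nodes R))
        {root}  : Fin (arcs R)
        tree    : Tree R items root

    open TreeItem public

    treeNodes : List TreeItem → List (Fin (nodes R))
    treeNodes = concatMap items

    leaf-kind : ∀ {x a} → IsLeaf x a → WellTyped (type R) x → KindE (type R a)
    leaf-kind bot e        = subst KindE (sym e) ⊥
    leaf-kind {a = a} weak (B , e) = subst KindE (sym e) (⁇-kind (subst ¬?⊗LL e (_OfFragment_.types frag a)))

    binary-kind : ∀ {x p q a} → IsBinary x p q a → WellTyped (type R) x →
                  KindE (type R p) → KindE (type R q) → KindE (type R a)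
    binary-kind par   e                      ep eq = subst KindE (sym e) (ep ⅋ eq)
    binary-kind contr (B , tp , _ , ta) ep eq = subst KindE (trans tp (sym ta)) ep

    -- `⊥` and all `⁇` formulae of the fragment have kind E, which `⅋` preserves; a ?c node repeats
    -- the type of its premises.
    tree-kind : ∀ {ns a} → Tree R ns a → KindE (type R a)
    tree-kind (leaf {v} l)             = leaf-kind l (wt v)
    tree-kind {a = a} (der {v} e t)    =
      subst KindE (sym ta) (⁇-kind (subst ¬?⊗LL ta (_OfFragment_.types frag a)))
      where ta = subst (WellTyped (type R)) e (wt v)
    tree-kind (binary {v} b t u)       = binary-kind b (wt v) (tree-kind t) (tree-kind u)

    Derived : Fin (nodes R) → Set
    Derived v = joins (node R v) ≡ 0 × initials (node R v) ≡ 0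

    leaf-derived : ∀ {v a} → IsLeaf (node R v) a → Derived v
    leaf-derived {v} l with node R v | l
    ... | _ | bot  = refl , refl
    ... | _ | weak = refl , refl

    binary-derived : ∀ {v p q a} → IsBinary (node R v) p q a → Derived v
    binary-derived {v} b with node R v | b
    ... | _ | par   = refl , refl
    ... | _ | contr = refl , refl

    tree-derived : ∀ {ns a v} → Tree R ns a → v ∈ ns → Derived v
    tree-derived (leaf l)       (here refl) = leaf-derived l
    tree-derived (der e t)      (here refl) = cong joins e , cong (λ x → initials x) e
    tree-derived (der e t)      (there i)   = tree-derived t i
    tree-derived (binary b t u) (here refl) = binary-derived b
    tree-derived (binary {ns = ns} b t u) (there i) with ∈-++⁻ ns i
    ... | inj₁ j = tree-derived t j
    ... | inj₂ j = tree-derived u j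

    items-derived : ∀ ts {v} → v ∈ treeNodes ts → Derived v
    items-derived ts i with t , _ , j ← concatMap-∈ items ts i = tree-derived (tree t) j

    -- An arc has a single head. As the head of `p` lies outside `ns`, `p` is not a premise within
    -- `ns` and must be an output.
    border-premise : ∀ {ns cs v p} → Bordered ns cs → v ∉ ns → p ∈ prem v → tail p ∈ ns → p ∈ cs
    border-premise B v∉ p∈ t∈ with tail-border B t∈
    ... | inj₁ i            = i
    ... | inj₂ (u , u∈ , j) = contradiction (subst (_∈ _) (prem-disjoint j p∈) u∈) v∉

    -- An arc leading from a tree to a node outside it is the root of the tree, hence of kind E,
    -- whereas both premises of ⊗ have kind A.
    tensor-premise : ∀ ts {v p q a r} → node R v ≡ tensor p q a → r ∈ prem v → tail r ∉ treeNodes ts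
    tensor-premise ts {v} {p} {q} {a} {r} e r∈ i with t , t∈ , j ← concatMap-∈ items ts i =
      kinds-disjoint kind (subst (KindE ∘ type R) (sym root≡) (tree-kind (tree t)))
      where
      v∉ : v ∉ items t
      v∉ k = case trans (sym (proj₁ (tree-derived (tree t) k))) (cong joins e) of λ ()
      root≡ : r ≡ root t
      root≡ with here eq ← border-premise (tree-border (tree t)) v∉ r∈ j = eq
      pq : KindA (type R p) × KindA (type R q)
      pq = ⊗-kinds (subst ¬?⊗LL (subst (WellTyped (type R)) e (wt v)) (_OfFragment_.types frag a))
      kind : KindA (type R r)
      kind with subst (λ x → r ∈ premises x) e r∈
      ... | here refl         = proj₁ pq
      ... | there (here refl) = proj₂ pq

    -- Maximality of the family of trees: a node of `rest` is neither a leaf nor a der, ⅋ or ?c node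
    -- fed by trees alone.
    record Saturated : Set where
      field
        trees     : List TreeItem
        rest      : List (Fin (nodes R))
        split     : treeNodes trees ⊕ rest ↭ V
        saturated : ∀ {v} → v ∈ rest → ¬ Below (λ p → tail p ∈ treeNodes trees) (node R v)

    private
      grow : ∀ ts {v rest} → treeNodes ts ⊕ v ∷ rest ↭ V →
             Below (λ p → tail p ∈ treeNodes ts) (node R v) →
             ∃ λ ts′ → treeNodes ts′ ⊕ rest ↭ V
      grow ts {v} {rest} split b = go (below-view (node R v) b)
        where
        open ↭Solver using (solve; _⊜_) renaming (_⊕_ to _⊙_)
        T = treeNodes ts
        v∉T : v ∉ T
        v∉T i = Unique-++-disjoint T (Unique-resp-↭ (↭-sym split) (allFin⁺ _)) i (here refl)
        locate : ∀ {p} → p ∈ prem v → tail p ∈ T → ∃ λ t → t ∈ ts × p ≡ root t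
        locate p∈ i with t , t∈ , j ← concatMap-∈ items ts i
          with here eq ← border-premise (tree-border (tree t)) (v∉T ∘ ∈-concatMap {f = items} t∈) p∈ j = t , t∈ , eq
        go : BelowView (λ p → tail p ∈ T) (node R v) → ∃ λ ts′ → treeNodes ts′ ⊕ rest ↭ V
        go (leaf l) = tree-item (leaf l) ∷ ts , ↭-trans (↭-sym (shift v T rest)) split
        go (der e i) with t , t∈ , refl ← locate (subst (λ x → _ ∈ premises x) (sym e) (here refl)) i
          with ts′ , p ← ∈⇒↭∷ t∈ = tree-item (der e (tree t)) ∷ ts′ ,
            ↭-trans (↭-sym (shift v (items t ⊕ treeNodes ts′) rest))
              (↭-trans (++⁺ʳ (v ∷ rest) (↭-sym (concatMap-↭ items p))) split)
        go (binary {p} {q} b i j)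
          with t , t∈ , refl ← locate (subst (p ∈_) (sym (binary-prem b)) (here refl)) i
             | u , u∈ , refl ← locate (subst (q ∈_) (sym (binary-prem b)) (there (here refl))) j
          -- The premises of a node are distinct arcs, so `t` and `u` have different roots and can
          -- both be taken out of the list.
          with ts′ , r ← ∈∈⇒↭∷∷ t∈ u∈ (λ { refl → case subst Unique (binary-prem b) (prem-unique v) of λ { ((n ∷ []) ∷ _) → n refl } })
          = tree-item (binary b (tree t) (tree u)) ∷ ts′ ,
            ↭-trans (↭-trans (↭-sym (shift v ((items t ⊕ items u) ⊕ treeNodes ts′) rest))
              (++⁺ʳ (v ∷ rest) (↭-reflexive (List.++-assoc (items t) (items u) (treeNodes ts′)))))
              (↭-trans (++⁺ʳ (v ∷ rest) (↭-sym (concatMap-↭ items r))) split)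

      saturate : ∀ n ts rest → length rest ≡ n → treeNodes ts ⊕ rest ↭ V → Saturated
      saturate n ts rest len split with any? (λ v → below? (λ p → tail p ∈? treeNodes ts) (node R v)) rest
      ... | no none = record
        { trees = ts ; rest = rest ; split = split ; saturated = λ v∈ b → none (lose v∈ b) }
      saturate zero ts [] len split | yes ()
      saturate (suc n) ts rest len split | yes some
        with v , v∈ , b ← find some
        with rest′ , p ← ∈⇒↭∷ v∈
        with ts′ , split′ ← grow ts (↭-trans (++⁺ˡ (treeNodes ts) (↭-sym p)) split) b
        = saturate n ts′ rest′ (suc-injective (trans (sym (↭-length p)) len)) split′

    saturation : Saturated
    saturation = saturate (length V) [] V refl ↭-refl

-- A switching that isolates a cluster

module Colouring (𝒜 : Atoms) where
  open MELL 𝒜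
  open Nodes 𝒜
  open Sequents 𝒜
  open Parsing 𝒜

  -- P p: p leaves a given cluster; Q p: only ⊥ and ?w nodes lie at the top above p.
  -- Then x can be added to the cluster, or is a ⊗ node below it.
  Touch : ∀ {m} → (P Q : Fin m → Set) → Node m → Set
  Touch P Q (tensor p q a) = P p ⊎ P q
  Touch P Q (par p q a)    = (P p ⊎ Q p) × (P q ⊎ Q q)
  Touch P Q (contr p q a)  = (P p ⊎ Q p) × (P q ⊎ Q q)
  Touch P Q (der p a)      = P p
  Touch P Q _              = Empty

  touch? : ∀ {m} {P Q : Fin m → Set} → (∀ a → Dec (P a)) → (∀ a → Dec (Q a)) →
           (x : Node m) → Dec (Touch P Q x)
  touch? P? Q? (ax a b)       = no id
  touch? P? Q? (cut p q)      = no id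
  touch? P? Q? (one a)        = no id
  touch? P? Q? (bot a)        = no id
  touch? P? Q? (tensor p q a) = P? p ⊎-dec P? q
  touch? P? Q? (par p q a)    = (P? p ⊎-dec Q? p) ×-dec (P? q ⊎-dec Q? q)
  touch? P? Q? (weak a)       = no id
  touch? P? Q? (contr p q a)  = (P? p ⊎-dec Q? p) ×-dec (P? q ⊎-dec Q? q)
  touch? P? Q? (der p a)      = P? p
  touch? P? Q? (box S i as)   = no id

  touch-binary : ∀ {m} {P Q : Fin m → Set} {x p q a} → IsBinary x p q a →
                 P p ⊎ Q p → P q ⊎ Q q → Touch P Q x
  touch-binary par   i j = i , j
  touch-binary contr i j = i , j

  binary-touch : ∀ {m} {P Q : Fin m → Set} {x p q a} → IsBinary x p q a →
                 Touch P Q x → (P p ⊎ Q p) × (P q ⊎ Q q)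
  binary-touch par   t = t
  binary-touch contr t = t

  choose : {X : Set} → Side → X → X → X
  choose left  p q = p
  choose right p q = q

  module _ {c : ℕ} (R : PreStructure c) (ps : IsProofStructure R) (cf : CutFree R) where
    open Ground R (IsProofStructure.well-formed ps)
    open DecMembership (Fin._≟_ {nodes R}) using (_∈?_)

    _⊏_ : Fin (nodes R) → Fin (nodes R) → Set
    _⊏_ = TransClosure λ u v → ∃ λ a → a ∈ conc u × a ∈ prem v

    ⊏-wellFounded : WellFounded _⊏_
    ⊏-wellFounded = spo-wellFounded {_⊏_ = _⊏_} record
      { isEquivalence = isEquivalence
      ; irrefl        = λ { {u} refl c → IsProofStructure.acyclic ps (internal u) (lift c) }
      ; trans         = Plus._++_
      ; <-resp-≈      = (λ { refl r → r }) , (λ { refl r → r })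
      }
      where
      lift : ∀ {u v} → u ⊏ v → TransClosure (λ u w → ∃ λ a → _─[_]→_ (ground R) u a w) (internal u) (internal v)
      lift Plus.[ e ]    = Plus.[ e ]
      lift (e Plus.∷ es) = e Plus.∷ lift es

    above : ∀ {v p} → p ∈ prem v → tail p ⊏ v
    above {p = p} i = Plus.[ p , tail∈ p , i ]

    -- `ns` stands for the nodes of a cluster and `N` for those of all trees; the two may overlap,
    -- since trees get grafted into clusters. `isolated` says that no node outside both can absorb
    -- the cluster or is a ⊗ node fed by it.
    module _ (ns N : List (Fin (nodes R)))
             (closed : ∀ {v p} → v ∈ ns → p ∈ prem v → tail p ∈ ns)
             (saturated : ∀ {v} → v ∉ N → ¬ Below (λ p → tail p ∈ N) (node R v))
             (tensor-premise : ∀ {v p q a r} → node R v ≡ tensor p q a → r ∈ prem v → tail r ∉ N)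
             (tensor∉N : ∀ {v p q a} → node R v ≡ tensor p q a → v ∉ N)
             (isolated : ∀ {v} → v ∉ ns → v ∉ N → ¬ Touch (λ p → tail p ∈ ns) (λ p → tail p ∈ N) (node R v))
             where

      private
        -- What gets detached, in order of priority: a premise coming from a tree, then one coming
        -- from `ns`. If neither tail is in `N` and that of `p` is not in `ns`, detaching `q` is
        -- right wherever `q` comes from.
        side : Fin (arcs R) → Fin (arcs R) → Side
        side p q with tail p ∈? N | tail q ∈? N | tail p ∈? ns
        ... | yes _ | _     | _     = right
        ... | no _  | yes _ | _     = left
        ... | no _  | no _  | yes _ = right
        ... | no _  | no _  | no _  = left

        switch : ∀ (x : Node (arcs R)) → IsSwitch x → Side
        switch (par p q a)   _ = side p q
        switch (contr p q a) _ = side p q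

        φ : Switching R
        φ v s = switch (node R v) s

        pick : Fin (arcs R) → Fin (arcs R) → Fin (arcs R)
        pick p q = choose (side p q) p q

        Inside : Fin (arcs R) → Fin (nodes R) → Set
        Inside k v = (v ∈ ns → tail k ∈ ns) × (v ∉ ns → tail k ∉ ns)

        -- By the choice of side, the arc kept at v enters or leaves ns only if v is in N.
        pick-outside : ∀ {v p q a} → IsBinary (node R v) p q a → v ∉ N →
                       tail (pick p q) ∉ N × Inside (pick p q) v
        pick-outside {v} {p} {q} b v∉N
          with tail p ∈? N | tail q ∈? N | tail p ∈? ns
        ... | yes p∈N | _       | _       = (λ q∈N → saturated v∉N (below-binary b p∈N q∈N)) ,
          (λ v∈ → closed v∈ q∈) , λ v∉ q∈ns → isolated v∉ v∉N (touch-binary b (inj₂ p∈N) (inj₁ q∈ns))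
          where q∈ = subst (q ∈_) (sym (binary-prem b)) (there (here refl))
        ... | no  p∉N | yes q∈N | _       = p∉N ,
          (λ v∈ → closed v∈ p∈) , λ v∉ p∈ns → isolated v∉ v∉N (touch-binary b (inj₁ p∈ns) (inj₂ q∈N))
          where p∈ = subst (p ∈_) (sym (binary-prem b)) (here refl)
        ... | no  p∉N | no q∉N  | yes p∈ns = q∉N ,
          (λ v∈ → closed v∈ q∈) , λ v∉ q∈ns → isolated v∉ v∉N (touch-binary b (inj₁ p∈ns) (inj₁ q∈ns))
          where q∈ = subst (q ∈_) (sym (binary-prem b)) (there (here refl))
        ... | no  p∉N | no q∉N  | no p∉ns = p∉N ,
          (λ v∈ → closed v∈ p∈) , λ _ → p∉ns
          where p∈ = subst (p ∈_) (sym (binary-prem b)) (here refl)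

        -- A ⊗ node keeps both premises and offers no canonical one, so a climb stops there just as
        -- at initial and leaf nodes.
        data Next {m} (pick : Fin m → Fin m → Fin m) : Node m → Fin m → Set where
          der    : ∀ {p a} → Next pick (der p a) p
          binary : ∀ {x p q a} → IsBinary x p q a → Next pick x (pick p q)

        next? : ∀ {m} (pick : Fin m → Fin m → Fin m) (x : Node m) → Dec (∃ (Next pick x))
        next? pick (ax a b)       = no λ { (_ , binary ()) }
        next? pick (cut p q)      = no λ { (_ , binary ()) }
        next? pick (one a)        = no λ { (_ , binary ()) }
        next? pick (bot a)        = no λ { (_ , binary ()) }
        next? pick (tensor p q a) = no λ { (_ , binary ()) }
        next? pick (par p q a)    = yes (_ , binary par)
        next? pick (weak a)       = no λ { (_ , binary ()) }
        next? pick (contr p q a)  = yes (_ , binary contr)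
        next? pick (der p a)      = yes (_ , der)
        next? pick (box S i as)   = no λ { (_ , binary ()) }

        next-unique : ∀ {m} {pick : Fin m → Fin m → Fin m} {x k l} → Next pick x k → Next pick x l → k ≡ l
        next-unique der            der            = refl
        next-unique (binary par)   (binary par)   = refl
        next-unique (binary contr) (binary contr) = refl

        choose-∈ : ∀ {p q : Fin (arcs R)} s → choose s p q ∈ p ∷ q ∷ []
        choose-∈ left  = here refl
        choose-∈ right = there (here refl)

        next-premise : ∀ {x k} → Next pick x k → k ∈ premises x
        next-premise der = here refl
        next-premise (binary {p = p} {q} b) = subst (pick p q ∈_) (sym (binary-prem b)) (choose-∈ (side p q))

        Colour : Set
        Colour = Fin (nodes R) ⊎ Bool

        -- Every ⊥ or ?w node is a colour of its own, while the other sources are distinguished only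
        -- by membership in `ns`: this makes the `♯w + 2` colours to be separated.
        source-colour : Fin (nodes R) → Colour
        source-colour v = if isWeakening (node R v) then inj₁ v else inj₂ (Dec.does (v ∈? ns))

        -- The colour of v is that of the source reached from v by climbing along
        -- kept premises.
        data Coloured (v : Fin (nodes R)) : Colour → Set where
          source : ¬ ∃ (Next pick (node R v)) → Coloured v (source-colour v)
          climb  : ∀ {k col} → Next pick (node R v) k → Coloured (tail k) col → Coloured v col

        coloured-unique : ∀ {v k l} → Coloured v k → Coloured v l → k ≡ l
        coloured-unique (source _)  (source _)  = refl
        coloured-unique (source n)  (climb s _) = contradiction (_ , s) n
        coloured-unique (climb s _) (source n)  = contradiction (_ , s) n
        coloured-unique (climb s r) (climb s′ r′) with refl ← next-unique s s′ = coloured-unique r r′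

        coloured : ∀ v → Acc _⊏_ v → ∃ (Coloured v)
        coloured v (acc rs) with next? pick (node R v)
        ... | no none = _ , source none
        ... | yes (k , s) with col , r ← coloured (tail k) (rs (above {v} (next-premise s))) = col , climb s r

        colour : Fin (nodes R) → Colour
        colour v = proj₁ (coloured v (⊏-wellFounded v))

        colour-is : ∀ {v col} → Coloured v col → colour v ≡ col
        colour-is r = coloured-unique (proj₂ (coloured _ (⊏-wellFounded _))) r

        colour-next : ∀ {v k} → Next pick (node R v) k → colour v ≡ colour (tail k)
        colour-next {v} {k} s = colour-is (climb s (proj₂ (coloured (tail k) (⊏-wellFounded _))))

        side-colour : Fin (nodes R) → Colour
        side-colour v = inj₂ (Dec.does (v ∈? ns))

        same-side : ∀ {k v} → Inside k v → side-colour (tail k) ≡ side-colour v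
        same-side {k} {v} (f , g) with v ∈? ns | tail k ∈? ns
        ... | yes v∈ | no k∉  = contradiction (f v∈) k∉
        ... | yes _  | yes _  = refl
        ... | no v∉  | yes k∈ = contradiction k∈ (g v∉)
        ... | no _   | no _   = refl

        -- ⊥ and ?w nodes satisfy `Below` outright, so by saturation none of them is outside `N`.
        source-outside : ∀ {v} → v ∉ N → source-colour v ≡ side-colour v
        source-outside {v} v∉N with node R v | saturated v∉N
        ... | ax _ _       | _ = refl
        ... | cut _ _      | _ = refl
        ... | one _        | _ = refl
        ... | bot _        | b = contradiction tt b
        ... | tensor _ _ _ | _ = refl
        ... | par _ _ _    | _ = refl
        ... | weak _       | b = contradiction tt b
        ... | contr _ _ _  | _ = refl
        ... | der _ _      | _ = refl
        ... | box _ _ _    | _ = refl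

        -- A climb that starts outside `N` never enters a tree and never crosses the boundary of
        -- `ns`, so its final colour can be read off at its start.
        next-outside : ∀ {v k} → Next pick (node R v) k → v ∉ N → tail k ∉ N × Inside k v
        next-outside {v} {k} s v∉N = go (node R v) refl s
          where
          go : ∀ x → node R v ≡ x → Next pick x k → tail k ∉ N × Inside k v
          go _ e der = (λ k∈N → saturated v∉N (subst (Below _) (sym e) k∈N)) ,
            (λ v∈ → closed v∈ (subst (λ x → _ ∈ premises x) (sym e) (here refl))) ,
            λ v∉ k∈ → isolated v∉ v∉N (subst (Touch _ _) (sym e) k∈)
          go _ refl (binary b) = pick-outside b v∉N

        coloured-outside : ∀ {v col} → Coloured v col → v ∉ N → col ≡ side-colour v
        coloured-outside (source _)  v∉N = source-outside v∉N
        coloured-outside (climb s r) v∉N with k∉N , i ← next-outside s v∉N =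
          trans (coloured-outside r k∉N) (same-side i)

        colour-outside : ∀ {v} → v ∉ N → colour v ≡ side-colour v
        colour-outside v∉N = coloured-outside (proj₂ (coloured _ (⊏-wellFounded _))) v∉N

        keeps-pick : ∀ {x p q a b} → IsBinary x p q b → a ∈ switchedPremises x (switch x) → a ≡ pick p q
        keeps-pick {p = p} {q} par   (here e) with side p q
        ... | left  = e
        ... | right = e
        keeps-pick {p = p} {q} contr (here e) with side p q
        ... | left  = e
        ... | right = e

        -- At der, ⅋ and ?c nodes this is how colours propagate. A ⊗ node and the tails of its
        -- premises lie outside `N`, so their colours are their sides of `ns`; these agree since
        -- `ns` is closed upwards and, by `isolated`, feeds no ⊗ node outside it.
        colour-premise : ∀ {a} v → a ∈ switchedPremises (node R v) (φ v) → colour v ≡ colour (tail a)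
        colour-premise {a} v i = go (view (node R v) (CutFree.no-cut cf v)) i
          where
          go : View (node R v) → a ∈ switchedPremises (node R v) (switch (node R v)) → colour v ≡ colour (tail a)
          go (initial n)  i = case subst (a ∈_) (initial-prem n) (kept⇒premise (node R v) (φ v) i) of λ ()
          go (leaf n)     i = case subst (a ∈_) (leaf-prem n) (kept⇒premise (node R v) (φ v) i) of λ ()
          go (der {p} e)  i with here refl ← subst (λ x → a ∈ premises x) e (kept⇒premise (node R v) (φ v) i) =
            colour-next (subst (λ x → Next pick x p) (sym e) der)
          go (binary b)   i = trans (colour-next (binary b)) (cong (colour ∘ tail) (sym (keeps-pick b i)))
          go (tensor {p} {q} e) i = trans (colour-outside v∉N)
            (trans (sym (same-side {a} {v} (closed′ , isolated′))) (sym (colour-outside (tensor-premise e a∈))))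
            where
            v∉N = tensor∉N e
            a∈ : a ∈ prem v
            a∈ = kept⇒premise (node R v) (φ v) i
            closed′ : v ∈ ns → tail a ∈ ns
            closed′ v∈ = closed v∈ a∈
            isolated′ : v ∉ ns → tail a ∉ ns
            isolated′ v∉ t∈ = isolated v∉ v∉N (subst (Touch _ _) (sym e) (case subst (λ x → a ∈ premises x) e a∈ of λ where
              (here refl)         → inj₁ t∈
              (there (here refl)) → inj₂ t∈))

        vertex-colour : SwitchVertex R → Colour
        vertex-colour (internal v) = colour v
        vertex-colour (• i)        = colour (tail (lookup (concl R) i))
        vertex-colour (fresh v s)  = colour (tail (detached s (φ v s)))

        G : Graph
        G = switchingGraph R φ

        vertex-premise : ∀ {a} x → a ∈ Graph.premises G x → colour (tail a) ≡ vertex-colour x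
        vertex-premise (internal v) i           = sym (colour-premise v i)
        vertex-premise (• i)        (here refl) = refl
        vertex-premise (fresh v s)  (here refl) = refl

        walk-colour : ∀ {x y} → Walk G x y → vertex-colour x ≡ vertex-colour y
        walk-colour w = conn-invariant 𝔾 {as = allFin (arcs R)} vertex-colour
          (λ {a} _ → vertex-premise (FiniteGraph.tgt 𝔾 a) (proj₂ (FiniteGraph.edge 𝔾 a)))
          (walk⇒conn 𝔾 ∈-allFin w)
          where 𝔾 = switching φ

        source-kind : ∀ {v} → IsInitial (node R v) → colour v ≡ side-colour v
        source-kind {v} n = trans (colour-is (source (none n))) (side-kind n)
          where
          none : ∀ {x : Node (arcs R)} → IsInitial x → ¬ ∃ (Next pick x)
          none ax  (_ , binary ())
          none one (_ , binary ())
          none box (_ , binary ())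
          side-kind : IsInitial (node R v) → source-colour v ≡ side-colour v
          side-kind n with node R v | n
          ... | _ | ax  = refl
          ... | _ | one = refl
          ... | _ | box = refl

        W : List (Fin (nodes R))
        W = filterᵇ (isWeakening ∘ node R) V

        weakening-colour : ∀ {v} → v ∈ W → colour v ≡ inj₁ v
        weakening-colour {v} i = trans (colour-is (source (none (node R v) w)))
          (cong (λ b → if b then inj₁ v else side-colour v) (Equivalence.to T-≡ w))
          where
          w : IsTrue (isWeakening (node R v))
          w = proj₂ (∈-filter⁻ (λ v → T? (isWeakening (node R v))) {xs = V} i)
          none : ∀ (x : Node (arcs R)) → IsTrue (isWeakening x) → ¬ ∃ (Next pick x)
          none (bot a)  _ (_ , binary ())
          none (weak a) _ (_ , binary ())

      -- The ♯w weakening nodes, u and v have pairwise distinct colours.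
      no-isolated-part : (∀ φ → HasComponents (switchingGraph R φ) (♯w R + 1)) →
                         ∀ {u v} → IsInitial (node R u) → IsInitial (node R v) → u ∈ ns → v ∉ ns → Empty
      no-isolated-part components {u} {v} iu iv u∈ v∉ =
        -- `length W` is `♯w R` by definition, so `reps` has one entry more than there are
        -- components.
        let i , j , i<j , e = pigeonhole (s≤s (ℕ.≤-reflexive (+-comm (♯w R) 1))) (component ∘ internal ∘ List.lookup reps)
        in ℕ.<⇒≢ i<j (cong toℕ (reps-injective (walk-colour (Equivalence.to (connected _ _) e))))
        where
        open HasComponents (components φ)
        reps : List (Fin (nodes R))
        reps = u ∷ v ∷ W
        u-colour : colour u ≡ inj₂ true
        u-colour = trans (source-kind iu) (cong inj₂ (dec-true (u ∈? ns) u∈))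
        v-colour : colour v ≡ inj₂ false
        v-colour = trans (source-kind iv) (cong inj₂ (dec-false (v ∈? ns) v∉))
        colours : ∀ ws → (∀ {w} → w ∈ ws → colour w ≡ inj₁ w) → List.map colour ws ≡ List.map inj₁ ws
        colours []       f = refl
        colours (w ∷ ws) f = cong₂ _∷_ (f (here refl)) (colours ws (f ∘ there))
        unique : Unique (List.map colour reps)
        unique = subst Unique (sym (cong₂ _∷_ u-colour (cong₂ _∷_ v-colour (colours W weakening-colour))))
          (((λ ()) ∷ All.tabulate (λ i e → case ∈-map⁻ inj₁ i of λ { (_ , _ , refl) → case e of λ () }))
           ∷ All.tabulate (λ i e → case ∈-map⁻ inj₁ i of λ { (_ , _ , refl) → case e of λ () })
           ∷ Unique.map⁺ (λ { refl → refl }) (Unique.filter⁺ (λ v → T? (isWeakening (node R v))) (allFin⁺ _)))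
        reps-injective : ∀ {i j} → colour (List.lookup reps i) ≡ colour (List.lookup reps j) → i ≡ j
        reps-injective {i} {j} e = map-injective reps unique e
          where
          map-injective : ∀ xs → Unique (List.map colour xs) → ∀ {i j} →
                          colour (List.lookup xs i) ≡ colour (List.lookup xs j) → i ≡ j
          map-injective (x ∷ xs) (n ∷ un) {zero}  {zero}  e = refl
          map-injective (x ∷ xs) (n ∷ un) {zero}  {suc j} e = contradiction e (All.lookup n (∈-map⁺ colour (∈-lookup j)))
          map-injective (x ∷ xs) (n ∷ un) {suc i} {zero}  e = contradiction (sym e) (All.lookup n (∈-map⁺ colour (∈-lookup i)))
          map-injective (x ∷ xs) (n ∷ un) {suc i} {suc j} e = cong suc (map-injective xs un e)

-- Parsing R with clusters

lookup-pair-↭ : {X : Set} (xs : List X) {i j : Fin (length xs)} → i ≢ j →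
                ∃ λ ys → xs ↭ List.lookup xs i ∷ List.lookup xs j ∷ ys
lookup-pair-↭ (x ∷ xs) {zero}  {zero}  i≢j = contradiction refl i≢j
lookup-pair-↭ (x ∷ xs) {zero}  {suc j} i≢j with ys , p ← ∈⇒↭∷ (∈-lookup {xs = xs} j) = ys , ↭-prep x p
lookup-pair-↭ (x ∷ xs) {suc i} {zero}  i≢j with ys , p ← ∈⇒↭∷ (∈-lookup {xs = xs} i) =
  ys , ↭-trans (↭-prep x p) (↭.swap x _ ↭-refl)
lookup-pair-↭ (x ∷ xs) {suc i} {suc j} i≢j with ys , p ← lookup-pair-↭ xs (i≢j ∘ cong suc) =
  x ∷ ys , ↭-trans (↭-prep x p) (↭-sym (shift x (_ ∷ _ ∷ []) ys))

-- A move found for any one cluster ends the search; failing that, exits for all clusters are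
-- available together, as the pigeonhole argument requires.
each-or-some : {X : Set} {n : ℕ} {P : Fin n → Set} → (∀ i → X ⊎ P i) → X ⊎ (∀ i → P i)
each-or-some {n = zero}  f = inj₂ λ ()
each-or-some {n = suc n} f with f zero | each-or-some (f ∘ suc)
... | inj₁ x | _      = inj₁ x
... | inj₂ _ | inj₁ x = inj₁ x
... | inj₂ p | inj₂ g = inj₂ λ { zero → p ; (suc i) → g i }

concatMap-owner : {X Y : Set} (f : X → List Y) {xs : List X} → Unique (concatMap f xs) →
                  ∀ {x x′ y} → x ∈ xs → x′ ∈ xs → y ∈ f x → y ∈ f x′ → x ≡ x′
concatMap-owner f {x ∷ xs} u (here refl) (here refl) i j = refl
concatMap-owner f {x ∷ xs} u (here refl) (there x′∈) i j =
  contradiction (∈-concatMap {f = f} x′∈ j) (Unique-++-disjoint (f x) u i)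
concatMap-owner f {x ∷ xs} u (there x∈)  (here refl) i j =
  contradiction (∈-concatMap {f = f} x∈ i) (Unique-++-disjoint (f x) u j)
concatMap-owner f {x ∷ xs} u (there x∈)  (there x′∈) i j =
  concatMap-owner f (Unique-++⁻ʳ (f x) u) x∈ x′∈ i j

singleton : {X : Set} (xs : List X) → length xs ≡ 1 → ∃ λ x → xs ≡ [ x ]
singleton (x ∷ []) refl = x , refl

inhabited : {X : Set} {n : ℕ} (xs : List X) → length xs ≡ suc n → ∃ λ x → x ∈ xs
inhabited (x ∷ xs) _ = x , here refl

module Sequentialization (𝒜 : Atoms) where
  open MELL 𝒜
  open Nodes 𝒜
  open Sequents 𝒜
  open Parsing 𝒜
  open Colouring 𝒜

  -- Supplies the vertices that the colouring tells apart, one inside the isolated cluster and one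
  -- inside another.
  seq-initial : ∀ {c} {R : PreStructure c} {ns cs} → Seq R ns cs → ∃ λ v → v ∈ ns × IsInitial (node R v)
  seq-initial (init {v} i)   = v , here refl , i
  seq-initial (leaf _ s)     with v , v∈ , i ← seq-initial s = v , there v∈ , i
  seq-initial (der _ s)      with v , v∈ , i ← seq-initial s = v , there v∈ , i
  seq-initial (binary _ s)   with v , v∈ , i ← seq-initial s = v , there v∈ , i
  seq-initial (tensor _ s t) with v , v∈ , i ← seq-initial s = v , there (∈-++⁺ˡ v∈) , i
  seq-initial (resp p _ s)   with v , v∈ , i ← seq-initial s = v , ∈-resp-↭ p v∈ , i

  module _ {c : ℕ} (R : PreStructure c) (ps : IsProofStructure R)
           (frag : R OfFragment ¬?⊗LL) (cf : CutFree R) (acc♯w : ACC♯w R) where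
    open Ground R (IsProofStructure.well-formed ps)
    open Borders R (IsProofStructure.well-formed ps)
    open Trees R ps frag
    open Saturated saturation using () renaming (trees to trees₀; rest to rest₀; split to split₀; saturated to saturated₀)
    open DecMembership (Fin._≟_ {nodes R}) using (_∈?_)

    touch-initial : ∀ {m} {P Q : Fin m → Set} {x} → IsInitial x → ¬ Touch P Q x
    touch-initial ax  t = t
    touch-initial one t = t
    touch-initial box t = t

    N : List (Fin (nodes R))
    N = treeNodes trees₀

    ∉N⇒rest : ∀ {v} → v ∉ N → v ∈ rest₀
    ∉N⇒rest {v} v∉N with ∈-++⁻ N (∈-resp-↭ (↭-sym split₀) (∈-allFin v))
    ... | inj₁ v∈N = contradiction v∈N v∉N
    ... | inj₂ v∈  = v∈

    rest⇒∉N : ∀ {v} → v ∈ rest₀ → v ∉ N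
    rest⇒∉N v∈ v∈N = Unique-++-disjoint N (Unique-resp-↭ (↭-sym split₀) (allFin⁺ _)) v∈N v∈

    initials-joins : ∑ᴿ initials ≡ suc (∑ᴿ joins)
    initials-joins = ℕ.+-cancelˡ-≡ (arcs R + ♯w R) _ _ (begin
      (arcs R + ♯w R) + ∑ᴿ initials                                ≡⟨ size-count φ ⟨
      FiniteGraph.size (switching φ) + ∑ᴿ joins
        ≡⟨ cong (_+ ∑ᴿ joins) (euler (switching φ) (allFin (arcs R)) ∈-allFin (allFin⁺ _)
             (ACC♯w.acyclic acc♯w φ) (ACC♯w.components acc♯w φ)) ⟩
      (length (allFin (arcs R)) + (♯w R + 1)) + ∑ᴿ joins           ≡⟨ cong (λ n → (n + (♯w R + 1)) + ∑ᴿ joins) |A|≡ ⟩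
      (arcs R + (♯w R + 1)) + ∑ᴿ joins
        ≡⟨ solve 3 (λ a w j → (a :+ (w :+ con 1)) :+ j := (a :+ w) :+ (con 1 :+ j)) refl (arcs R) (♯w R) (∑ᴿ joins) ⟩
      (arcs R + ♯w R) + suc (∑ᴿ joins) ∎)
      where
      open ≡-Reasoning
      open +-*-Solver
      -- The resulting equation does not mention the switching, so any choice serves.
      φ : Switching R
      φ _ _ = left
      |A|≡ : length (allFin (arcs R)) ≡ arcs R
      |A|≡ = List.length-tabulate id

    -- `clean` says that grafted trees are never left open: their roots are used up at once by a ⅋
    -- or ?c node. Hence a premise of a waiting node with tail in `N` comes from a tree still at
    -- hand.
    record Cluster : Set where
      constructor cluster
      field
        {members} : List (Fin (nodes R))
        {outputs} : List (Fin (arcs R))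
        seq       : Seq R members outputs
        clean     : ∀ {a} → a ∈ outputs → tail a ∉ N

    open Cluster

    clusterNodes : List Cluster → List (Fin (nodes R))
    clusterNodes = concatMap members

    -- The invariant of parsing, where ws are the nodes waiting to join a cluster.
    record State (n : ℕ) : Set where
      field
        clusters : List Cluster
        trees    : List TreeItem
        ws       : List (Fin (nodes R))
        split    : clusterNodes clusters ⊕ treeNodes trees ⊕ ws ↭ V
        trees⊆N  : ∀ {v} → v ∈ treeNodes trees → v ∈ N
        ws∉N     : ∀ {v} → v ∈ ws → v ∉ N
        ws-inner : ∀ {v} → v ∈ ws → ¬ IsInitial (node R v)
        count    : length clusters ≡ suc (∑ₙ ws joins)
        size     : length ws ≡ n

    private
      classify : ∀ vs → (∀ {v} → v ∈ vs → v ∉ N) → ∃₂ λ clusters ws →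
                 clusterNodes clusters ⊕ ws ↭ vs × length clusters ≡ ∑ₙ vs initials ×
                 ∑ₙ ws joins ≡ ∑ₙ vs joins × (∀ {v} → v ∈ ws → ¬ IsInitial (node R v))
      classify [] _ = [] , [] , ↭-refl , refl , refl , λ ()
      classify (v ∷ vs) vs∉N with classify vs (vs∉N ∘ there) | isInitial? (node R v)
      ... | cl , ws , p , len , js , inner | yes i =
        cluster (init i) (λ a∈ t∈N → vs∉N (here refl) (subst (_∈ N) (sym (tail-unique a∈)) t∈N)) ∷ cl , ws ,
        ↭-prep v p , cong₂ _+_ (one-initial i) len , trans js (cong (_+ ∑ₙ vs joins) (no-join i)) , inner
        where
        one-initial : ∀ {x : Node (arcs R)} → IsInitial x → 1 ≡ initials x
        one-initial ax  = refl
        one-initial one = refl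
        one-initial box = refl
        no-join : ∀ {x : Node (arcs R)} → IsInitial x → 0 ≡ joins x
        no-join ax  = refl
        no-join one = refl
        no-join box = refl
      ... | cl , ws , p , len , js , inner | no ¬i =
        cl , v ∷ ws , ↭-trans (shift v (clusterNodes cl) ws) (↭-prep v p) ,
        trans len (cong (_+ ∑ₙ vs initials) (not-initial (node R v) ¬i)) , cong (joins (node R v) +_) js ,
        λ { (here refl) → ¬i ; (there j) → inner j }
        where
        not-initial : ∀ (x : Node (arcs R)) → ¬ IsInitial x → 0 ≡ initials x
        not-initial (ax a b)       n = contradiction ax n
        not-initial (cut p q)      n = refl
        not-initial (one a)        n = contradiction one n
        not-initial (bot a)        n = refl
        not-initial (tensor p q a) n = refl
        not-initial (par p q a)    n = refl
        not-initial (weak a)       n = refl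
        not-initial (contr p q a)  n = refl
        not-initial (der p a)      n = refl
        not-initial (box S i as)   n = contradiction box n

      -- Tree nodes are neither initial nor ⊗ nodes, so the count made for all of R holds for the
      -- remaining nodes as well.
      rest-∑ : ∀ f → (∀ {v} → v ∈ N → f (node R v) ≡ 0) → ∑ₙ rest₀ f ≡ ∑ᴿ f
      rest-∑ f z = sym (trans (sym (∑-↭ (f ∘ node R) split₀)) (trans (∑-++ (f ∘ node R) N rest₀)
        (cong (_+ ∑ₙ rest₀ f) (∑-zero N z))))

    start : ∃ State
    start with cl , ws , p , len , js , inner ← classify rest₀ rest⇒∉N = length ws , record
      { clusters = cl
      ; trees    = trees₀
      ; ws       = ws
      ; split    = ↭-trans (solve 3 (λ a b c → a ⊙ (b ⊙ c) ⊜ b ⊙ (a ⊙ c)) ↭-refl (clusterNodes cl) N ws)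
                     (↭-trans (++⁺ˡ N p) split₀)
      ; trees⊆N  = id
      ; ws∉N     = λ v∈ → rest⇒∉N (∈-resp-↭ p (∈-++⁺ʳ (clusterNodes cl) v∈))
      ; ws-inner = inner
      ; count    = trans len (trans (rest-∑ initials (proj₂ ∘ items-derived trees₀))
          (trans initials-joins (cong suc (sym (trans js (rest-∑ joins (proj₁ ∘ items-derived trees₀)))))))
      ; size     = refl
      }
      where open ↭Solver using (solve; _⊜_) renaming (_⊕_ to _⊙_)

    module Step {n : ℕ} (S : State n) where
      open State S

      split-unique : Unique (clusterNodes clusters ⊕ treeNodes trees ⊕ ws)
      split-unique = Unique-resp-↭ (↭-sym split) (allFin⁺ _)

      cluster∌waiting : ∀ {k v} → k ∈ clusters → v ∈ ws → v ∉ members k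
      cluster∌waiting k∈ v∈ i = Unique-++-disjoint (clusterNodes clusters) split-unique
        (∈-concatMap {f = members} k∈ i) (∈-++⁺ʳ (treeNodes trees) v∈)

      tree∌waiting : ∀ {t v} → t ∈ trees → v ∈ ws → v ∉ items t
      tree∌waiting t∈ v∈ i = Unique-++-disjoint (treeNodes trees)
        (Unique-++⁻ʳ (clusterNodes clusters) split-unique) (∈-concatMap {f = items} t∈ i) v∈

      data Location (v : Fin (nodes R)) : Set where
        in-cluster : ∀ {k} → k ∈ clusters → v ∈ members k → Location v
        in-tree    : ∀ {t} → t ∈ trees → v ∈ items t → Location v
        waiting    : v ∈ ws → Location v

      locate : ∀ v → Location v
      locate v with ∈-++⁻ (clusterNodes clusters) (∈-resp-↭ (↭-sym split) (∈-allFin v))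
      ... | inj₁ i with k , k∈ , j ← concatMap-∈ members clusters i = in-cluster k∈ j
      ... | inj₂ i with ∈-++⁻ (treeNodes trees) i
      ...   | inj₁ j with t , t∈ , l ← concatMap-∈ items trees j = in-tree t∈ l
      ...   | inj₂ j = waiting j

      cluster-output : ∀ {k v p} → k ∈ clusters → v ∈ ws → p ∈ prem v → tail p ∈ members k → p ∈ outputs k
      cluster-output {k} k∈ v∈ = border-premise (seq-border (seq k)) (cluster∌waiting k∈ v∈)

      tree-root : ∀ {v p} → v ∈ ws → p ∈ prem v → tail p ∈ N → ∃ λ t → t ∈ trees × p ≡ root t
      tree-root {p = p} v∈ p∈ t∈N with locate (tail p)
      ... | in-cluster {k} k∈ i = contradiction t∈N (clean k (cluster-output k∈ v∈ p∈ i))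
      ... | waiting i           = contradiction t∈N (ws∉N i)
      ... | in-tree {t} t∈ i with here eq ← border-premise (tree-border (tree t)) (tree∌waiting t∈ v∈) p∈ i = t , t∈ , eq

    -- A move consumes a waiting node, so none exists from `State zero`. Computing the target from
    -- `n` spares the moves a case distinction on `n`.
    Moved : ℕ → Set
    Moved zero    = Empty
    Moved (suc n) = State n

    module _ {n : ℕ} (S : State n) where
      open State S
      open Step S

      -- Replace the clusters ks, the trees ts and the node v by the cluster k.
      move : ∀ {v} → v ∈ ws → ∀ ks {ks′} → clusters ↭ ks ⊕ ks′ → ∀ ts {ts′} → trees ↭ ts ⊕ ts′ →
             length ks ≡ suc (joins (node R v)) → (k : Cluster) →
             members k ↭ v ∷ clusterNodes ks ⊕ treeNodes ts → Moved n
      move {v} v∈ ks {ks′} pk ts {ts′} pt len k mk with ws′ , pw ← ∈⇒↭∷ v∈ = moved n size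
        where
        open ↭Solver using (solve; _⊜_) renaming (_⊕_ to _⊙_)
        split′ : members k ⊕ clusterNodes ks′ ⊕ treeNodes ts′ ⊕ ws′ ↭ V
        split′ = ↭-trans (++⁺ʳ _ mk) (↭-trans
          (solve 6 (λ v a b c d e → (v ⊙ (a ⊙ b)) ⊙ (c ⊙ (d ⊙ e)) ⊜ (a ⊙ c) ⊙ ((b ⊙ d) ⊙ (v ⊙ e))) ↭-refl
            List.[ v ] (clusterNodes ks) (treeNodes ts) (clusterNodes ks′) (treeNodes ts′) ws′)
          (↭-trans (++⁺
            (↭-trans (↭-reflexive (sym (List.concatMap-++ members ks ks′))) (↭-sym (concatMap-↭ members pk)))
            (++⁺ (↭-trans (↭-reflexive (sym (List.concatMap-++ items ts ts′))) (↭-sym (concatMap-↭ items pt)))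
              (↭-sym pw))) split))
        trees⊆ : ∀ {u} → u ∈ treeNodes ts′ → u ∈ N
        trees⊆ u∈ = trees⊆N (∈-resp-↭ (↭-sym (concatMap-↭ items pt))
          (subst (_ ∈_) (sym (List.concatMap-++ items ts ts′)) (∈-++⁺ʳ (treeNodes ts) u∈)))
        -- A ⊗ node leaves the waiting list and turns two clusters into one; any other node
        -- exchanges one cluster for one. Both sides of `count` thus drop by `joins (node R v)`.
        count′ : suc (length ks′) ≡ suc (∑ₙ ws′ joins)
        count′ = cong suc (ℕ.+-cancelˡ-≡ (suc (joins (node R v))) _ _ (begin
          suc (joins (node R v)) + length ks′   ≡⟨ cong (_+ length ks′) len ⟨
          length ks + length ks′                ≡⟨ List.length-++ ks ⟨
          length (ks ⊕ ks′)                     ≡⟨ ↭-length pk ⟨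
          length clusters                       ≡⟨ count ⟩
          suc (∑ₙ ws joins)                     ≡⟨ cong suc (∑-↭ (joins ∘ node R) pw) ⟩
          suc (joins (node R v)) + ∑ₙ ws′ joins ∎))
          where open ≡-Reasoning
        moved : ∀ n → length ws ≡ n → Moved n
        moved zero    e = case trans (sym e) (↭-length pw) of λ ()
        moved (suc n) e = record
          { clusters = k ∷ ks′
          ; trees    = ts′
          ; ws       = ws′
          ; split    = ↭-trans (↭-reflexive (List.++-assoc (members k) (clusterNodes ks′) _)) split′
          ; trees⊆N  = trees⊆
          ; ws∉N     = λ i → ws∉N (∈-resp-↭ (↭-sym pw) (there i))
          ; ws-inner = λ i → ws-inner (∈-resp-↭ (↭-sym pw) (there i))
          ; count    = count′
          ; size     = suc-injective (trans (sym (↭-length pw)) e)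
          }

      private
        clean-cons : ∀ {v a} {as bs : List (Fin (arcs R))} → v ∈ ws → conc v ≡ [ a ] →
                     (∀ {b} → b ∈ as → b ∈ bs) → (∀ {b} → b ∈ bs → tail b ∉ N) →
                     ∀ {b} → b ∈ a ∷ as → tail b ∉ N
        clean-cons {v} {a} v∈ ev sub cl (here refl) =
          subst (_∉ N) (tail-unique (subst (a ∈_) (sym ev) (here refl))) (ws∉N v∈)
        clean-cons v∈ ev sub cl (there i) = cl (sub i)

        single : ∀ {X : Set} {k : X} {ks} → k ∈ ks → ∃ λ ks′ → ks ↭ [ k ] ⊕ ks′
        single = ∈⇒↭∷

        in-prem : ∀ {v x p} → node R v ≡ x → p ∈ premises x → p ∈ prem v
        in-prem refl i = i

        premise≢ : ∀ {v p q a} → IsBinary (node R v) p q a → p ≢ q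
        premise≢ {v} b refl = case subst Unique (binary-prem b) (prem-unique v) of λ { ((n ∷ []) ∷ _) → n refl }

      module _ {v : Fin (nodes R)} (v∈ : v ∈ ws) {k : Cluster} (k∈ : k ∈ clusters) where

        move-der : ∀ {p a} → node R v ≡ der p a → tail p ∈ members k → Moved n
        move-der {p} {a} e t∈ with os , r ← ∈⇒↭∷ (cluster-output k∈ v∈ (in-prem e (here refl)) t∈) =
          move v∈ [ k ] (proj₂ (single k∈)) [] ↭-refl (cong (suc ∘ joins) (sym e))
            (cluster (der e (resp ↭-refl r (seq k)))
              (clean-cons v∈ (cong conclusions e) (∈-resp-↭ (↭-sym r) ∘ there) (clean k)))
            (↭-prep v (↭-reflexive (sym (trans (List.++-identityʳ (members k ⊕ [])) (List.++-identityʳ (members k))))))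

        module _ {p q a : Fin (arcs R)} (b : IsBinary (node R v) p q a) where
          private
            p∈ : p ∈ prem v
            p∈ = subst (p ∈_) (sym (binary-prem b)) (here refl)
            q∈ : q ∈ prem v
            q∈ = subst (q ∈_) (sym (binary-prem b)) (there (here refl))
            joins≡ : 1 ≡ suc (joins (node R v))
            joins≡ = cong suc (sym (proj₁ (binary-derived b)))

          move-binary : tail p ∈ members k → tail q ∈ members k → Moved n
          move-binary tp tq with os , r ← ∈∈⇒↭∷∷ (cluster-output k∈ v∈ p∈ tp) (cluster-output k∈ v∈ q∈ tq) (premise≢ b) =
            move v∈ [ k ] (proj₂ (single k∈)) [] ↭-refl joins≡
              (cluster (binary b (resp ↭-refl r (seq k)))
                (clean-cons v∈ (binary-conc b) (∈-resp-↭ (↭-sym r) ∘ there ∘ there) (clean k)))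
              (↭-prep v (↭-reflexive (sym (trans (List.++-identityʳ (members k ⊕ [])) (List.++-identityʳ (members k))))))

          private
            tree-↭ : ∀ t → v ∷ items t ⊕ members k ↭ v ∷ (members k ⊕ []) ⊕ (items t ⊕ [])
            tree-↭ t = ↭-prep v (solve 2 (λ a b → a ⊙ b ⊜ (b ⊙ :0) ⊙ (a ⊙ :0)) ↭-refl (items t) (members k))
              where
              open ↭Solver using (solve; _⊜_) renaming (_⊕_ to _⊙_; id to :0)

          move-binaryˡ : tail p ∈ members k → tail q ∈ N → Moved n
          move-binaryˡ tp tq with t , t∈ , refl ← tree-root v∈ q∈ tq
            with os , r ← ∈⇒↭∷ (cluster-output k∈ v∈ p∈ tp) =
            move v∈ [ k ] (proj₂ (single k∈)) [ t ] (proj₂ (single t∈)) joins≡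
              (cluster (binary b (resp ↭-refl (↭.swap _ _ ↭-refl) (graft R (tree t) (resp ↭-refl r (seq k)))))
                (clean-cons v∈ (binary-conc b) (∈-resp-↭ (↭-sym r) ∘ there) (clean k)))
              (tree-↭ t)

          move-binaryʳ : tail p ∈ N → tail q ∈ members k → Moved n
          move-binaryʳ tp tq with t , t∈ , refl ← tree-root v∈ p∈ tp
            with os , r ← ∈⇒↭∷ (cluster-output k∈ v∈ q∈ tq) =
            move v∈ [ k ] (proj₂ (single k∈)) [ t ] (proj₂ (single t∈)) joins≡
              (cluster (binary b (graft R (tree t) (resp ↭-refl r (seq k))))
                (clean-cons v∈ (binary-conc b) (∈-resp-↭ (↭-sym r) ∘ there) (clean k)))
              (tree-↭ t)

      move-tensor : ∀ {v p q a k l ks} → v ∈ ws → node R v ≡ tensor p q a → clusters ↭ k ∷ l ∷ ks →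
                    tail p ∈ members k → tail q ∈ members l → Moved n
      move-tensor {v} {p} {q} {a} {k} {l} v∈ e r tp tq
        with os , rk ← ∈⇒↭∷ (cluster-output (∈-resp-↭ (↭-sym r) (here refl)) v∈ (in-prem e (here refl)) tp)
           | qs , rl ← ∈⇒↭∷ (cluster-output (∈-resp-↭ (↭-sym r) (there (here refl))) v∈ (in-prem e (there (here refl))) tq) =
        move v∈ (k ∷ l ∷ []) r [] ↭-refl (cong (suc ∘ joins) (sym e))
          (cluster (tensor e (resp ↭-refl rk (seq k)) (resp ↭-refl rl (seq l)))
            (clean-cons v∈ (cong conclusions e) sub λ i → [ clean k , clean l ]′ (∈-++⁻ (outputs k) i)))
          (↭-prep v (solve 2 (λ a b → a ⊙ b ⊜ (a ⊙ (b ⊙ :0)) ⊙ :0) ↭-refl (members k) (members l)))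
        where
        open ↭Solver using (solve; _⊜_) renaming (_⊕_ to _⊙_; id to :0)
        sub : ∀ {x} → x ∈ os ⊕ qs → x ∈ outputs k ⊕ outputs l
        sub i with ∈-++⁻ os i
        ... | inj₁ j = ∈-++⁺ˡ (∈-resp-↭ (↭-sym rk) (there j))
        ... | inj₂ j = ∈-++⁺ʳ (outputs k) (∈-resp-↭ (↭-sym rl) (there j))

      Touches : Cluster → Fin (nodes R) → Set
      Touches k v = Touch (λ p → tail p ∈ members k) (λ p → tail p ∈ N) (node R v)

      Exit : Cluster → Set
      Exit k = ∃ λ v → v ∈ ws × ∃₂ λ p q → (∃ λ a → node R v ≡ tensor p q a) ×
               (tail p ∈ members k ⊎ tail q ∈ members k)

      saturated : ∀ {v} → v ∉ N → ¬ Below (λ p → tail p ∈ N) (node R v)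
      saturated v∉N = saturated₀ (∉N⇒rest v∉N)

      -- A touched node has its premises in the cluster or in trees, and saturation excludes trees
      -- alone, so it can be absorbed. Only a ⊗ node must wait for a second cluster.
      handle : ∀ {k v} → k ∈ clusters → v ∈ ws → Touches k v → Moved n ⊎ Exit k
      handle {k} {v} k∈ v∈ t with view (node R v) (CutFree.no-cut cf v)
      ... | initial i  = contradiction i (ws-inner v∈)
      ... | leaf l     = contradiction (below-leaf l) (saturated (ws∉N v∈))
      ... | der e      = inj₁ (move-der v∈ k∈ e (subst (Touch _ _) e t))
      ... | tensor e   = inj₂ (v , v∈ , _ , _ , (_ , e) , subst (Touch _ (λ p → tail p ∈ N)) e t)
      ... | binary b with binary-touch b t
      ...   | inj₁ i , inj₁ j = inj₁ (move-binary v∈ k∈ b i j)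
      ...   | inj₁ i , inj₂ j = inj₁ (move-binaryˡ v∈ k∈ b i j)
      ...   | inj₂ i , inj₁ j = inj₁ (move-binaryʳ v∈ k∈ b i j)
      ...   | inj₂ i , inj₂ j = contradiction (below-binary b i j) (saturated (ws∉N v∈))

      same-cluster : ∀ {k l v} → k ∈ clusters → l ∈ clusters → v ∈ members k → v ∈ members l → k ≡ l
      same-cluster = concatMap-owner members (Unique-++⁻ˡ (clusterNodes clusters) split-unique)

      -- Otherwise some switching would cut the cluster k off from the others.
      touched : 2 ≤ length clusters → ∀ {k} → k ∈ clusters → ∃ λ v → v ∈ ws × Touches k v
      touched two {k} k∈ with any? (λ v → touch? (λ p → tail p ∈? members k) (λ p → tail p ∈? N) (node R v)) ws
      ... | yes some = find some
      ... | no none  = ⊥-elim (part-isolated two)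
        where
        closed : ∀ l {v p} → v ∈ members l → p ∈ prem v → tail p ∈ members l
        closed l = prem-tail (seq-border (seq l))
        tensor∉N : ∀ {v p q a} → node R v ≡ tensor p q a → v ∉ N
        tensor∉N e v∈ = case trans (sym (proj₁ (items-derived trees₀ v∈))) (cong joins e) of λ ()
        -- A waiting node is excluded by the failed search and a tree node by `v∉N`, which leaves
        -- the members of other clusters.
        isolated : ∀ {v} → v ∉ members k → v ∉ N → ¬ Touches k v
        isolated {v} v∉k v∉N t with locate v
        ... | waiting v∈   = none (lose v∈ t)
        ... | in-tree l∈ v∈ = v∉N (trees⊆N (∈-concatMap {f = items} l∈ v∈))
        -- `members l` is closed upwards, so a premise of `v` coming from `k` would put its tail in
        -- both clusters and force `l` to be `k`.
        ... | in-cluster {l} l∈ v∈ = apart (view (node R v) (CutFree.no-cut cf v))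
          where
          outside : ∀ {p} → p ∈ prem v → tail p ∉ members k
          outside p∈ i = v∉k (subst (λ l → v ∈ members l) (same-cluster l∈ k∈ (closed l v∈ p∈) i) v∈)
          apart : View (node R v) → Empty
          apart (initial i) = touch-initial i t
          apart (leaf l)   = saturated v∉N (below-leaf l)
          apart (der e)    = outside (in-prem e (here refl)) (subst (Touch _ _) e t)
          apart (tensor e) = [ outside (in-prem e (here refl)) , outside (in-prem e (there (here refl))) ]′
                               (subst (Touch _ (λ p → tail p ∈ N)) e t)
          apart (binary b) with binary-touch b t
          ... | inj₁ i , _      = outside (subst (_ ∈_) (sym (binary-prem b)) (here refl)) i
          ... | _      , inj₁ j = outside (subst (_ ∈_) (sym (binary-prem b)) (there (here refl))) j
          ... | inj₂ i , inj₂ j = saturated v∉N (below-binary b i j)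
        part-isolated : 2 ≤ length clusters → Empty
        part-isolated two with ks , r ← ∈⇒↭∷ k∈ = other ks r (subst (2 ≤_) (↭-length r) two)
          where
          other : ∀ ks → clusters ↭ k ∷ ks → 2 ≤ suc (length ks) → Empty
          other []       r (s≤s ())
          other (l ∷ ls) r _ with u , u∈ , iu ← seq-initial (seq k) | v , v∈ , iv ← seq-initial (seq l) =
            no-isolated-part R ps cf (members k) N (closed k) saturated (tensor-premise trees₀) tensor∉N isolated
              (ACC♯w.components acc♯w) iu iv u∈
              λ v∈k → Unique-++-disjoint (members k)
                (Unique-resp-↭ (concatMap-↭ members r) (Unique-++⁻ˡ (clusterNodes clusters) split-unique))
                v∈k (∈-++⁺ˡ v∈)

      -- By count there are fewer waiting ⊗ nodes than clusters, so if every cluster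
      -- exits to a ⊗ node, two of them exit to the same one, which can be moved.
      step-many : 2 ≤ length clusters → Moved n
      step-many two with each-or-some {P = Exit ∘ List.lookup clusters}
        (λ i → case touched two (∈-lookup i) of λ (v , v∈ , t) → handle (∈-lookup i) v∈ t)
      ... | inj₁ m = m
      ... | inj₂ exits = conclude (pigeonhole (ℕ.≤-reflexive (sym count′)) slot)
        where
        tensors : List (Fin (nodes R))
        tensors = filterᵇ (isJoin ∘ node R) ws
        count′ : length clusters ≡ suc (length tensors)
        count′ = trans count (cong suc (sym (length-filterᵇ (isJoin ∘ node R) ws)))
        exit∈ : ∀ i → proj₁ (exits i) ∈ tensors
        exit∈ i with v , v∈ , _ , _ , (_ , e) , _ ← exits i =
          ∈-filter⁺ (λ v → T? (isJoin (node R v))) v∈ (subst (IsTrue ∘ isJoin) (sym e) tt)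
        slot : Fin (length clusters) → Fin (length tensors)
        slot i = Any.index (exit∈ i)
        conclude : (∃₂ λ i j → toℕ i < toℕ j × slot i ≡ slot j) → Moved n
        conclude (i , j , i<j , same-slot)
          with ks , r ← lookup-pair-↭ clusters {i} {j} (λ { refl → ℕ.<-irrefl refl i<j })
          = meet (exits i) (exits j) same-node
          where
          k = List.lookup clusters i
          l = List.lookup clusters j
          same-node : proj₁ (exits i) ≡ proj₁ (exits j)
          same-node = trans (lookup-index (exit∈ i))
            (trans (cong (List.lookup tensors) same-slot) (sym (lookup-index (exit∈ j))))
          apart : ∀ {v} → v ∈ members k → v ∉ members l
          apart v∈k v∈l = Unique-++-disjoint (members k)
            (Unique-resp-↭ (concatMap-↭ members r) (Unique-++⁻ˡ (clusterNodes clusters) split-unique))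
            v∈k (∈-++⁺ˡ v∈l)
          -- Different clusters share no node, so they feed different premises of the ⊗ node.
          meet : (x : Exit k) (y : Exit l) → proj₁ x ≡ proj₁ y → Moved n
          meet (v , v∈ , _ , _ , (_ , e) , x) (_ , _ , _ , _ , (_ , e′) , y) refl with trans (sym e) e′ | x | y
          ... | refl | inj₁ p∈k | inj₁ p∈l = contradiction p∈l (apart p∈k)
          ... | refl | inj₂ q∈k | inj₂ q∈l = contradiction q∈l (apart q∈k)
          ... | refl | inj₁ p∈k | inj₂ q∈l = move-tensor v∈ e r p∈k q∈l
          ... | refl | inj₂ q∈k | inj₁ p∈l = move-tensor v∈ e (↭-trans r (↭.swap k l ↭-refl)) p∈l q∈k

      -- R has no directed cycle, so passing from a waiting node to a waiting tail of one of its
      -- premises comes to an end.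
      topmost : ∀ {v} → v ∈ ws → Acc (_⊏_ R ps cf) v → ∃ λ u → u ∈ ws × (∀ {p} → p ∈ prem u → tail p ∉ ws)
      topmost {v} v∈ (acc rs) with any? (λ p → tail p ∈? ws) (prem v)
      ... | no none = v , v∈ , λ p∈ t∈ → none (lose p∈ t∈)
      ... | yes some with p , p∈ , t∈ ← find some = topmost t∈ (rs (above R ps cf p∈))

      -- By `count` no ⊗ node is waiting. A topmost waiting node has all its premises in the only
      -- cluster or in trees, and by saturation not in trees alone, so the cluster absorbs it.
      step-single : length clusters ≡ 1 → ∀ {v} → v ∈ ws → Moved n
      step-single one′ v∈ with k , clusters≡ ← singleton clusters one′
        with u , u∈ , top ← topmost v∈ (⊏-wellFounded R ps cf _) = go (view (node R u) (CutFree.no-cut cf u))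
        where
        k∈ : k ∈ clusters
        k∈ = subst (k ∈_) (sym clusters≡) (here refl)
        source : ∀ {p} → p ∈ prem u → tail p ∈ members k ⊎ tail p ∈ N
        source {p} p∈ with locate (tail p)
        ... | waiting i    = contradiction i (top p∈)
        ... | in-tree t∈ i = inj₂ (trees⊆N (∈-concatMap {f = items} t∈ i))
        ... | in-cluster {l} l∈ i with here refl ← subst (l ∈_) clusters≡ l∈ = inj₁ i
        no-joins : joins (node R u) ≤ 0
        no-joins = subst (joins (node R u) ≤_) (suc-injective (trans (sym count) one′)) (∑-member (joins ∘ node R) u∈)
        no-exit : Moved n ⊎ Exit k → Moved n
        no-exit (inj₁ m) = m
        no-exit (inj₂ (v , v∈ , _ , _ , (_ , e) , _)) = case ℕ.≤-trans
          (subst (1 ≤_) (cong joins (sym e)) (s≤s z≤n))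
          (subst (joins (node R v) ≤_) (suc-injective (trans (sym count) one′)) (∑-member (joins ∘ node R) v∈)) of λ ()
        go : View (node R u) → Moved n
        go (initial i) = contradiction i (ws-inner u∈)
        go (leaf l)    = contradiction (below-leaf l) (saturated (ws∉N u∈))
        go (tensor e)  = case subst (_≤ 0) (cong joins e) no-joins of λ ()
        go (binary b)  = no-exit (handle k∈ u∈ (touch-binary b
          (source (subst (_ ∈_) (sym (binary-prem b)) (here refl)))
          (source (subst (_ ∈_) (sym (binary-prem b)) (there (here refl))))))
        go (der e) with source (in-prem e (here refl))
        ... | inj₁ i = move-der u∈ k∈ e i
        ... | inj₂ i = contradiction (subst (Below _) (sym e) i) (saturated (ws∉N u∈))

    step : ∀ {n} → State (suc n) → State n
    step S with inhabited (State.ws S) (State.size S) | ∑ₙ (State.ws S) joins in eq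
    ... | v , v∈ | zero  = step-single S (trans (State.count S) (cong suc eq)) v∈
    ... | v , v∈ | suc j = step-many S (subst (2 ≤_) (sym (trans (State.count S) (cong suc eq))) (s≤s (s≤s z≤n)))

    -- The trees left over when nothing is waiting are those whose roots are conclusions of R; no
    -- rule calls for them, and they are weakened in last.
    graft-all : ∀ ts {ns cs} → Seq R ns cs → ∃ λ ds → Seq R (treeNodes ts ⊕ ns) ds
    graft-all []       s = _ , s
    graft-all (t ∷ ts) s with ds , s′ ← graft-all ts s =
      _ , resp (↭-reflexive (sym (List.++-assoc (items t) (treeNodes ts) _))) ↭-refl (graft R (tree t) s′)

    finish : ∀ n → State n → ∃ λ cs → Seq R V cs
    finish (suc n) S = finish n (step S)
    finish zero    S = done (State.ws S) (State.size S) (State.count S) (State.split S)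
      where
      open State S using (clusters; trees)
      done : ∀ ws → length ws ≡ 0 → length clusters ≡ suc (∑ₙ ws joins) →
             clusterNodes clusters ⊕ treeNodes trees ⊕ ws ↭ V → ∃ λ cs → Seq R V cs
      done [] _ one′ split with k , clusters≡ ← singleton clusters one′
        with ds , s ← graft-all trees (seq k) = ds , resp (↭-trans
          (solve 2 (λ a b → a ⊙ b ⊜ (b ⊙ :0) ⊙ (a ⊙ :0)) ↭-refl (treeNodes trees) (members k))
          (subst (λ ks → clusterNodes ks ⊕ treeNodes trees ⊕ [] ↭ V) clusters≡ split)) ↭-refl s
        where open ↭Solver using (solve; _⊜_) renaming (_⊕_ to _⊙_; id to :0)

    sequentialization : ∃ λ cs → Seq R V cs
    sequentialization = finish _ (proj₂ start)

-- Induction on the nesting of boxes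

module Recursion (𝒜 : Atoms) where
  open MELL 𝒜
  open Completeness 𝒜
  open Sequentialization 𝒜

  correct⇒sequentialized : ∀ {c} (R : PreStructure c) → IsProofStructure R → R OfFragment ¬?⊗LL →
                           CutFree R → ACC♯w R → Sequentialized {¬?⊗LL} R
  content-sequentialized : ∀ {m} (x : Node m) → Content IsProofStructure x → Content (_OfFragment ¬?⊗LL) x →
                           Content CutFree x → Content ACC♯w x → Content (Sequentialized {¬?⊗LL}) x

  -- Exposing the field `node` shows the termination checker that the content of a box `x v` is
  -- smaller than R.
  correct⇒sequentialized R@(record { node = x }) ps frag cf acc♯w =
    Build.sequentialized R ps frag
      (λ v → content-sequentialized (x v) (IsProofStructure.contents ps v) (_OfFragment_.contents frag v)
                                    (CutFree.contents cf v) (ACC♯w.contents acc♯w v))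
      cf (proj₂ (sequentialization R ps frag cf acc♯w))

  content-sequentialized (ax a b)       _ _ _ _ = tt
  content-sequentialized (cut p q)      _ _ _ _ = tt
  content-sequentialized (one a)        _ _ _ _ = tt
  content-sequentialized (bot a)        _ _ _ _ = tt
  content-sequentialized (tensor p q a) _ _ _ _ = tt
  content-sequentialized (par p q a)    _ _ _ _ = tt
  content-sequentialized (weak a)       _ _ _ _ = tt
  content-sequentialized (contr p q a)  _ _ _ _ = tt
  content-sequentialized (der p a)      _ _ _ _ = tt
  content-sequentialized (box S i as)   = correct⇒sequentialized S

corollary70 : (𝒜 : Atoms) → let open MELL 𝒜 in
    {c : ℕ} (R : PreStructure c) →
    IsProofStructure R → R OfFragment ¬?⊗LL → CutFree R →
    ACC♯w R ⇔ Sequentializable ¬?⊗LL R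
corollary70 𝒜 R ps frag cf = mk⇔
  (λ acc♯w → _ , Recursion.correct⇒sequentialized 𝒜 R ps frag cf acc♯w)
  (λ (_ , π , iso) → Soundness.sequentializable⇒correct 𝒜 π R ps cf iso)
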